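{- Let $q$ be a prime power, $n\ge 1$, and let $\mathrm{M}=\{(m_{i,j})\in\mathrm{H}_n(q^2): m_{i,i}=0 \text{ for all } 1\le i\le n\}$. Then $\mathrm{M}$ is not a $t$-design for any $t\in\{1,\dots,n\}$.
   Context: $\mathrm{H}_n(q^2)$ is the set of Hermitian $n\times n$ matrices over $\mathbb{F}_{q^2}$ ($A^*=A$, $A^*$ = transpose of entrywise $q$-th power). Designs: with $\chi$ a nontrivial character of $(\mathbb{F}_q,+)$, $Q_k(i)=\sum_{A\in\mathrm{H}_n(q^2),\mathrm{rk}A=k}\chi(\mathrm{tr}(A^*B))$ for any $B\in\mathrm{H}_n(q^2)$ of rank $i$; for $\mathrm{C}\subseteq\mathrm{H}_n(q^2)$, $A_i=|\{(X,Y)\in\mathrm{C}^2:\mathrm{rk}(X-Y)=i\}|/|\mathrm{C}|$ and $A'_k=\sum_iQ_k(i)A_i$; $\mathrm{C}$ is a $t$-design if $A'_1=\dots=A'_t=0$. -}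

module Defs where

open import Level using (Level; 0ℓ)
open import Data.Nat as ℕ using (ℕ; zero; suc; _≤_)
open import Data.Nat.Primality using (Prime)
open import Data.Fin as Fin using (Fin)
open import Data.Fin.Properties using () renaming (_≟_ to _≟ᶠ_)
open import Data.Bool using (Bool; true; false; _∧_; _∨_; not; if_then_else_)
open import Data.List as List using (List; []; _∷_; filter; length; concatMap; allFin)
open import Data.List.Membership.Propositional using (_∈_)
open import Data.List.Relation.Unary.Unique.Propositional using (Unique)
open import Data.Product using (Σ; ∃; _×_; _,_)
open import Data.Sum using (_⊎_)
open import Relation.Nullary using (¬_; Dec; yes; no; does)
open import Relation.Binary.PropositionalEquality using (_≡_)
open import Algebra.Bundles using (CommutativeRing)
open import Algebra.Structures using (IsCommutativeRing)

record FiniteField : Set₁ where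
  infixl 6 _+_
  infixl 7 _*_
  field
    Carrier : Set
    _+_ _*_ : Carrier → Carrier → Carrier
    -_      : Carrier → Carrier
    0# 1#   : Carrier
    isCommutativeRing : IsCommutativeRing _≡_ _+_ _*_ -_ 0# 1#
    0≢1     : ¬ (0# ≡ 1#)
    inverse : ∀ x → ¬ (x ≡ 0#) → ∃ λ y → x * y ≡ 1#
    _≟_     : (x y : Carrier) → Dec (x ≡ y)
    elements : List Carrier
    complete : ∀ x → x ∈ elements
    unique   : Unique elements

  card : ℕ
  card = length elements

  _-_ : Carrier → Carrier → Carrier
  x - y = x + (- y)

  _^_ : Carrier → ℕ → Carrier
  x ^ zero  = 1#
  x ^ suc k = x * (x ^ k)

  _==_ : Carrier → Carrier → Bool
  x == y = does (x ≟ y)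

IsPrimePower : ℕ → Set
IsPrimePower q = Σ ℕ λ p → Σ ℕ λ m → Prime p × 1 ≤ m × q ≡ p ℕ.^ m

cons : ∀ {a} {A : Set a} {k} → A → (Fin k → A) → Fin (suc k) → A
cons x f Fin.zero    = x
cons x f (Fin.suc i) = f i

allB : ∀ {n} → (Fin n → Bool) → Bool
allB {n} P = List.foldr (λ i b → P i ∧ b) true (allFin n)


-- Matrices over a finite field F = F_{q^2}, where q² = |F|.

module Matrices (F : FiniteField) (q : ℕ) where
  open FiniteField F

  Vector : ℕ → Set
  Vector k = Fin k → Carrier

  Matrix : ℕ → Set
  Matrix n = Fin n → Fin n → Carrier

  sumF : ∀ k → (Fin k → Carrier) → Carrier
  sumF zero    f = 0#
  sumF (suc k) f = f Fin.zero + sumF k (λ i → f (Fin.suc i))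

  allVectors : ∀ k → List (Vector k)
  allVectors zero    = (λ ()) ∷ []
  allVectors (suc k) =
    concatMap (λ x → List.map (λ v → cons x v) (allVectors k)) elements

  allMatrices : ∀ n → List (Matrix n)
  allMatrices n = go n
    where
      go : ∀ k → List (Fin k → Fin n → Carrier)
      go zero    = (λ ()) ∷ []
      go (suc k) =
        concatMap (λ r → List.map (λ m → cons r m) (go k)) (allVectors n)

  conj : Carrier → Carrier
  conj x = x ^ q

  _* : ∀ {n} → Matrix n → Matrix n
  (A *) i j = conj (A j i)

  _-ᴹ_ : ∀ {n} → Matrix n → Matrix n → Matrix n
  (A -ᴹ B) i j = A i j - B i j

  _·ᴹ_ : ∀ {n} → Matrix n → Matrix n → Matrix n
  _·ᴹ_ {n} A B i j = sumF n (λ k → A i k * B k j)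

  trace : ∀ {n} → Matrix n → Carrier
  trace {n} A = sumF n (λ i → A i i)

  isHermitianB : ∀ {n} → Matrix n → Bool
  isHermitianB A = allB (λ i → allB (λ j → ((A *) i j) == A i j))

  hermitian : ∀ n → List (Matrix n)
  hermitian n = filter (λ A → isHermitianB A ≟B true) (allMatrices n)
    where
      _≟B_ : (a b : Bool) → Dec (a ≡ b)
      _≟B_ = Data.Bool._≟_
        where import Data.Bool

  isZeroVecB : ∀ {k} → Vector k → Bool
  isZeroVecB v = allB (λ i → v i == 0#)

  independentB : ∀ {n k} → Matrix n → (Fin k → Fin n) → Bool
  independentB {n} {k} A cols =
    List.foldr (λ a b → (not (isZeroVecB (λ r → sumF k (λ j → a j * A r (cols j))))
                         ∨ isZeroVecB a) ∧ b)
               true (allVectors k)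

  injectiveB : ∀ {n k} → (Fin k → Fin n) → Bool
  injectiveB cols =
    allB (λ i → allB (λ j →
      not (does (cols i ≟ᶠ cols j)) ∨ does (i ≟ᶠ j)))

  allMaps : ∀ n k → List (Fin k → Fin n)
  allMaps n zero    = (λ ()) ∷ []
  allMaps n (suc k) =
    concatMap (λ x → List.map (λ f → cons x f) (allMaps n k)) (allFin n)

  hasIndepB : ∀ {n} → Matrix n → ℕ → Bool
  hasIndepB {n} A k =
    List.foldr (λ c b → (injectiveB c ∧ independentB A c) ∨ b) false (allMaps n k)

  rank : ∀ {n} → Matrix n → ℕ
  rank {n} A = go n
    where
      go : ℕ → ℕ
      go zero    = zero
      go (suc k) = if hasIndepB A (suc k) then suc k else go k

  diagOnes : ∀ n → ℕ → Matrix n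
  diagOnes n i r c =
    if does (r ≟ᶠ c) ∧ does (Fin.toℕ r ℕ.<? i) then 1# else 0#

module Designs (F : FiniteField) (q : ℕ)
               {c ℓ : Level} (R : CommutativeRing c ℓ) where
  open FiniteField F using (Carrier; elements)
  open Matrices F q
  module R = CommutativeRing R

  sumR : ∀ {a} {A : Set a} → List A → (A → R.Carrier) → R.Carrier
  sumR []       f = R.0#
  sumR (x ∷ xs) f = f x R.+ sumR xs f

  fromℕ : ℕ → R.Carrier
  fromℕ zero    = R.0#
  fromℕ (suc k) = R.1# R.+ fromℕ k

  module _ {n : ℕ} (χ : Carrier → R.Carrier) where
    Q′ : ℕ → Matrix n → R.Carrier
    Q′ k B = sumR (filter (λ A → rank A ℕ.≟ k) (hermitian n))
                  (λ A → χ (trace ((A *) ·ᴹ B)))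

    Q : ℕ → ℕ → R.Carrier
    Q k i = Q′ k (diagOnes n i)

    -- |C| · A_i = |{(X,Y) ∈ C² : rk(X − Y) = i}|
    pairCount : List (Matrix n) → ℕ → ℕ
    pairCount C i =
      length (filter (λ XY → rank (Data.Product.proj₁ XY -ᴹ Data.Product.proj₂ XY) ℕ.≟ i)
                     (List.cartesianProduct C C))
      where import Data.Product

    -- |C| · A'_k = Σ_{i=0}^{n} Q_k(i) · (|C| · A_i)
    scaledDual : List (Matrix n) → ℕ → R.Carrier
    scaledDual C k = sumR (List.upTo (suc n)) (λ i → Q k i R.* fromℕ (pairCount C i))

    -- C is a t-design: A'_1 = … = A'_t = 0
    -- (equivalently |C|·A'_k = 0, since |C| ≠ 0 in R of characteristic 0)
    IsDesign : List (Matrix n) → ℕ → Set ℓ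
    IsDesign C t = ∀ k → 1 ≤ k → k ≤ t → scaledDual C k R.≈ R.0#

  zeroDiagonal : ∀ n → List (Matrix n)
  zeroDiagonal n =
    filter (λ A → allB (λ i → FiniteField._==_ F (A i i) (FiniteField.0# F))
                  Data.Bool.≟ true)
           (hermitian n)
    where import Data.Bool

-- Hypotheses on the target ring: integral domain of characteristic 0
-- (e.g. ℂ), and nontrivial additive characters of F_q = {x | x^q = x}.

module _ {c ℓ : Level} (R : CommutativeRing c ℓ) where
  open CommutativeRing R

  fromℕR : ℕ → Carrier
  fromℕR zero    = 0#
  fromℕR (suc k) = 1# + fromℕR k

  record IntegralDomainChar0 : Set (c Level.⊔ ℓ) where
    field
      noZeroDivisors : ∀ x y → x * y ≈ 0# → x ≈ 0# ⊎ y ≈ 0#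
      char0          : ∀ k → ¬ (fromℕR (suc k) ≈ 0#)

module _ (F : FiniteField) (q : ℕ) {c ℓ : Level} (R : CommutativeRing c ℓ) where
  private
    module F = FiniteField F
    module R = CommutativeRing R

  InSubfield : F.Carrier → Set
  InSubfield x = x F.^ q ≡ x

  record NontrivialCharacter (χ : F.Carrier → R.Carrier) : Set (c Level.⊔ ℓ) where
    field
      χ-0       : χ F.0# R.≈ R.1#
      χ-+       : ∀ x y → InSubfield x → InSubfield y → χ (x F.+ y) R.≈ χ x R.* χ y
      nontrivial : ∃ λ x → InSubfield x × ¬ (χ x R.≈ R.1#)

module Submission where

-- For Hermitian B of rank r put S(B) = Σ_v χ(v*Bv) over v ∈ F_{q²}ⁿ. Each Hermitian matrix of
-- rank one is vv* for exactly q + 1 vectors v, so S(B) = 1 + (q+1) Σ_{rk A = 1} χ(tr(A*B)), and in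
-- particular S(B) is an integer ≡ 1 mod q + 1. Squaring gives S(B)² = q^{2n} |ker B|, which depends
-- only on r; as q + 1 > 2 the congruence fixes the sign, so S(B), and with it
-- Σ_{rk A = 1} χ(tr(A*B)), depends only on the rank of B and equals Q_1(r).
-- Hence (q+1) |M| A'_1 = Σ_{v≠0} Σ_{X,Y∈M} χ(v*(X−Y)v). The inner sum vanishes as soon as v has two
-- nonzero entries, because M then contains some Z with χ(v*Zv) ≠ 1, and it is |M|² otherwise.
-- So A'_1 ≠ 0.

-- The definition evaluates `Q` at one diagonal matrix of each rank, so it says something about the
-- actual differences `X - Y` only once the rank-one character sum is known to depend on the rank
-- alone. The usual reason is that Hermitian matrices of equal rank are congruent; squaring `S`
-- avoids that normal form at the price of a sign. The sign cannot be settled by size, because `R`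
-- is any integral domain of characteristic 0, with neither absolute value nor conjugation. Two
-- facts about norms replace these. Since -1 is a norm, scaling vectors gives `S(-B) = S(B)`, so the
-- square expands like a product with a conjugate. Since every nonzero element of the subfield is a
-- norm, a form takes each such value equally often, so `S(B)` is 1 plus a difference of two vector
-- counts, each a multiple of q + 1. These naturals are compared modulo q + 1 after pulling the
-- equation back along the injection of the naturals into `R`. Vectors and matrices are functions,
-- compared entrywise throughout, and sums run over lists that meet every class of equal functions
-- exactly once.

open import Defs
open import Level using (Level; _⊔_; 0ℓ)
open import Data.Nat as ℕ using (ℕ; zero; suc; z≤n; s≤s; _≤_)
import Data.Nat.Properties as ℕₚ
open import Data.Nat.Combinatorics using (_C_; nCn≡1; nC1≡n; nCk+nC[k+1]≡[n+1]C[k+1])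
open import Data.Nat.Divisibility using (_∣_; divides; ∣⇒≤; m∣m*n; ∣m+n∣m⇒∣n; ∣m∣n⇒∣m+n)
open import Data.Nat.Primality using (Prime; euclidsLemma; prime⇒nonZero)
import Data.Nat.Solver
open import Data.Integer as ℤ using (ℤ; -[1+_]; _⊖_; _◃_)
import Data.Integer.Properties as ℤₚ
import Data.Sign as Sign
open import Data.Fin as Fin using (Fin)
import Data.Fin.Properties as Finₚ
open import Data.Bool using (Bool; true; false; if_then_else_; _∧_; _∨_; not)
import Data.Bool.Properties as Boolₚ
import Data.Maybe as Maybe
open import Data.List as List using (List; []; _∷_; _++_; concatMap; filter; length)
open import Data.List.Membership.Propositional using (_∈_; lose)
import Data.List.Membership.Propositional.Properties as ∈ₚ
open import Data.List.Membership.Propositional.Properties.WithK using (unique∧set⇒bag)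
open import Data.List.Relation.Binary.BagAndSetEquality using (∼bag⇒↭)
open import Data.List.Relation.Binary.Permutation.Propositional as ↭ using (_↭_)
open import Data.List.Relation.Unary.Any as Any using (here; there)
open import Data.List.Relation.Unary.All as All using (All; []; _∷_)
import Data.List.Relation.Unary.All.Properties as Allₚ
open import Data.List.Relation.Unary.AllPairs using ([]; _∷_)
open import Data.List.Relation.Unary.Unique.Propositional using (Unique)
import Data.List.Relation.Unary.Unique.Propositional.Properties as Uniqueₚ
open import Data.Product using (∃; _×_; _,_; proj₁; proj₂)
open import Data.Sum using (_⊎_; inj₁; inj₂; [_,_]′)
open import Data.Empty using (⊥-elim)
open import Function using (_∘_; mk⇔)
open import Relation.Nullary using (¬_; Dec; yes; no; does; contradiction; dec⇒maybe)
open import Relation.Nullary.Decidable using (toSum; _×-dec_; _⊎-dec_; _→-dec_; ¬?; decidable-stable)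
open import Relation.Binary using (Rel; Decidable; tri<; tri≈; tri>)
open import Relation.Binary.PropositionalEquality as ≡ using (_≡_; _≢_; cong; cong₂; sym; trans; subst)
open import Algebra.Bundles using (CommutativeSemiring; CommutativeRing)
import Algebra.Properties.Ring
import Algebra.Properties.Monoid.Sum
import Algebra.Properties.CommutativeSemiring.Binomial
import Algebra.Properties.CommutativeSemiring.Exp
import Algebra.Properties.Semiring.Exp
import Algebra.Properties.Semiring.Mult
import Algebra.Properties.Semiring.Mult.TCOptimised
import Algebra.Solver.Ring
import Algebra.Solver.Ring.AlmostCommutativeRing as ACR

-- A ring solver with integer coefficients

-- With integer coefficients the solver decides cancellations without deciding equality in R.
module IntegerSolver {c ℓ} (R : CommutativeRing c ℓ) where
  open CommutativeRing R renaming (sym to ≈-sym; trans to ≈-trans)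
  open Algebra.Properties.Ring ring
  open Algebra.Properties.Semiring.Mult.TCOptimised semiring renaming (_×_ to _·_)
  open import Relation.Binary.Reasoning.Setoid setoid

  -- With the optimised multiple, `1 · 1#` reduces to `1#`; so `con (ℤ.+ 1)` in a solver call means
  -- `1#` itself, and the laws for 0 and 1 hold by `refl`.
  fromℤ : ℤ → Carrier
  fromℤ (ℤ.+ n)    = n · 1#
  fromℤ -[1+ n ] = - (suc n · 1#)

  fromℤ-neg : ∀ n → fromℤ (ℤ.- (ℤ.+ n)) ≈ - (n · 1#)
  fromℤ-neg zero    = ≈-sym -0#≈0#
  fromℤ-neg (suc n) = refl

  fromℤ-⊖ : ∀ m n → fromℤ (m ⊖ n) ≈ m · 1# + - (n · 1#)
  fromℤ-⊖ m       zero    = ≈-sym (≈-trans (+-congˡ -0#≈0#) (+-identityʳ _))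
  fromℤ-⊖ zero    (suc n) = ≈-sym (+-identityˡ _)
  fromℤ-⊖ (suc m) (suc n) = begin
    fromℤ (suc m ⊖ suc n)                 ≡⟨ ≡.cong fromℤ (ℤₚ.[1+m]⊖[1+n]≡m⊖n m n) ⟩
    fromℤ (m ⊖ n)                         ≈⟨ fromℤ-⊖ m n ⟩
    m · 1# + - (n · 1#)                   ≈⟨ +-congʳ (+-identityʳ _) ⟨
    (m · 1# + 0#) + - (n · 1#)            ≈⟨ +-congʳ (+-congˡ (-‿inverseʳ 1#)) ⟨
    (m · 1# + (1# + - 1#)) + - (n · 1#)   ≈⟨ +-congʳ (+-assoc _ _ _) ⟨
    ((m · 1# + 1#) + - 1#) + - (n · 1#)   ≈⟨ +-assoc _ _ _ ⟩
    (m · 1# + 1#) + (- 1# + - (n · 1#))   ≈⟨ +-congˡ (-‿+-comm _ _) ⟩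
    (m · 1# + 1#) + - (1# + n · 1#)       ≈⟨ +-cong (+-comm _ _) (-‿cong (≈-sym (1+× n 1#))) ⟩
    (1# + m · 1#) + - (suc n · 1#)        ≈⟨ +-congʳ (1+× m 1#) ⟨
    suc m · 1# + - (suc n · 1#)           ∎

  fromℤ-+ : ∀ i j → fromℤ (i ℤ.+ j) ≈ fromℤ i + fromℤ j
  fromℤ-+ (ℤ.+ m)    (ℤ.+ n)    = ×-homo-+ 1# m n
  fromℤ-+ (ℤ.+ m)    -[1+ n ] = fromℤ-⊖ m (suc n)
  fromℤ-+ -[1+ m ] (ℤ.+ n)    = ≈-trans (fromℤ-⊖ n (suc m)) (+-comm _ _)
  fromℤ-+ -[1+ m ] -[1+ n ] = begin
    - (suc (suc (m ℕ.+ n)) · 1#)      ≡⟨ ≡.cong (λ k → - (suc k · 1#)) (ℕₚ.+-suc m n) ⟨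
    - ((suc m ℕ.+ suc n) · 1#)        ≈⟨ -‿cong (×-homo-+ 1# (suc m) (suc n)) ⟩
    - (suc m · 1# + suc n · 1#)       ≈⟨ -‿+-comm _ _ ⟨
    - (suc m · 1#) + - (suc n · 1#)   ∎

  fromℤ-◃ : ∀ n → fromℤ (Sign.- ◃ n) ≈ - (n · 1#)
  fromℤ-◃ zero    = ≈-sym -0#≈0#
  fromℤ-◃ (suc n) = refl

  fromℤ-* : ∀ i j → fromℤ (i ℤ.* j) ≈ fromℤ i * fromℤ j
  fromℤ-* (ℤ.+ m) (ℤ.+ n) = begin
    fromℤ (Sign.+ ◃ m ℕ.* n)  ≡⟨ ≡.cong fromℤ (ℤₚ.+◃n≡+n (m ℕ.* n)) ⟩
    (m ℕ.* n) · 1#            ≈⟨ ×1-homo-* m n ⟩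
    (m · 1#) * (n · 1#)       ∎
  fromℤ-* (ℤ.+ m) -[1+ n ] = begin
    fromℤ (Sign.- ◃ m ℕ.* suc n)   ≈⟨ fromℤ-◃ (m ℕ.* suc n) ⟩
    - ((m ℕ.* suc n) · 1#)         ≈⟨ -‿cong (×1-homo-* m (suc n)) ⟩
    - ((m · 1#) * (suc n · 1#))    ≈⟨ -‿distribʳ-* _ _ ⟩
    (m · 1#) * - (suc n · 1#)      ∎
  fromℤ-* -[1+ m ] (ℤ.+ n) = begin
    fromℤ (Sign.- ◃ suc m ℕ.* n)   ≈⟨ fromℤ-◃ (suc m ℕ.* n) ⟩
    - ((suc m ℕ.* n) · 1#)         ≈⟨ -‿cong (×1-homo-* (suc m) n) ⟩
    - ((suc m · 1#) * (n · 1#))    ≈⟨ -‿distribˡ-* _ _ ⟩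
    - (suc m · 1#) * (n · 1#)      ∎
  fromℤ-* -[1+ m ] -[1+ n ] = begin
    (suc m ℕ.* suc n) · 1#             ≈⟨ ×1-homo-* (suc m) (suc n) ⟩
    (suc m · 1#) * (suc n · 1#)        ≈⟨ -‿involutive _ ⟨
    - - ((suc m · 1#) * (suc n · 1#))  ≈⟨ -‿cong (-‿distribˡ-* _ _) ⟩
    - (- (suc m · 1#) * (suc n · 1#))  ≈⟨ -‿distribʳ-* _ _ ⟩
    - (suc m · 1#) * - (suc n · 1#)    ∎

  fromℤ-negate : ∀ i → fromℤ (ℤ.- i) ≈ - fromℤ i
  fromℤ-negate (ℤ.+ n)    = fromℤ-neg n
  fromℤ-negate -[1+ n ] = ≈-sym (-‿involutive _)

  morphism : CommutativeRing.rawRing ℤₚ.+-*-commutativeRing ACR.-Raw-AlmostCommutative⟶ ACR.fromCommutativeRing R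
  morphism = record
    { ⟦_⟧    = fromℤ
    ; +-homo = fromℤ-+
    ; *-homo = fromℤ-*
    ; -‿homo = fromℤ-negate
    ; 0-homo = refl
    ; 1-homo = refl
    }

  open Algebra.Solver.Ring (CommutativeRing.rawRing ℤₚ.+-*-commutativeRing) (ACR.fromCommutativeRing R) morphism
    (λ i j → Maybe.map (λ i≡j → reflexive (≡.cong fromℤ i≡j)) (dec⇒maybe (i ℤ.≟ j))) public
    using (solve; _:=_; _:+_; _:*_; _:-_; :-_; con)

-- Entrywise equality and finite sums with indicators

Pointwise : ∀ {a r} {A : Set a} (_~_ : Rel A r) {k : ℕ} → Rel (Fin k → A) r
Pointwise _~_ u v = ∀ i → u i ~ v i

pointwise? : ∀ {a r} {A : Set a} {_~_ : Rel A r} → Decidable _~_ →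
             ∀ {k} → Decidable (Pointwise _~_ {k})
pointwise? _≟_ u v = Finₚ.all? (λ i → u i ≟ v i)

module Sums {c ℓ} (S : CommutativeSemiring c ℓ) where
  open CommutativeSemiring S renaming (sym to ≈-sym; trans to ≈-trans)
  open import Relation.Binary.Reasoning.Setoid setoid
  open import Algebra.Properties.CommutativeSemigroup +-commutativeSemigroup
    using (interchange)

  private variable
    a b p r s : Level
    A : Set a
    B : Set b
    P Q : Set p

  ∑ : List A → (A → Carrier) → Carrier
  ∑ []       f = 0#
  ∑ (x ∷ xs) f = f x + ∑ xs f

  ⟦_⟧ : Dec P → Carrier
  ⟦ d ⟧ = if does d then 1# else 0#

  ⟦⟧-yes : (d : Dec P) → P → ⟦ d ⟧ ≈ 1#
  ⟦⟧-yes (yes _) _ = refl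
  ⟦⟧-yes (no ¬p) p = ⊥-elim (¬p p)

  ⟦⟧-no : (d : Dec P) → ¬ P → ⟦ d ⟧ ≈ 0#
  ⟦⟧-no (yes p) ¬p = ⊥-elim (¬p p)
  ⟦⟧-no (no _)  _  = refl

  ⟦⟧-cong : (d : Dec P) (e : Dec Q) → (P → Q) → (Q → P) → ⟦ d ⟧ ≈ ⟦ e ⟧
  ⟦⟧-cong (yes p) e to from = ≈-sym (⟦⟧-yes e (to p))
  ⟦⟧-cong (no ¬p) e to from = ≈-sym (⟦⟧-no e (λ q → ¬p (from q)))

  ⟦⟧-× : (d : Dec P) (e : Dec Q) → ⟦ d ×-dec e ⟧ ≈ ⟦ d ⟧ * ⟦ e ⟧
  ⟦⟧-× (yes _) (yes _) = ≈-sym (*-identityˡ _)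
  ⟦⟧-× (yes _) (no _)  = ≈-sym (*-identityˡ _)
  ⟦⟧-× (no _)  e       = ≈-sym (zeroˡ _)

  ⟦⟧-complement : (d : Dec P) → ⟦ d ⟧ + ⟦ ¬? d ⟧ ≈ 1#
  ⟦⟧-complement (yes _) = +-identityʳ _
  ⟦⟧-complement (no _)  = +-identityˡ _

  ⟦⟧-guard : (d : Dec P) {x y : Carrier} → (P → x ≈ y) → ⟦ d ⟧ * x ≈ ⟦ d ⟧ * y
  ⟦⟧-guard (yes p) x≈y = *-congˡ (x≈y p)
  ⟦⟧-guard (no _)  x≈y = ≈-trans (zeroˡ _) (≈-sym (zeroˡ _))

  ⟦⟧-split : (d : Dec P) (x : Carrier) → x ≈ ⟦ d ⟧ * x + ⟦ ¬? d ⟧ * x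
  ⟦⟧-split d x = begin
    x                             ≈⟨ *-identityˡ x ⟨
    1# * x                        ≈⟨ *-congʳ (⟦⟧-complement d) ⟨
    (⟦ d ⟧ + ⟦ ¬? d ⟧) * x        ≈⟨ distribʳ _ _ _ ⟩
    ⟦ d ⟧ * x + ⟦ ¬? d ⟧ * x      ∎

  ∑-cong : (L : List A) {f g : A → Carrier} → (∀ x → f x ≈ g x) → ∑ L f ≈ ∑ L g
  ∑-cong []       f≈g = refl
  ∑-cong (x ∷ xs) f≈g = +-cong (f≈g x) (∑-cong xs f≈g)

  ∑-zero : (L : List A) {f : A → Carrier} → (∀ x → f x ≈ 0#) → ∑ L f ≈ 0#
  ∑-zero []       f≈0 = refl
  ∑-zero (x ∷ xs) f≈0 = ≈-trans (+-cong (f≈0 x) (∑-zero xs f≈0)) (+-identityˡ _)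

  ∑-+ : (L : List A) (f g : A → Carrier) → ∑ L (λ x → f x + g x) ≈ ∑ L f + ∑ L g
  ∑-+ []       f g = ≈-sym (+-identityˡ _)
  ∑-+ (x ∷ xs) f g = ≈-trans (+-congˡ (∑-+ xs f g)) (interchange _ _ _ _)

  ∑-*ˡ : (L : List A) (c : Carrier) (f : A → Carrier) → c * ∑ L f ≈ ∑ L (λ x → c * f x)
  ∑-*ˡ []       c f = zeroʳ c
  ∑-*ˡ (x ∷ xs) c f = ≈-trans (distribˡ _ _ _) (+-congˡ (∑-*ˡ xs c f))

  ∑-*ʳ : (L : List A) (c : Carrier) (f : A → Carrier) → ∑ L f * c ≈ ∑ L (λ x → f x * c)
  ∑-*ʳ []       c f = zeroˡ c
  ∑-*ʳ (x ∷ xs) c f = ≈-trans (distribʳ _ _ _) (+-congˡ (∑-*ʳ xs c f))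

  ∑-swap : (L : List A) (M : List B) (f : A → B → Carrier) →
           ∑ L (λ x → ∑ M (f x)) ≈ ∑ M (λ y → ∑ L (λ x → f x y))
  ∑-swap []       M f = ≈-sym (∑-zero M (λ _ → refl))
  ∑-swap (x ∷ xs) M f = ≈-trans (+-congˡ (∑-swap xs M f)) (≈-sym (∑-+ M _ _))

  ∑-++ : (L M : List A) (f : A → Carrier) → ∑ (L ++ M) f ≈ ∑ L f + ∑ M f
  ∑-++ []       M f = ≈-sym (+-identityˡ _)
  ∑-++ (x ∷ xs) M f = ≈-trans (+-congˡ (∑-++ xs M f)) (≈-sym (+-assoc _ _ _))

  ∑-map : (h : B → A) (L : List B) (f : A → Carrier) → ∑ (List.map h L) f ≡ ∑ L (f ∘ h)
  ∑-map h []       f = ≡.refl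
  ∑-map h (x ∷ xs) f = ≡.cong (f (h x) +_) (∑-map h xs f)

  ∑-concatMap : (h : B → List A) (L : List B) (f : A → Carrier) →
                ∑ (concatMap h L) f ≈ ∑ L (λ x → ∑ (h x) f)
  ∑-concatMap h []       f = refl
  ∑-concatMap h (x ∷ xs) f =
    ≈-trans (∑-++ (h x) (concatMap h xs) f) (+-congˡ (∑-concatMap h xs f))

  ∑-cartesianProduct : (L : List A) (M : List B) (f : A × B → Carrier) →
                       ∑ (List.cartesianProduct L M) f ≈ ∑ L (λ x → ∑ M (λ y → f (x , y)))
  ∑-cartesianProduct []       M f = refl
  ∑-cartesianProduct (x ∷ xs) M f =
    ≈-trans (∑-++ (List.map (x ,_) M) _ f)
          (+-cong (reflexive (∑-map (x ,_) M f)) (∑-cartesianProduct xs M f))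

  ∑-filter : {P : A → Set p} (P? : ∀ x → Dec (P x)) (L : List A) (f : A → Carrier) →
             ∑ (filter P? L) f ≈ ∑ L (λ x → ⟦ P? x ⟧ * f x)
  ∑-filter P? []       f = refl
  ∑-filter P? (x ∷ xs) f with P? x
  ... | yes _ = +-cong (≈-sym (*-identityˡ _)) (∑-filter P? xs f)
  ... | no  _ = ≈-trans (∑-filter P? xs f) (≈-sym (≈-trans (+-congʳ (zeroˡ _)) (+-identityˡ _)))

  -- Functions that agree entrywise need not be identical, so completeness and absence of repetition
  -- are expressed by a count up to `~`. The count is taken in the semiring itself, which lets it be
  -- inserted as a factor 1 in double sums.
  record Enumerates {A : Set a} {_~_ : Rel A r} (_≟_ : Decidable _~_) (L : List A) :
                    Set (a ⊔ ℓ) where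
    constructor enumerated
    field once : ∀ y → ∑ L (λ x → ⟦ x ≟ y ⟧) ≈ 1#
  open Enumerates public

  ∑-pick : {_~_ : Rel A r} (_≟_ : Decidable _~_) (L : List A) → ∀ y →
           ∑ L (λ x → ⟦ x ≟ y ⟧) ≈ 1# →
           (f : A → Carrier) → (∀ x → x ~ y → f x ≈ f y) →
           ∑ L (λ x → ⟦ x ≟ y ⟧ * f x) ≈ f y
  ∑-pick _≟_ L y hit f f-resp = begin
    ∑ L (λ x → ⟦ x ≟ y ⟧ * f x)  ≈⟨ ∑-cong L (λ x → ⟦⟧-guard (x ≟ y) (f-resp x)) ⟩
    ∑ L (λ x → ⟦ x ≟ y ⟧ * f y)  ≈⟨ ∑-*ʳ L (f y) _ ⟨
    ∑ L (λ x → ⟦ x ≟ y ⟧) * f y  ≈⟨ *-congʳ hit ⟩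
    1# * f y                     ≈⟨ *-identityˡ _ ⟩
    f y                          ∎

  module _ {A : Set a} {B : Set b}
           {_~_ : Rel A r} {_≟_ : Decidable _~_} {L : List A} (enumL : Enumerates _≟_ L)
           {_≃_ : Rel B s} {_≟′_ : Decidable _≃_} {M : List B} (enumM : Enumerates _≟′_ M)
           (φ : B → A) (ψ : A → B)
           where

    -- Insert 1 as the sum over `y` of the indicator of `y ≃ ψ x`, exchange the sums, read the
    -- indicator as that of `x ~ φ y`, and collapse the sum over `x`.
    ∑-reindex : (∀ x y → y ≃ ψ x → x ~ φ y) → (∀ x y → x ~ φ y → y ≃ ψ x) →
                (f : A → Carrier) → (∀ x y → x ~ y → f x ≈ f y) →
                ∑ L f ≈ ∑ M (λ y → f (φ y))
    ∑-reindex to from f f-resp = begin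
      ∑ L f
        ≈⟨ ∑-cong L (λ x → ∑-pick _≟′_ M (ψ x) (once enumM _) (λ _ → f x) (λ _ _ → refl)) ⟨
      ∑ L (λ x → ∑ M (λ y → ⟦ y ≟′ ψ x ⟧ * f x))
        ≈⟨ ∑-swap L M _ ⟩
      ∑ M (λ y → ∑ L (λ x → ⟦ y ≟′ ψ x ⟧ * f x))
        ≈⟨ ∑-cong M (λ y → ∑-cong L (λ x →
             *-congʳ (⟦⟧-cong (y ≟′ ψ x) (x ≟ φ y) (to x y) (from x y)))) ⟩
      ∑ M (λ y → ∑ L (λ x → ⟦ x ≟ φ y ⟧ * f x))
        ≈⟨ ∑-cong M (λ y → ∑-pick _≟_ L (φ y) (once enumL _) f (λ x → f-resp x (φ y))) ⟩
      ∑ M (λ y → f (φ y)) ∎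

    -- The same double count, for maps that are mutually inverse only between the elements
    -- satisfying `P` and those satisfying `Q`; the indicators of `P` and `Q` therefore travel with
    -- the pairs.
    ∑-bijection : {P : A → Set p} (P? : ∀ x → Dec (P x)) {Q : B → Set p} (Q? : ∀ y → Dec (Q y)) →
                  (∀ x y → P x → y ≃ ψ x → Q y × x ~ φ y) →
                  (∀ x y → Q y → x ~ φ y → P x × y ≃ ψ x) →
                  ∑ L (λ x → ⟦ P? x ⟧) ≈ ∑ M (λ y → ⟦ Q? y ⟧)
    ∑-bijection P? Q? to from = begin
      ∑ L (λ x → ⟦ P? x ⟧)
        ≈⟨ ∑-cong L (λ x → ∑-pick _≟′_ M (ψ x) (once enumM _) (λ _ → ⟦ P? x ⟧) (λ _ _ → refl)) ⟨
      ∑ L (λ x → ∑ M (λ y → ⟦ y ≟′ ψ x ⟧ * ⟦ P? x ⟧))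
        ≈⟨ ∑-swap L M _ ⟩
      ∑ M (λ y → ∑ L (λ x → ⟦ y ≟′ ψ x ⟧ * ⟦ P? x ⟧))
        ≈⟨ ∑-cong M (λ y → ∑-cong L (λ x → indicator x y)) ⟩
      ∑ M (λ y → ∑ L (λ x → ⟦ x ≟ φ y ⟧ * ⟦ Q? y ⟧))
        ≈⟨ ∑-cong M (λ y → ∑-pick _≟_ L (φ y) (once enumL _) (λ _ → ⟦ Q? y ⟧) (λ _ _ → refl)) ⟩
      ∑ M (λ y → ⟦ Q? y ⟧) ∎
      where
      indicator : ∀ x y → ⟦ y ≟′ ψ x ⟧ * ⟦ P? x ⟧ ≈ ⟦ x ≟ φ y ⟧ * ⟦ Q? y ⟧
      indicator x y = begin
        ⟦ y ≟′ ψ x ⟧ * ⟦ P? x ⟧        ≈⟨ ⟦⟧-× (y ≟′ ψ x) (P? x) ⟨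
        ⟦ (y ≟′ ψ x) ×-dec P? x ⟧
          ≈⟨ ⟦⟧-cong ((y ≟′ ψ x) ×-dec P? x) ((x ≟ φ y) ×-dec Q? y)
               (λ (e , px) → let qy , e′ = to x y px e in e′ , qy)
               (λ (e , qy) → let px , e′ = from x y qy e in e′ , px) ⟩
        ⟦ (x ≟ φ y) ×-dec Q? y ⟧       ≈⟨ ⟦⟧-× (x ≟ φ y) (Q? y) ⟩
        ⟦ x ≟ φ y ⟧ * ⟦ Q? y ⟧         ∎

  ∑-unique : {A : Set a} (_≟_ : (x y : A) → Dec (x ≡ y)) {L : List A} → Unique L →
             ∀ {y} → y ∈ L → ∑ L (λ x → ⟦ x ≟ y ⟧) ≈ 1#
  ∑-unique _≟_ {x ∷ L} (x∉L ∷ uniq) {y} (here y≡x) = begin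
    ⟦ x ≟ y ⟧ + ∑ L (λ x → ⟦ x ≟ y ⟧) ≈⟨ +-cong (⟦⟧-yes (x ≟ y) (≡.sym y≡x)) (absent x∉L) ⟩
    1# + 0#                           ≈⟨ +-identityʳ _ ⟩
    1#                                ∎
    where
    absent : ∀ {M} → All (x ≢_) M → ∑ M (λ x → ⟦ x ≟ y ⟧) ≈ 0#
    absent []                   = refl
    absent {z ∷ M} (x≢z ∷ x∉M) =
      ≈-trans (+-cong (⟦⟧-no (z ≟ y) (λ z≡y → x≢z (≡.sym (≡.trans z≡y y≡x)))) (absent x∉M))
            (+-identityˡ _)
  ∑-unique _≟_ {x ∷ L} (x∉L ∷ uniq) {y} (there y∈L) = begin
    ⟦ x ≟ y ⟧ + ∑ L (λ x → ⟦ x ≟ y ⟧)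
      ≈⟨ +-cong (⟦⟧-no (x ≟ y) (All.lookup x∉L y∈L)) (∑-unique _≟_ uniq y∈L) ⟩
    0# + 1#  ≈⟨ +-identityˡ _ ⟩
    1#       ∎

  enumerates-nil : {_~_ : Rel A r} (_≟_ : Decidable _~_) (empty : Fin 0 → A) →
                   Enumerates (pointwise? _≟_ {0}) (empty ∷ [])
  enumerates-nil _≟_ empty = enumerated λ y → +-identityʳ _

  enumerates-cons : {_~_ : Rel A r} {_≟_ : Decidable _~_} {L : List A} →
                    ∀ {k} {M : List (Fin k → A)} →
                    Enumerates _≟_ L → Enumerates (pointwise? _≟_) M →
                    Enumerates (pointwise? _≟_) (concatMap (λ x → List.map (cons x) M) L)
  enumerates-cons {_≟_ = _≟_} {L = L} {M = M} enumL enumM = enumerated λ y → begin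
    ∑ (concatMap (λ x → List.map (cons x) M) L) (λ v → ⟦ pointwise? _≟_ v y ⟧)
      ≈⟨ ∑-concatMap _ L _ ⟩
    ∑ L (λ x → ∑ (List.map (cons x) M) (λ v → ⟦ pointwise? _≟_ v y ⟧))
      ≈⟨ ∑-cong L (λ x → reflexive (∑-map (cons x) M _)) ⟩
    ∑ L (λ x → ∑ M (λ v → ⟦ pointwise? _≟_ (cons x v) y ⟧))
      ≈⟨ ∑-cong L (λ x → ∑-cong M (λ v → factor y x v)) ⟩
    ∑ L (λ x → ∑ M (λ v → ⟦ x ≟ y Fin.zero ⟧ * ⟦ pointwise? _≟_ v (y ∘ Fin.suc) ⟧))
      ≈⟨ ∑-cong L (λ x → ∑-*ˡ M _ _) ⟨
    ∑ L (λ x → ⟦ x ≟ y Fin.zero ⟧ * ∑ M (λ v → ⟦ pointwise? _≟_ v (y ∘ Fin.suc) ⟧))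
      ≈⟨ ∑-cong L (λ x → *-congˡ (once enumM (y ∘ Fin.suc))) ⟩
    ∑ L (λ x → ⟦ x ≟ y Fin.zero ⟧ * 1#)
      ≈⟨ ∑-cong L (λ x → *-identityʳ _) ⟩
    ∑ L (λ x → ⟦ x ≟ y Fin.zero ⟧)
      ≈⟨ once enumL (y Fin.zero) ⟩
    1# ∎
    where
    factor : ∀ y x v → ⟦ pointwise? _≟_ (cons x v) y ⟧ ≈
                     ⟦ x ≟ y Fin.zero ⟧ * ⟦ pointwise? _≟_ v (y ∘ Fin.suc) ⟧
    factor y x v = begin
      ⟦ pointwise? _≟_ (cons x v) y ⟧
        ≈⟨ ⟦⟧-cong (pointwise? _≟_ (cons x v) y)
             ((x ≟ y Fin.zero) ×-dec pointwise? _≟_ v (y ∘ Fin.suc))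
             (λ e → e Fin.zero , e ∘ Fin.suc)
             (λ { (e , es) Fin.zero → e ; (e , es) (Fin.suc i) → es i }) ⟩
      ⟦ (x ≟ y Fin.zero) ×-dec pointwise? _≟_ v (y ∘ Fin.suc) ⟧
        ≈⟨ ⟦⟧-× (x ≟ y Fin.zero) (pointwise? _≟_ v (y ∘ Fin.suc)) ⟩
      ⟦ x ≟ y Fin.zero ⟧ * ⟦ pointwise? _≟_ v (y ∘ Fin.suc) ⟧ ∎

module ∑ℕ = Sums ℕₚ.+-*-commutativeSemiring

length-filter : ∀ {a p} {A : Set a} {P : A → Set p} (P? : ∀ x → Dec (P x)) (L : List A) →
                length (filter P? L) ≡ ∑ℕ.∑ L (λ x → ∑ℕ.⟦ P? x ⟧)
length-filter P? []       = ≡.refl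
length-filter P? (x ∷ xs) with P? x
... | yes _ = cong suc (length-filter P? xs)
... | no  _ = length-filter P? xs

∑ℕ-≤ : ∀ {a} {A : Set a} (L : List A) {f g : A → ℕ} → (∀ x → f x ℕ.≤ g x) →
       ∑ℕ.∑ L f ℕ.≤ ∑ℕ.∑ L g
∑ℕ-≤ []       f≤g = z≤n
∑ℕ-≤ (x ∷ xs) f≤g = ℕₚ.+-mono-≤ (f≤g x) (∑ℕ-≤ xs f≤g)

-- Binomial coefficients divisible by a prime

absorption : ∀ n k → suc k ℕ.* (suc n C suc k) ≡ suc n ℕ.* (n C k)
absorption n zero = trans (ℕₚ.*-identityˡ _) (trans (nC1≡n (suc n)) (sym (ℕₚ.*-identityʳ (suc n))))
absorption zero (suc k) = begin
  suc (suc k) ℕ.* (1 C suc (suc k))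
    ≡⟨ cong (suc (suc k) ℕ.*_) (sym (nCk+nC[k+1]≡[n+1]C[k+1] 0 (suc k))) ⟩
  suc (suc k) ℕ.* 0
    ≡⟨ ℕₚ.*-zeroʳ (suc (suc k)) ⟩
  0 ∎
  where open ≡.≡-Reasoning
absorption (suc n) (suc k) = begin
  suc (suc k) ℕ.* (suc (suc n) C suc (suc k))
    ≡⟨ cong (suc (suc k) ℕ.*_) (sym (nCk+nC[k+1]≡[n+1]C[k+1] (suc n) (suc k))) ⟩
  suc (suc k) ℕ.* (B ℕ.+ (suc n C suc (suc k)))
    ≡⟨ ℕₚ.*-distribˡ-+ (suc (suc k)) B _ ⟩
  (B ℕ.+ suc k ℕ.* B) ℕ.+ suc (suc k) ℕ.* (suc n C suc (suc k))
    ≡⟨ cong₂ (λ x y → (B ℕ.+ x) ℕ.+ y) (absorption n k) (absorption n (suc k)) ⟩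
  (B ℕ.+ suc n ℕ.* (n C k)) ℕ.+ suc n ℕ.* (n C suc k)
    ≡⟨ ℕₚ.+-assoc B _ _ ⟩
  B ℕ.+ (suc n ℕ.* (n C k) ℕ.+ suc n ℕ.* (n C suc k))
    ≡⟨ cong (B ℕ.+_) (ℕₚ.*-distribˡ-+ (suc n) (n C k) (n C suc k)) ⟨
  B ℕ.+ suc n ℕ.* (n C k ℕ.+ n C suc k)
    ≡⟨ cong (λ x → B ℕ.+ suc n ℕ.* x) (nCk+nC[k+1]≡[n+1]C[k+1] n k) ⟩
  suc (suc n) ℕ.* B ∎
  where
  open ≡.≡-Reasoning
  B = suc n C suc k

-- By `absorption` the prime divides `suc k` times the coefficient. It cannot divide `suc k`, which
-- is smaller, so Euclid's lemma leaves the coefficient.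
prime∣binomial : ∀ {n} → Prime (suc n) → ∀ k → k ℕ.< n → suc n ∣ (suc n C suc k)
prime∣binomial {n} p-prime k k<n
  with euclidsLemma (suc k) (suc n C suc k) p-prime (subst (suc n ∣_) (sym (absorption n k)) (m∣m*n _))
... | inj₂ p∣C = p∣C
... | inj₁ p∣k = contradiction (s≤s k<n) (ℕₚ.≤⇒≯ (∣⇒≤ p∣k))

-- Finite fields: root counting, Fermat's theorem, characteristic

module Field (F : FiniteField) where
  open FiniteField F

  commutativeRing : CommutativeRing 0ℓ 0ℓ
  commutativeRing = record { isCommutativeRing = isCommutativeRing }

  module FR = CommutativeRing commutativeRing
  module FP = Algebra.Properties.Ring FR.ring
  module ^ₚ = Algebra.Properties.Semiring.Exp FR.semiring
  module *^ₚ = Algebra.Properties.CommutativeSemiring.Exp FR.commutativeSemiring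
  module ×ₚ = Algebra.Properties.Semiring.Mult FR.semiring
  module ∑F = Sums FR.commutativeSemiring
  module FSolver = IntegerSolver commutativeRing
  open ×ₚ using () renaming (_×_ to _·_)
  open ≡.≡-Reasoning

  ^≡ : ∀ x n → x ^ n ≡ (x ^ₚ.^ n)
  ^≡ x zero    = ≡.refl
  ^≡ x (suc n) = cong (x *_) (^≡ x n)

  ^-* : ∀ x m n → (x ^ m) ^ n ≡ x ^ (m ℕ.* n)
  ^-* x m n = begin
    (x ^ m) ^ n             ≡⟨ ^≡ (x ^ m) n ⟩
    ((x ^ m) ^ₚ.^ n)        ≡⟨ cong (λ y → y ^ₚ.^ n) (^≡ x m) ⟩
    ((x ^ₚ.^ m) ^ₚ.^ n)     ≡⟨ ^ₚ.^-assocʳ x m n ⟩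
    (x ^ₚ.^ (m ℕ.* n))      ≡⟨ ^≡ x (m ℕ.* n) ⟨
    x ^ (m ℕ.* n)           ∎

  ^-distrib : ∀ x y n → (x * y) ^ n ≡ x ^ n * y ^ n
  ^-distrib x y n = trans (^≡ (x * y) n)
    (trans (*^ₚ.^-distrib-* x y n) (sym (cong₂ _*_ (^≡ x n) (^≡ y n))))

  1^ : ∀ n → 1# ^ n ≡ 1#
  1^ zero    = ≡.refl
  1^ (suc n) = trans (FR.*-identityˡ _) (1^ n)

  inv : ∀ x → x ≢ 0# → Carrier
  inv x x≢0 = proj₁ (inverse x x≢0)

  inv-r : ∀ x (x≢0 : x ≢ 0#) → x * inv x x≢0 ≡ 1#
  inv-r x x≢0 = proj₂ (inverse x x≢0)

  *-cancelˡ : ∀ x {y z} → x ≢ 0# → x * y ≡ x * z → y ≡ z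
  *-cancelˡ x {y} {z} x≢0 xy≡xz with inverse x x≢0
  ... | w , xw≡1 = begin
    y           ≡⟨ expand y ⟩
    w * (x * y) ≡⟨ cong (w *_) xy≡xz ⟩
    w * (x * z) ≡⟨ expand z ⟨
    z           ∎
    where
    expand : ∀ y → y ≡ w * (x * y)
    expand y = begin
      y             ≡⟨ FR.*-identityˡ y ⟨
      1# * y        ≡⟨ cong (_* y) (trans (sym xw≡1) (FR.*-comm x w)) ⟩
      (w * x) * y   ≡⟨ FR.*-assoc w x y ⟩
      w * (x * y)   ∎

  *-nonzero : ∀ {x y} → x ≢ 0# → y ≢ 0# → x * y ≢ 0#
  *-nonzero {x} x≢0 y≢0 xy≡0 = y≢0 (*-cancelˡ x x≢0 (trans xy≡0 (sym (FR.zeroʳ x))))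

  *-zero : ∀ x {y} → x * y ≡ 0# → x ≢ 0# → y ≡ 0#
  *-zero x xy≡0 x≢0 = *-cancelˡ x x≢0 (trans xy≡0 (sym (FR.zeroʳ x)))

  ^-zero : ∀ x n → x ^ n ≡ 0# → x ≡ 0#
  ^-zero x zero    1≡0 = contradiction (sym 1≡0) 0≢1
  ^-zero x (suc n) xx≡0 with x ≟ 0#
  ... | yes x≡0 = x≡0
  ... | no  x≢0 = ^-zero x n (*-zero x xx≡0 x≢0)

  -≡0 : ∀ {x y} → x - y ≡ 0# → x ≡ y
  -≡0 {x} {y} = FP.x∙y⁻¹≈ε⇒x≈y x y

  -- Polynomials are represented by the functions they define; d is the degree.
  data Monic : ℕ → (Carrier → Carrier) → Set where
    const : ∀ {f} → (∀ x → f x ≡ 1#) → Monic 0 f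
    step  : ∀ {d f g} a → Monic d g → (∀ x → f x ≡ x * g x + a) → Monic (suc d) f

  -- Synthetic division. For `f x = x * g x + a` the difference `f x - f r` is
  -- `x * (g x - g r) + (x - r) * g r`, and the first bracket is divisible by `x - r` by induction
  -- on the degree.
  monic-factor : ∀ {d f} → Monic (suc d) f → ∀ r →
                 ∃ λ g → Monic d g × (∀ x → f x - f r ≡ (x - r) * g x)
  monic-factor {f = f} (step {g = g} a (const g≡1) f≡) r = (λ _ → 1#) , const (λ _ → ≡.refl) , λ x → begin
    f x - f r                              ≡⟨ cong₂ _-_ (f≡ x) (f≡ r) ⟩
    (x * g x + a) - (r * g r + a)
      ≡⟨ cong₂ (λ s t → (x * s + a) - (r * t + a)) (g≡1 x) (g≡1 r) ⟩
    (x * 1# + a) - (r * 1# + a)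
      ≡⟨ FSolver.solve 3 (λ x r a → (x :* con (ℤ.+ 1) :+ a) :- (r :* con (ℤ.+ 1) :+ a) := (x :- r) :* con (ℤ.+ 1)) ≡.refl x r a ⟩
    (x - r) * 1#                           ∎
    where open FSolver
  monic-factor {f = f} (step {g = g} a mg@(step _ _ _) f≡) r with monic-factor mg r
  ... | h , mh , eq = (λ x → x * h x + g r) , step (g r) mh (λ _ → ≡.refl) , λ x → begin
    f x - f r                              ≡⟨ cong₂ _-_ (f≡ x) (f≡ r) ⟩
    (x * g x + a) - (r * g r + a)
      ≡⟨ FSolver.solve 5 (λ x r a u v → (x :* u :+ a) :- (r :* v :+ a) := x :* (u :- v) :+ (x :- r) :* v)
           ≡.refl x r a (g x) (g r) ⟩
    x * (g x - g r) + (x - r) * g r        ≡⟨ cong (λ s → x * s + (x - r) * g r) (eq x) ⟩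
    x * ((x - r) * h x) + (x - r) * g r
      ≡⟨ FSolver.solve 4 (λ x r u v → x :* ((x :- r) :* u) :+ (x :- r) :* v := (x :- r) :* (x :* u :+ v))
           ≡.refl x r (h x) (g r) ⟩
    (x - r) * (x * h x + g r)              ∎
    where open FSolver

  -- Splitting off one root `r`, every other root makes `x - r` nonzero and is thus a root of the
  -- quotient, whose degree is one less.
  roots-bound : ∀ {d f} → Monic d f → ∀ {L} → Unique L → (∀ {x} → x ∈ L → f x ≡ 0#) → length L ℕ.≤ d
  roots-bound m [] _ = z≤n
  roots-bound (const f≡1) {x ∷ L} (_ ∷ _) root =
    contradiction (trans (sym (root (here ≡.refl))) (f≡1 x)) 0≢1
  roots-bound {f = f} m@(step _ _ _) {r ∷ L} (r∉L ∷ uniq) root with monic-factor m r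
  ... | g , mg , eq = s≤s (roots-bound mg uniq (λ {x} x∈L →
    *-zero (x - r)
      (trans (sym (eq x)) (trans (cong₂ _-_ (root (there x∈L)) (root (here ≡.refl))) (FR.-‿inverseʳ 0#)))
      (λ x-r≡0 → All.lookup r∉L x∈L (sym (-≡0 x-r≡0)))))

  monic-^ : ∀ n → Monic n (_^ n)
  monic-^ zero    = const (λ _ → ≡.refl)
  monic-^ (suc n) = step 0# (monic-^ n) (λ _ → sym (FR.+-identityʳ _))

  count-roots : ∀ {d f} → Monic d f → ∀ {P : Carrier → Set} (P? : ∀ x → Dec (P x)) →
                (∀ x → P x → f x ≡ 0#) → ∑ℕ.∑ elements (λ x → ∑ℕ.⟦ P? x ⟧) ℕ.≤ d
  count-roots m P? root = subst (ℕ._≤ _) (length-filter P? elements)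
    (roots-bound m (Uniqueₚ.filter⁺ P? unique) (λ x∈ → root _ (proj₂ (∈ₚ.∈-filter⁻ P? {xs = elements} x∈))))

  enumerates : ∀ {c ℓ} (S : CommutativeSemiring c ℓ) → Sums.Enumerates S _≟_ elements
  enumerates S = Sums.enumerated λ y → Sums.∑-unique S _≟_ unique (complete y)

  ∏ : List Carrier → Carrier
  ∏ = List.foldr _*_ 1#

  ∏-↭ : ∀ {L M} → L ↭ M → ∏ L ≡ ∏ M
  ∏-↭ ↭.refl         = ≡.refl
  ∏-↭ (↭.prep x p)   = cong (x *_) (∏-↭ p)
  ∏-↭ (↭.swap x y p) =
    trans (cong (λ z → x * (y * z)) (∏-↭ p))
          (FSolver.solve 3 (λ x y z → x :* (y :* z) := y :* (x :* z)) ≡.refl x y _)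
    where open FSolver
  ∏-↭ (↭.trans p r)  = trans (∏-↭ p) (∏-↭ r)

  ∏-nonzero : ∀ L → All (_≢ 0#) L → ∏ L ≢ 0#
  ∏-nonzero []       []           = 0≢1 ∘ sym
  ∏-nonzero (x ∷ xs) (x≢0 ∷ xs≢0) = *-nonzero x≢0 (∏-nonzero xs xs≢0)

  ∏-scale : ∀ x L → ∏ (List.map (x *_) L) ≡ x ^ length L * ∏ L
  ∏-scale x []       = sym (FR.*-identityˡ _)
  ∏-scale x (y ∷ ys) = trans (cong ((x * y) *_) (∏-scale x ys))
    (FSolver.solve 4 (λ x y p r → (x :* y) :* (p :* r) := (x :* p) :* (y :* r)) ≡.refl x y _ _)
    where open FSolver

  nonzero? : ∀ x → Dec (x ≢ 0#)
  nonzero? x = ¬? (x ≟ 0#)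

  units : List Carrier
  units = filter nonzero? elements

  units-scale : ∀ x → x ≢ 0# → List.map (x *_) units ↭ units
  units-scale x x≢0 = ∼bag⇒↭ (unique∧set⇒bag
    (Uniqueₚ.map⁺ (*-cancelˡ x x≢0) (Uniqueₚ.filter⁺ nonzero? unique))
    (Uniqueₚ.filter⁺ nonzero? unique)
    (mk⇔ to from))
    where
    to : ∀ {y} → y ∈ List.map (x *_) units → y ∈ units
    to y∈ with ∈ₚ.∈-map⁻ (x *_) y∈
    ... | z , z∈ , ≡.refl =
      ∈ₚ.∈-filter⁺ nonzero? (complete _) (*-nonzero x≢0 (proj₂ (∈ₚ.∈-filter⁻ nonzero? {xs = elements} z∈)))
    from : ∀ {y} → y ∈ units → y ∈ List.map (x *_) units
    from {y} y∈ = subst (_∈ List.map (x *_) units) xwy≡y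
      (∈ₚ.∈-map⁺ (x *_) (∈ₚ.∈-filter⁺ nonzero? (complete (inv x x≢0 * y)) wy≢0))
      where
      xwy≡y : x * (inv x x≢0 * y) ≡ y
      xwy≡y = trans (sym (FR.*-assoc _ _ _)) (trans (cong (_* y) (inv-r x x≢0)) (FR.*-identityˡ y))
      y≢0 : y ≢ 0#
      y≢0 = proj₂ (∈ₚ.∈-filter⁻ nonzero? {xs = elements} y∈)
      wy≢0 : inv x x≢0 * y ≢ 0#
      wy≢0 wy≡0 = y≢0 (trans (sym xwy≡y) (trans (cong (x *_) wy≡0) (FR.zeroʳ x)))

  -- Multiplication by `x` permutes the units, so their product equals itself times
  -- `x ^ length units`; being nonzero, it cancels.
  ^-units : ∀ x → x ≢ 0# → x ^ length units ≡ 1#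
  ^-units x x≢0 = *-cancelˡ (∏ units) ∏≢0 (begin
    ∏ units * x ^ length units     ≡⟨ FR.*-comm _ _ ⟩
    x ^ length units * ∏ units     ≡⟨ ∏-scale x units ⟨
    ∏ (List.map (x *_) units)      ≡⟨ ∏-↭ (units-scale x x≢0) ⟩
    ∏ units                        ≡⟨ FR.*-identityʳ _ ⟨
    ∏ units * 1#                   ∎)
    where
    ∏≢0 : ∏ units ≢ 0#
    ∏≢0 = ∏-nonzero units (Allₚ.all-filter nonzero? elements)

  length-∑ : ∀ {A : Set} (L : List A) → length L ≡ ∑ℕ.∑ L (λ _ → 1)
  length-∑ []      = ≡.refl
  length-∑ (x ∷ L) = cong suc (length-∑ L)

  suc-units : suc (length units) ≡ card
  suc-units = begin
    1 ℕ.+ length units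
      ≡⟨ cong₂ ℕ._+_ (sym (∑ℕ.once (enumerates ℕₚ.+-*-commutativeSemiring) 0#)) (length-filter nonzero? elements) ⟩
    ∑ℕ.∑ elements (λ x → ∑ℕ.⟦ x ≟ 0# ⟧) ℕ.+ ∑ℕ.∑ elements (λ x → ∑ℕ.⟦ nonzero? x ⟧)
      ≡⟨ ∑ℕ.∑-+ elements (λ x → ∑ℕ.⟦ x ≟ 0# ⟧) _ ⟨
    ∑ℕ.∑ elements (λ x → ∑ℕ.⟦ x ≟ 0# ⟧ ℕ.+ ∑ℕ.⟦ nonzero? x ⟧)
      ≡⟨ ∑ℕ.∑-cong elements (λ x → ∑ℕ.⟦⟧-complement (x ≟ 0#)) ⟩
    ∑ℕ.∑ elements (λ _ → 1)
      ≡⟨ length-∑ elements ⟨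
    card ∎

  ^-card : ∀ x → x ^ card ≡ x
  ^-card x = subst (λ k → x ^ k ≡ x) suc-units (go (x ≟ 0#))
    where
    go : Dec (x ≡ 0#) → x ^ suc (length units) ≡ x
    go (yes ≡.refl) = FR.zeroˡ _
    go (no x≢0)     = trans (cong (x *_) (^-units x x≢0)) (FR.*-identityʳ x)

  ·-∑ : ∀ {A : Set} (L : List A) → ∑F.∑ L (λ _ → 1#) ≡ length L · 1#
  ·-∑ []      = ≡.refl
  ·-∑ (x ∷ L) = cong (1# +_) (·-∑ L)

  -- Translation by 1 permutes the field, so the sum of all elements is unchanged by adding card × 1.
  card·1 : card · 1# ≡ 0#
  card·1 = FP.+-cancelˡ total _ _ (begin
    total + card · 1#                        ≡⟨ cong (total +_) (·-∑ elements) ⟨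
    total + ∑F.∑ elements (λ _ → 1#)         ≡⟨ ∑F.∑-+ elements (λ x → x) _ ⟨
    ∑F.∑ elements (λ x → x + 1#)
      ≡⟨ ∑F.∑-reindex (enumerates FR.commutativeSemiring) (enumerates FR.commutativeSemiring)
           (_+ 1#) (_- 1#)
           (λ x y y≡ → trans (FSolver.solve 1 (λ x → x := (x :- con (ℤ.+ 1)) :+ con (ℤ.+ 1)) ≡.refl x) (cong (_+ 1#) (sym y≡)))
           (λ x y x≡ → trans (FSolver.solve 1 (λ y → y := (y :+ con (ℤ.+ 1)) :- con (ℤ.+ 1)) ≡.refl y) (cong (_- 1#) (sym x≡)))
           (λ x → x) (λ _ _ e → e) ⟨
    total                                    ≡⟨ FR.+-identityʳ total ⟨
    total + 0#                               ∎)
    where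
    open FSolver
    total = ∑F.∑ elements (λ x → x)

-- Frobenius conjugation and the trace of the quadratic extension

module QuadraticExtension (F : FiniteField) (q : ℕ) (q-primePower : IsPrimePower q)
                          (card≡ : FiniteField.card F ≡ q ℕ.* q) where
  open FiniteField F
  open Matrices F q using (conj)
  open Field F
  open ×ₚ using () renaming (_×_ to _·_)
  open ≡.≡-Reasoning
  open FSolver using (solve; _:=_; _:+_; _:*_; _:-_; :-_; con)

  private
    p = proj₁ q-primePower
    m = proj₁ (proj₂ q-primePower)
    p-prime : Prime p
    p-prime = proj₁ (proj₂ (proj₂ q-primePower))
    q≡p^m : q ≡ p ℕ.^ m
    q≡p^m = proj₂ (proj₂ (proj₂ (proj₂ q-primePower)))

  ^·1 : ∀ k n → (k ℕ.^ n) · 1# ≡ (k · 1#) ^ n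
  ^·1 k zero    = FR.+-identityʳ 1#
  ^·1 k (suc n) = trans (×ₚ.×1-homo-* k (k ℕ.^ n)) (cong ((k · 1#) *_) (^·1 k n))

  -- `card · 1#` is zero and, as `card` is the square of `p ^ m`, it is a power of `p · 1#`. A field
  -- has no nonzero nilpotent elements.
  p·1≡0 : p · 1# ≡ 0#
  p·1≡0 = ^-zero (p · 1#) m (conclude (q·1 ≟ 0#))
    where
    q·1 = (p · 1#) ^ m
    square : q·1 * q·1 ≡ 0#
    square = begin
      q·1 * q·1                   ≡⟨ cong (λ x → x * x) (trans (cong (_· 1#) q≡p^m) (^·1 p m)) ⟨
      (q · 1#) * (q · 1#)         ≡⟨ ×ₚ.×1-homo-* q q ⟨
      (q ℕ.* q) · 1#              ≡⟨ cong (_· 1#) card≡ ⟨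
      card · 1#                   ≡⟨ card·1 ⟩
      0#                          ∎
    conclude : Dec (q·1 ≡ 0#) → q·1 ≡ 0#
    conclude (yes e) = e
    conclude (no ≢0) = *-zero q·1 square ≢0

  ∣⇒·≡0 : ∀ {k} → p ∣ k → ∀ x → k · x ≡ 0#
  ∣⇒·≡0 {k} (divides j k≡jp) x = begin
    k · x                   ≡⟨ cong (_· x) k≡jp ⟩
    (j ℕ.* p) · x           ≡⟨ ×ₚ.×-assocˡ x j p ⟨
    j · (p · x)             ≡⟨ cong (λ y → j · (p · y)) (FR.*-identityˡ x) ⟨
    j · (p · (1# * x))      ≡⟨ cong (j ·_) (×ₚ.×-assoc-* p 1# x) ⟨
    j · ((p · 1#) * x)      ≡⟨ cong (λ y → j · (y * x)) p·1≡0 ⟩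
    j · (0# * x)            ≡⟨ cong (j ·_) (FR.zeroˡ x) ⟩
    j · 0#                  ≡⟨ cong (j ·_) (FR.zeroˡ 0#) ⟨
    j · (0# * 0#)           ≡⟨ ×ₚ.×-comm-* j 0# 0# ⟨
    0# * (j · 0#)           ≡⟨ FR.zeroˡ _ ⟩
    0#                      ∎

  -- The binomial coefficients strictly between the two ends are multiples of `p` and annihilate
  -- their terms. Writing `p` as `suc r` makes both end terms of the expansion visible.
  frobenius-p : ∀ {r} → p ≡ suc r → ∀ x y → (x + y) ^ p ≡ x ^ p + y ^ p
  frobenius-p {r} p≡ x y rewrite p≡ = begin
    (x + y) ^ suc r                              ≡⟨ ^≡ (x + y) (suc r) ⟩
    ((x + y) ^ₚ.^ suc r)                         ≡⟨ Binom.theorem (suc r) x y ⟩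
    term Fin.zero + ∑ᵥ.sum (term ∘ Fin.suc)
      ≡⟨ cong (term Fin.zero +_) (∑ᵥ.sum-init-last {r} (term ∘ Fin.suc)) ⟩
    term Fin.zero + (∑ᵥ.sum (λ i → term (Fin.suc (Fin.inject₁ i))) + term (Fin.suc (Fin.fromℕ r)))
      ≡⟨ cong₂ _+_ first (cong₂ _+_ middle last) ⟩
    y ^ suc r + (0# + x ^ suc r)
      ≡⟨ solve 2 (λ a b → b :+ (con (ℤ.+ 0) :+ a) := a :+ b) ≡.refl (x ^ suc r) (y ^ suc r) ⟩
    x ^ suc r + y ^ suc r ∎
    where
    module Binom = Algebra.Properties.CommutativeSemiring.Binomial FR.commutativeSemiring
    module ∑ᵥ = Algebra.Properties.Monoid.Sum FR.+-monoid
    term = Binom.binomialTerm x y (suc r)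
    first : term Fin.zero ≡ y ^ suc r
    first = trans (FR.+-identityʳ _) (trans (FR.*-identityˡ _) (sym (^≡ y (suc r))))
    middle : ∑ᵥ.sum (λ i → term (Fin.suc (Fin.inject₁ i))) ≡ 0#
    middle = trans (∑ᵥ.sum-cong-≗ {r} (λ i → ∣⇒·≡0
        (subst (_∣ (suc r C Fin.toℕ (Fin.suc (Fin.inject₁ i)))) (sym p≡)
          (prime∣binomial (subst Prime p≡ p-prime) _
            (subst (ℕ._< r) (sym (Finₚ.toℕ-inject₁ i)) (Finₚ.toℕ<n i)))) _))
      (∑ᵥ.sum-replicate-zero r)
    last : term (Fin.suc (Fin.fromℕ r)) ≡ x ^ suc r
    last rewrite Finₚ.toℕ-fromℕ r | nCn≡1 (suc r) | ℕₚ.n∸n≡0 r =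
      trans (FR.+-identityʳ _) (trans (FR.*-identityʳ _) (sym (^≡ x (suc r))))

  frobenius : ∀ k x y → (x + y) ^ (p ℕ.^ k) ≡ x ^ (p ℕ.^ k) + y ^ (p ℕ.^ k)
  frobenius zero    x y = solve 2 (λ x y → (x :+ y) :* con (ℤ.+ 1) := x :* con (ℤ.+ 1) :+ y :* con (ℤ.+ 1)) ≡.refl x y
  frobenius (suc k) x y = begin
    (x + y) ^ (p ℕ.* p ℕ.^ k)                            ≡⟨ ^-* (x + y) p (p ℕ.^ k) ⟨
    ((x + y) ^ p) ^ (p ℕ.^ k)                            ≡⟨ cong (_^ (p ℕ.^ k)) (frobenius-p p≡suc x y) ⟩
    (x ^ p + y ^ p) ^ (p ℕ.^ k)                          ≡⟨ frobenius k (x ^ p) (y ^ p) ⟩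
    (x ^ p) ^ (p ℕ.^ k) + (y ^ p) ^ (p ℕ.^ k)            ≡⟨ cong₂ _+_ (^-* x p _) (^-* y p _) ⟩
    x ^ (p ℕ.* p ℕ.^ k) + y ^ (p ℕ.* p ℕ.^ k)            ∎
    where
    p≡suc : p ≡ suc (ℕ.pred p)
    p≡suc = sym (ℕₚ.suc-pred p {{prime⇒nonZero p-prime}})

  conj-+ : ∀ x y → conj (x + y) ≡ conj x + conj y
  conj-+ x y = subst (λ k → (x + y) ^ k ≡ x ^ k + y ^ k) (sym q≡p^m) (frobenius m x y)

  conj-* : ∀ x y → conj (x * y) ≡ conj x * conj y
  conj-* x y = ^-distrib x y q

  conj-1 : conj 1# ≡ 1#
  conj-1 = 1^ q

  conj-0 : conj 0# ≡ 0#
  conj-0 = FP.+-cancelˡ (conj 0#) _ _ (begin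
    conj 0# + conj 0#    ≡⟨ conj-+ 0# 0# ⟨
    conj (0# + 0#)       ≡⟨ cong conj (FR.+-identityˡ 0#) ⟩
    conj 0#              ≡⟨ FR.+-identityʳ _ ⟨
    conj 0# + 0#         ∎)

  conj-neg : ∀ x → conj (- x) ≡ - conj x
  conj-neg x = FP.+-inverseʳ-unique (conj x) (conj (- x))
    (trans (sym (conj-+ x (- x))) (trans (cong conj (FR.-‿inverseʳ x)) conj-0))

  -- Two conjugations raise to the power `q * q = card`, which fixes every element.
  conj-conj : ∀ x → conj (conj x) ≡ x
  conj-conj x = trans (^-* x q q) (subst (λ k → x ^ k ≡ x) card≡ (^-card x))

  conj-nonzero : ∀ {x} → x ≢ 0# → conj x ≢ 0#
  conj-nonzero {x} x≢0 cx≡0 = x≢0 (trans (sym (conj-conj x)) (trans (cong conj cx≡0) conj-0))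

  2≤q : 2 ℕ.≤ q
  2≤q = ℕₚ.≰⇒> λ q≤1 → contradiction
    (ℕₚ.≤-trans (s≤s units-nonempty) (subst (ℕ._≤ 1) (trans (sym card≡) (sym suc-units)) (ℕₚ.*-mono-≤ q≤1 q≤1)))
    ℕₚ.1+n≰n
    where
    units-nonempty : 1 ℕ.≤ length units
    units-nonempty with units | ∈ₚ.∈-filter⁺ nonzero? (complete 1#) (0≢1 ∘ sym)
    ... | _ ∷ _ | _ = s≤s z≤n

  -- With `q` in the form `suc (suc k)`, the polynomials `x ^ q + x` and `x ^ (q - 1) - 1` can be
  -- assembled step by step as `Monic`; the second has degree `suc k`.
  k : ℕ
  k = q ℕ.∸ 2

  q≡ : q ≡ suc (suc k)
  q≡ = sym (ℕₚ.m+[n∸m]≡n 2≤q)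

  Fixed : Carrier → Set
  Fixed x = conj x ≡ x

  norm : Carrier → Carrier
  norm x = x * conj x

  norm-fixed : ∀ x → Fixed (norm x)
  norm-fixed x = trans (conj-* x (conj x)) (trans (cong (conj x *_) (conj-conj x)) (FR.*-comm _ _))

  -- `x + x ^ q` is monic of degree `q`, so it cannot vanish on all `q * q` elements.
  trace-nonzero : ∃ λ x → x + conj x ≢ 0#
  trace-nonzero with Any.any? (λ x → ¬? ((x + conj x) ≟ 0#)) elements
  ... | yes a = Any.satisfied a
  ... | no ¬a = contradiction
      (subst (ℕ._≤ q) card≡ (roots-bound monic unique
        (λ {x} x∈ → decidable-stable ((x + conj x) ≟ 0#) (λ ≢0 → ¬a (lose x∈ ≢0)))))
      (ℕₚ.<⇒≱ q<q*q)
    where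
    q<q*q : q ℕ.< q ℕ.* q
    q<q*q = ℕₚ.m<m*n q q {{ℕ.>-nonZero (ℕₚ.<-trans ℕₚ.0<1+n 2≤q)}} 2≤q
    monic : Monic q (λ x → x + conj x)
    monic = subst (λ d → Monic d (λ x → x + x ^ d)) (sym q≡)
      (step 0# (step 1# (monic-^ k) (λ x → ≡.refl))
        (λ x → solve 2 (λ x y → x :+ x :* y := x :* (y :+ con (ℤ.+ 1)) :+ con (ℤ.+ 0)) ≡.refl x (x ^ suc k)))

  -- The trace is linear over the fixed elements. One nonzero trace `s` is itself fixed, so
  -- multiplying its argument by the fixed element `w * t`, with `w` the inverse of `s`, changes the
  -- trace to `t`.
  trace-surjective : ∀ t → Fixed t → ∃ λ x → x + conj x ≡ t
  trace-surjective t t-fixed with trace-nonzero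
  ... | y , s≢0 = y * (w * t) , (begin
      y * (w * t) + conj (y * (w * t))             ≡⟨ cong (y * (w * t) +_) (conj-* y _) ⟩
      y * (w * t) + conj y * conj (w * t)
        ≡⟨ cong (λ z → y * (w * t) + conj y * z) (trans (conj-* w t) (cong₂ _*_ w-fixed t-fixed)) ⟩
      y * (w * t) + conj y * (w * t)               ≡⟨ FR.distribʳ _ _ _ ⟨
      s * (w * t)                                  ≡⟨ FR.*-assoc _ _ _ ⟨
      (s * w) * t                                  ≡⟨ cong (_* t) (inv-r s s≢0) ⟩
      1# * t                                       ≡⟨ FR.*-identityˡ t ⟩
      t                                            ∎)
    where
    s = y + conj y
    w = inv s s≢0
    s-fixed : Fixed s
    s-fixed = trans (conj-+ y (conj y)) (trans (cong (conj y +_) (conj-conj y)) (FR.+-comm _ _))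
    w-fixed : Fixed w
    w-fixed = *-cancelˡ s s≢0 (begin
      s * conj w        ≡⟨ cong (_* conj w) s-fixed ⟨
      conj s * conj w   ≡⟨ conj-* s w ⟨
      conj (s * w)      ≡⟨ cong conj (inv-r s s≢0) ⟩
      conj 1#           ≡⟨ conj-1 ⟩
      1#                ≡⟨ inv-r s s≢0 ⟨
      s * w             ∎)

-- Every nonzero fixed element is a norm in exactly q + 1 ways

module NormFibres (F : FiniteField) (q : ℕ) (q-primePower : IsPrimePower q)
                  (card≡ : FiniteField.card F ≡ q ℕ.* q) where
  open FiniteField F
  open Matrices F q using (conj)
  open Field F
  open QuadraticExtension F q q-primePower card≡
  open ℕₚ.≤-Reasoning

  private
    FixedUnit : Carrier → Set
    FixedUnit c = c ≢ 0# × Fixed c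

    fixedUnit? : ∀ c → Dec (FixedUnit c)
    fixedUnit? c = nonzero? c ×-dec (conj c ≟ c)

    #_ : ∀ {P : Carrier → Set} → (∀ x → Dec (P x)) → ℕ
    # P? = ∑ℕ.∑ elements (λ x → ∑ℕ.⟦ P? x ⟧)

    -- `norm x` unfolds to `x ^ suc q`, so the fibre lies among the roots of a monic polynomial of
    -- degree `suc q`.
    fibre≤ : ∀ c → # (λ x → norm x ≟ c) ℕ.≤ suc q
    fibre≤ c = count-roots (step (- c) (monic-^ q) (λ _ → ≡.refl)) (λ x → norm x ≟ c)
      (λ x e → trans (cong (_- c) e) (FR.-‿inverseʳ c))

    -- Cancelling one factor `x` from `x ^ q = x` leaves `x ^ suc k = 1#`, where `suc k` is `q - 1`.
    fixedUnits≤ : # fixedUnit? ℕ.≤ suc k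
    fixedUnits≤ = count-roots (step (- 1#) (monic-^ k) (λ _ → ≡.refl)) fixedUnit?
      (λ x (x≢0 , fixed) → trans
        (cong (_- 1#) (*-cancelˡ x x≢0 (trans (cong (x ^_) (sym q≡)) (trans fixed (sym (FR.*-identityʳ x))))))
        (FR.-‿inverseʳ 1#))

  -- The q² − 1 units are spread by the norm over at most q − 1 fixed units,
  -- and every fibre has at most q + 1 elements; so all fibres have exactly q + 1.
  norm-fibre : ∀ c → c ≢ 0# → Fixed c → # (λ x → norm x ≟ c) ≡ suc q
  norm-fibre c c≢0 c-fixed = ℕₚ.≤-antisym (fibre≤ c)
    (ℕₚ.+-cancelʳ-≤ (suc q ℕ.* k) (suc q) (# (λ x → norm x ≟ c)) (begin
      suc q ℕ.+ suc q ℕ.* k            ≡⟨ ℕₚ.*-suc (suc q) k ⟨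
      suc q ℕ.* suc k                  ≡⟨ count-units ⟨
      # nonzero?                       ≡⟨ by-norm ⟩
      ∑ℕ.∑ elements (λ d → ∑ℕ.⟦ fixedUnit? d ⟧ ℕ.* fib d)
        ≡⟨ ∑ℕ.∑-cong elements (λ d → ∑ℕ.⟦⟧-split (d ≟ c) (∑ℕ.⟦ fixedUnit? d ⟧ ℕ.* fib d)) ⟩
      ∑ℕ.∑ elements (λ d → ∑ℕ.⟦ d ≟ c ⟧ ℕ.* (∑ℕ.⟦ fixedUnit? d ⟧ ℕ.* fib d)
                       ℕ.+ ∑ℕ.⟦ ¬? (d ≟ c) ⟧ ℕ.* (∑ℕ.⟦ fixedUnit? d ⟧ ℕ.* fib d))
        ≡⟨ ∑ℕ.∑-+ elements (λ d → ∑ℕ.⟦ d ≟ c ⟧ ℕ.* (∑ℕ.⟦ fixedUnit? d ⟧ ℕ.* fib d)) _ ⟩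
      ∑ℕ.∑ elements (λ d → ∑ℕ.⟦ d ≟ c ⟧ ℕ.* (∑ℕ.⟦ fixedUnit? d ⟧ ℕ.* fib d))
        ℕ.+ ∑ℕ.∑ elements (λ d → ∑ℕ.⟦ ¬? (d ≟ c) ⟧ ℕ.* (∑ℕ.⟦ fixedUnit? d ⟧ ℕ.* fib d))
        ≡⟨ cong (ℕ._+ ∑ℕ.∑ elements (λ d → ∑ℕ.⟦ ¬? (d ≟ c) ⟧ ℕ.* (∑ℕ.⟦ fixedUnit? d ⟧ ℕ.* fib d)))
             (∑ℕ.∑-pick _≟_ elements c (once c) (λ d → ∑ℕ.⟦ fixedUnit? d ⟧ ℕ.* fib d)
             (λ { _ ≡.refl → ≡.refl })) ⟩
      ∑ℕ.⟦ fixedUnit? c ⟧ ℕ.* fib c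
        ℕ.+ ∑ℕ.∑ elements (λ d → ∑ℕ.⟦ ¬? (d ≟ c) ⟧ ℕ.* (∑ℕ.⟦ fixedUnit? d ⟧ ℕ.* fib d))
        ≤⟨ ℕₚ.+-mono-≤ (ℕₚ.≤-reflexive (trans (cong (ℕ._* fib c) (∑ℕ.⟦⟧-yes (fixedUnit? c) (c≢0 , c-fixed)))
                          (ℕₚ.*-identityˡ _)))
             (∑ℕ-≤ elements (λ d → ℕₚ.≤-trans
               (ℕₚ.≤-reflexive (sym (ℕₚ.*-assoc ∑ℕ.⟦ ¬? (d ≟ c) ⟧ _ _)))
               (ℕₚ.*-monoʳ-≤ (∑ℕ.⟦ ¬? (d ≟ c) ⟧ ℕ.* ∑ℕ.⟦ fixedUnit? d ⟧) (fibre≤ d)))) ⟩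
      fib c ℕ.+ ∑ℕ.∑ elements (λ d → (∑ℕ.⟦ ¬? (d ≟ c) ⟧ ℕ.* ∑ℕ.⟦ fixedUnit? d ⟧) ℕ.* suc q)
        ≡⟨ cong (fib c ℕ.+_) (trans (sym (∑ℕ.∑-*ʳ elements (suc q) _)) (ℕₚ.*-comm _ (suc q))) ⟩
      fib c ℕ.+ suc q ℕ.* ∑ℕ.∑ elements (λ d → ∑ℕ.⟦ ¬? (d ≟ c) ⟧ ℕ.* ∑ℕ.⟦ fixedUnit? d ⟧)
        ≤⟨ ℕₚ.+-monoʳ-≤ (fib c) (ℕₚ.*-monoʳ-≤ (suc q) others≤) ⟩
      fib c ℕ.+ suc q ℕ.* k ∎))
    where
    fib : Carrier → ℕ
    fib d = # (λ x → norm x ≟ d)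
    once = ∑ℕ.once (enumerates ℕₚ.+-*-commutativeSemiring)
    count-units : # nonzero? ≡ suc q ℕ.* suc k
    count-units = ℕₚ.suc-injective (begin-equality
      suc (# nonzero?)                ≡⟨ cong suc (length-filter nonzero? elements) ⟨
      suc (length units)              ≡⟨ trans suc-units card≡ ⟩
      q ℕ.* q                         ≡⟨ cong₂ ℕ._*_ q≡ q≡ ⟩
      suc (suc k) ℕ.* suc (suc k)
        ≡⟨ Data.Nat.Solver.+-*-Solver.solve 1 (λ k → (con′ 2 :+′ k) :*′ (con′ 2 :+′ k)
                                             :=′ con′ 1 :+′ (con′ 3 :+′ k) :*′ (con′ 1 :+′ k)) ≡.refl k ⟩
      suc (suc (suc (suc k)) ℕ.* suc k) ≡⟨ cong (λ n → suc (suc n ℕ.* suc k)) q≡ ⟨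
      suc (suc q ℕ.* suc k)           ∎)
      where open Data.Nat.Solver.+-*-Solver using ()
              renaming (con to con′; _:+_ to _:+′_; _:*_ to _:*′_; _:=_ to _:=′_)
    by-norm : # nonzero? ≡ ∑ℕ.∑ elements (λ d → ∑ℕ.⟦ fixedUnit? d ⟧ ℕ.* fib d)
    by-norm = begin-equality
      ∑ℕ.∑ elements (λ x → ∑ℕ.⟦ nonzero? x ⟧)
        ≡⟨ ∑ℕ.∑-cong elements (λ x → trans
             (∑ℕ.⟦⟧-cong (nonzero? x) (fixedUnit? (norm x))
               (λ x≢0 → *-nonzero x≢0 (conj-nonzero x≢0) , norm-fixed x)
               (λ (n≢0 , _) x≡0 → n≢0 (trans (cong (_* conj x) x≡0) (FR.zeroˡ _))))
             (sym (∑ℕ.∑-pick _≟_ elements (norm x) (once (norm x)) (λ d → ∑ℕ.⟦ fixedUnit? d ⟧)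
               (λ { _ ≡.refl → ≡.refl })))) ⟩
      ∑ℕ.∑ elements (λ x → ∑ℕ.∑ elements (λ d → ∑ℕ.⟦ d ≟ norm x ⟧ ℕ.* ∑ℕ.⟦ fixedUnit? d ⟧))
        ≡⟨ ∑ℕ.∑-swap elements elements _ ⟩
      ∑ℕ.∑ elements (λ d → ∑ℕ.∑ elements (λ x → ∑ℕ.⟦ d ≟ norm x ⟧ ℕ.* ∑ℕ.⟦ fixedUnit? d ⟧))
        ≡⟨ ∑ℕ.∑-cong elements (λ d → trans (sym (∑ℕ.∑-*ʳ elements ∑ℕ.⟦ fixedUnit? d ⟧ _))
             (trans (ℕₚ.*-comm _ ∑ℕ.⟦ fixedUnit? d ⟧) (cong (∑ℕ.⟦ fixedUnit? d ⟧ ℕ.*_)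
               (∑ℕ.∑-cong elements (λ x → ∑ℕ.⟦⟧-cong (d ≟ norm x) (norm x ≟ d) sym sym))))) ⟩
      ∑ℕ.∑ elements (λ d → ∑ℕ.⟦ fixedUnit? d ⟧ ℕ.* fib d) ∎
    -- `c` is one of the at most `suc k` fixed units, so setting it aside leaves at most `k`. This
    -- gain of one forces the whole remaining `suc q` units into the fibre over `c`.
    others≤ : ∑ℕ.∑ elements (λ d → ∑ℕ.⟦ ¬? (d ≟ c) ⟧ ℕ.* ∑ℕ.⟦ fixedUnit? d ⟧) ℕ.≤ k
    others≤ = ℕₚ.+-cancelˡ-≤ 1 _ _ (begin
      1 ℕ.+ ∑ℕ.∑ elements (λ d → ∑ℕ.⟦ ¬? (d ≟ c) ⟧ ℕ.* ∑ℕ.⟦ fixedUnit? d ⟧)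
        ≡⟨ cong (ℕ._+ ∑ℕ.∑ elements (λ d → ∑ℕ.⟦ ¬? (d ≟ c) ⟧ ℕ.* ∑ℕ.⟦ fixedUnit? d ⟧))
             (trans (sym (∑ℕ.⟦⟧-yes (fixedUnit? c) (c≢0 , c-fixed)))
             (sym (∑ℕ.∑-pick _≟_ elements c (once c) (λ d → ∑ℕ.⟦ fixedUnit? d ⟧) (λ { _ ≡.refl → ≡.refl })))) ⟩
      ∑ℕ.∑ elements (λ d → ∑ℕ.⟦ d ≟ c ⟧ ℕ.* ∑ℕ.⟦ fixedUnit? d ⟧)
        ℕ.+ ∑ℕ.∑ elements (λ d → ∑ℕ.⟦ ¬? (d ≟ c) ⟧ ℕ.* ∑ℕ.⟦ fixedUnit? d ⟧)
        ≡⟨ ∑ℕ.∑-+ elements (λ d → ∑ℕ.⟦ d ≟ c ⟧ ℕ.* ∑ℕ.⟦ fixedUnit? d ⟧) _ ⟨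
      ∑ℕ.∑ elements (λ d → ∑ℕ.⟦ d ≟ c ⟧ ℕ.* ∑ℕ.⟦ fixedUnit? d ⟧
                         ℕ.+ ∑ℕ.⟦ ¬? (d ≟ c) ⟧ ℕ.* ∑ℕ.⟦ fixedUnit? d ⟧)
        ≡⟨ ∑ℕ.∑-cong elements (λ d → ∑ℕ.⟦⟧-split (d ≟ c) ∑ℕ.⟦ fixedUnit? d ⟧) ⟨
      # fixedUnit?
        ≤⟨ fixedUnits≤ ⟩
      suc k ∎)

  -- A fibre with `suc q` elements is not empty, and a search through the finite list turns this
  -- into a witness.
  norm-surjective : ∀ c → c ≢ 0# → Fixed c → ∃ λ x → norm x ≡ c
  norm-surjective c c≢0 c-fixed with Any.any? (λ x → norm x ≟ c) elements
  ... | yes a = Any.satisfied a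
  ... | no ¬a = contradiction (trans (sym (norm-fibre c c≢0 c-fixed)) (empty elements ¬a)) λ ()
    where
    empty : ∀ L → ¬ Any.Any (λ x → norm x ≡ c) L → ∑ℕ.∑ L (λ x → ∑ℕ.⟦ norm x ≟ c ⟧) ≡ 0
    empty []      _  = ≡.refl
    empty (x ∷ L) ¬a = cong₂ ℕ._+_ (∑ℕ.⟦⟧-no (norm x ≟ c) (¬a ∘ here)) (empty L (¬a ∘ there))

-- From Boolean tests and searches to propositions

module _ {a} {A : Set a} (f : A → Bool) where

  foldr-∧-true : ∀ L → List.foldr (λ x b → f x ∧ b) true L ≡ true → ∀ {x} → x ∈ L → f x ≡ true
  foldr-∧-true (y ∷ L) e x∈ with f y in fy
  foldr-∧-true (y ∷ L) e (here ≡.refl) | true = fy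
  foldr-∧-true (y ∷ L) e (there x∈)    | true = foldr-∧-true L e x∈

  foldr-∧-all : ∀ L → (∀ x → f x ≡ true) → List.foldr (λ x b → f x ∧ b) true L ≡ true
  foldr-∧-all []      all = ≡.refl
  foldr-∧-all (y ∷ L) all = cong₂ _∧_ (all y) (foldr-∧-all L all)

  foldr-∧-false : ∀ L → List.foldr (λ x b → f x ∧ b) true L ≡ false → ∃ λ x → f x ≡ false
  foldr-∧-false (y ∷ L) e with f y in fy
  ... | true  = foldr-∧-false L e
  ... | false = y , fy

  foldr-∨-true : ∀ L → List.foldr (λ x b → f x ∨ b) false L ≡ true → ∃ λ x → f x ≡ true
  foldr-∨-true (y ∷ L) e with f y in fy
  ... | true  = y , fy
  ... | false = foldr-∨-true L e

  foldr-∨-false : ∀ L → List.foldr (λ x b → f x ∨ b) false L ≡ false → ∀ {x} → x ∈ L → f x ≡ false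
  foldr-∨-false (y ∷ L) e x∈ with f y in fy
  foldr-∨-false (y ∷ L) e (here ≡.refl) | false = fy
  foldr-∨-false (y ∷ L) e (there x∈)    | false = foldr-∨-false L e x∈

allB⁻ : ∀ {n} (P : Fin n → Bool) → allB P ≡ true → ∀ i → P i ≡ true
allB⁻ {n} P e i = foldr-∧-true P (List.allFin n) e (∈ₚ.∈-allFin i)

allB⁺ : ∀ {n} (P : Fin n → Bool) → (∀ i → P i ≡ true) → allB P ≡ true
allB⁺ {n} P all = foldr-∧-all P (List.allFin n) all

does⁻ : ∀ {p} {P : Set p} (d : Dec P) → does d ≡ true → P
does⁻ (yes p) _ = p

does⁺ : ∀ {p} {P : Set p} (d : Dec P) → P → does d ≡ true
does⁺ (yes _) _ = ≡.refl
does⁺ (no ¬p) p = contradiction p ¬p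

does-false : ∀ {p} {P : Set p} (d : Dec P) → ¬ P → does d ≡ false
does-false (yes p) ¬p = contradiction p ¬p
does-false (no _)  _  = ≡.refl

-- The Boolean searches range over the members of a list. A given function is first replaced by a
-- listed copy with the same values before the outcome of a search can be applied to it.
covers-cons : ∀ {a} {A : Set a} {k} {L : List A} {M : List (Fin k → A)} →
              (∀ x → x ∈ L) → (∀ v → ∃ λ w → w ∈ M × Pointwise _≡_ w v) →
              ∀ v → ∃ λ w → w ∈ concatMap (λ x → List.map (cons x) M) L × Pointwise _≡_ w v
covers-cons {L = L} {M = M} coversL coversM v with coversM (v ∘ Fin.suc)
... | w , w∈ , w≗ =
  cons (v Fin.zero) w
  , ∈ₚ.∈-concatMap⁺ (λ x → List.map (cons x) M) (lose (coversL (v Fin.zero)) (∈ₚ.∈-map⁺ (cons (v Fin.zero)) w∈))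
  , λ { Fin.zero → ≡.refl ; (Fin.suc i) → w≗ i }

-- Vectors, kernels and column bases

module LinearAlgebra (F : FiniteField) (q : ℕ) where
  open FiniteField F
  open Matrices F q hiding (_*)
  open Field F
  open ≡.≡-Reasoning
  open FSolver using (solve; _:=_; _:+_; _:*_; _:-_; :-_; con)

  infix 4 _≋_ _≋?_ _≋ᴹ?_
  infixl 8 _⊛_

  _≋_ : ∀ {k} → Vector k → Vector k → Set
  _≋_ = Pointwise _≡_

  _≋?_ : ∀ {k} (u v : Vector k) → Dec (u ≋ v)
  _≋?_ = pointwise? _≟_

  _≋ᴹ?_ : ∀ {n} (A B : Matrix n) → Dec (Pointwise _≋_ A B)
  _≋ᴹ?_ = pointwise? _≋?_

  0ᵛ : ∀ {k} → Vector k
  0ᵛ _ = 0#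

  sumF-cong : ∀ k {f g : Fin k → Carrier} → (∀ i → f i ≡ g i) → sumF k f ≡ sumF k g
  sumF-cong zero    f≡g = ≡.refl
  sumF-cong (suc k) f≡g = cong₂ _+_ (f≡g Fin.zero) (sumF-cong k (f≡g ∘ Fin.suc))

  sumF-zero : ∀ k {f : Fin k → Carrier} → (∀ i → f i ≡ 0#) → sumF k f ≡ 0#
  sumF-zero zero    f≡0 = ≡.refl
  sumF-zero (suc k) f≡0 = trans (cong₂ _+_ (f≡0 Fin.zero) (sumF-zero k (f≡0 ∘ Fin.suc))) (FR.+-identityˡ 0#)

  sumF-+ : ∀ k (f g : Fin k → Carrier) → sumF k (λ i → f i + g i) ≡ sumF k f + sumF k g
  sumF-+ zero    f g = sym (FR.+-identityˡ 0#)
  sumF-+ (suc k) f g = trans (cong ((f Fin.zero + g Fin.zero) +_) (sumF-+ k (f ∘ Fin.suc) (g ∘ Fin.suc)))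
    (solve 4 (λ a b s t → (a :+ b) :+ (s :+ t) := (a :+ s) :+ (b :+ t)) ≡.refl _ _ _ _)

  sumF-*ˡ : ∀ k c (f : Fin k → Carrier) → c * sumF k f ≡ sumF k (λ i → c * f i)
  sumF-*ˡ zero    c f = FR.zeroʳ c
  sumF-*ˡ (suc k) c f = trans (FR.distribˡ _ _ _) (cong (c * f Fin.zero +_) (sumF-*ˡ k c (f ∘ Fin.suc)))

  sumF-*ʳ : ∀ k c (f : Fin k → Carrier) → sumF k f * c ≡ sumF k (λ i → f i * c)
  sumF-*ʳ k c f = trans (FR.*-comm _ c) (trans (sumF-*ˡ k c f) (sumF-cong k (λ i → FR.*-comm c (f i))))

  sumF-neg : ∀ k (f : Fin k → Carrier) → sumF k (λ i → - f i) ≡ - sumF k f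
  sumF-neg zero    f = sym FP.-0#≈0#
  sumF-neg (suc k) f = trans (cong (- f Fin.zero +_) (sumF-neg k (f ∘ Fin.suc))) (FP.-‿+-comm _ _)

  sumF-minus : ∀ k (f g : Fin k → Carrier) → sumF k (λ i → f i - g i) ≡ sumF k f - sumF k g
  sumF-minus k f g = trans (sumF-+ k f (λ i → - g i)) (cong (sumF k f +_) (sumF-neg k g))

  sumF-swap : ∀ k l (f : Fin k → Fin l → Carrier) →
              sumF k (λ i → sumF l (f i)) ≡ sumF l (λ j → sumF k (λ i → f i j))
  sumF-swap zero    l f = sym (sumF-zero l (λ _ → ≡.refl))
  sumF-swap (suc k) l f = trans (cong (sumF l (f Fin.zero) +_) (sumF-swap k l (f ∘ Fin.suc))) (sym (sumF-+ l _ _))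

  δ : ∀ {k} → Fin k → Fin k → Carrier
  δ i j = if does (i Finₚ.≟ j) then 1# else 0#

  δ-diag : ∀ {k} (i : Fin k) → δ i i ≡ 1#
  δ-diag i rewrite does⁺ (i Finₚ.≟ i) ≡.refl = ≡.refl

  δ-off : ∀ {k} {i j : Fin k} → i ≢ j → δ i j ≡ 0#
  δ-off {i = i} {j} i≢j rewrite does-false (i Finₚ.≟ j) i≢j = ≡.refl

  sumF-δ : ∀ {k} (i : Fin k) (f : Fin k → Carrier) → sumF k (λ j → δ i j * f j) ≡ f i
  sumF-δ {suc k} Fin.zero f = trans
    (cong₂ _+_ (FR.*-identityˡ _) (sumF-zero k (λ j → FR.zeroˡ _))) (FR.+-identityʳ _)
  sumF-δ {suc k} (Fin.suc i) f = trans
    (cong₂ _+_ (FR.zeroˡ _) (sumF-δ i (f ∘ Fin.suc))) (FR.+-identityˡ _)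

  _⊛_ : ∀ {n} → Matrix n → Vector n → Vector n
  _⊛_ {n} A v i = sumF n (λ j → A i j * v j)

  ⊛-cong : ∀ {n} (A : Matrix n) {u v : Vector n} → u ≋ v → A ⊛ u ≋ A ⊛ v
  ⊛-cong {n} A u≋v i = sumF-cong n (λ j → cong (A i j *_) (u≋v j))

  ⊛-+ : ∀ {n} (A : Matrix n) (u v : Vector n) → A ⊛ (λ i → u i + v i) ≋ (λ i → (A ⊛ u) i + (A ⊛ v) i)
  ⊛-+ {n} A u v i = trans (sumF-cong n (λ j → FR.distribˡ _ _ _)) (sumF-+ n _ _)

  module _ {c ℓ} (S : CommutativeSemiring c ℓ) where
    private module ∑S = Sums S

    enumerates-vectors : ∀ k → ∑S.Enumerates _≋?_ (allVectors k)
    enumerates-vectors zero    = ∑S.enumerates-nil _≟_ _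
    enumerates-vectors (suc k) = ∑S.enumerates-cons (enumerates S) (enumerates-vectors k)

  -- The local functions of allMatrices and rank cannot be named from outside; the next two
  -- blocks recover them by unification, after abstracting the size so that the two
  -- arguments become distinct variables.
  mutual
    matricesGo : ∀ n k → List (Fin k → Fin n → Carrier)
    matricesGo = _

    allMatrices-suc : ∀ n → allMatrices (suc n) ≡
                      concatMap (λ r → List.map (cons r) (matricesGo (suc n) n)) (allVectors (suc n))
    allMatrices-suc n = cong (λ L → concatMap (λ r → List.map (cons r) L) (allVectors (suc n))) (expose-matrices n)

    expose-matrices : ∀ n → _ ≡ matricesGo (suc n) n
    expose-matrices n with suc n
    ... | _ = ≡.refl

  mutual
    rankGo : ∀ {n} (A : Matrix n) → ℕ → ℕ
    rankGo = _

    rank-suc : ∀ n (A : Matrix (suc n)) → rank A ≡ (if hasIndepB A (suc n) then suc n else rankGo A n)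
    rank-suc n A = cong (λ r → if hasIndepB A (suc n) then suc n else r) (expose-rank n A)

    expose-rank : ∀ n (A : Matrix (suc n)) → _ ≡ rankGo A n
    expose-rank n A with suc n
    ... | _ = ≡.refl

  module _ {c ℓ} (S : CommutativeSemiring c ℓ) where
    private module ∑S = Sums S

    enumerates-matrices : ∀ n → ∑S.Enumerates _≋ᴹ?_ (allMatrices n)
    enumerates-matrices n = go n
      where
      go : ∀ k → ∑S.Enumerates (pointwise? _≋?_) (matricesGo n k)
      go zero    = ∑S.enumerates-nil _≋?_ _
      go (suc k) = ∑S.enumerates-cons (enumerates-vectors S n) (go k)

  covers-vectors : ∀ k (v : Vector k) → ∃ λ w → w ∈ allVectors k × w ≋ v
  covers-vectors zero    v = _ , here ≡.refl , λ ()
  covers-vectors (suc k) v = covers-cons complete (covers-vectors k) v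

  covers-maps : ∀ n k (c : Fin k → Fin n) → ∃ λ w → w ∈ allMaps n k × Pointwise _≡_ w c
  covers-maps n zero    c = _ , here ≡.refl , λ ()
  covers-maps n (suc k) c = covers-cons ∈ₚ.∈-allFin (covers-maps n k) c

  count-vectors : ∀ k → ∑ℕ.∑ (allVectors k) (λ _ → 1) ≡ card ℕ.^ k
  count-vectors zero    = ≡.refl
  count-vectors (suc k) = begin
    ∑ℕ.∑ (concatMap (λ x → List.map (cons x) (allVectors k)) elements) (λ _ → 1)
      ≡⟨ ∑ℕ.∑-concatMap _ elements _ ⟩
    ∑ℕ.∑ elements (λ x → ∑ℕ.∑ (List.map (cons x) (allVectors k)) (λ _ → 1))
      ≡⟨ ∑ℕ.∑-cong elements (λ x → trans (∑ℕ.∑-map (cons x) (allVectors k) _)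
           (trans (count-vectors k) (sym (ℕₚ.*-identityˡ _)))) ⟩
    ∑ℕ.∑ elements (λ _ → 1 ℕ.* card ℕ.^ k)
      ≡⟨ ∑ℕ.∑-*ʳ elements (card ℕ.^ k) _ ⟨
    ∑ℕ.∑ elements (λ _ → 1) ℕ.* card ℕ.^ k
      ≡⟨ cong (ℕ._* card ℕ.^ k) (length-∑ elements) ⟨
    card ℕ.* card ℕ.^ k ∎

  -- The number of kernel vectors, that is, `card` raised to the dimension of the kernel.
  nullity : ∀ {n} → Matrix n → ℕ
  nullity {n} A = ∑ℕ.∑ (allVectors n) (λ v → ∑ℕ.⟦ A ⊛ v ≋? 0ᵛ ⟧)

  comb : ∀ {n k} → Matrix n → (Fin k → Fin n) → Vector k → Vector n
  comb {k = k} A c a i = sumF k (λ l → a l * A i (c l))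

  Independent : ∀ {n k} → Matrix n → (Fin k → Fin n) → Set
  Independent A c = ∀ a → comb A c a ≋ 0ᵛ → a ≋ 0ᵛ

  Spanning : ∀ {n k} → Matrix n → (Fin k → Fin n) → Set
  Spanning A c = ∀ j → ∃ λ s → ∀ i → A i j ≡ comb A c s i

  comb-minus : ∀ {n k} (A : Matrix n) (c : Fin k → Fin n) a b i →
           comb A c (λ l → a l - b l) i ≡ comb A c a i - comb A c b i
  comb-minus {k = k} A c a b i = trans
    (sumF-cong k (λ l → solve 3 (λ x y z → (x :- y) :* z := x :* z :- y :* z) ≡.refl (a l) (b l) (A i (c l))))
    (sumF-minus k _ _)

  -- Count the pairs `(a , w)` with `A ⊛ w` equal to the combination of basis columns with
  -- coefficients `a`. For each `a` the solutions `w` form a translate of the kernel through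
  -- `embed a`, which places `a` at the chosen columns. For each `w` there is exactly one `a`, the
  -- coordinates `coord w`.
  nullity-basis : ∀ {n k} (A : Matrix n) (c : Fin k → Fin n) → Independent A c → Spanning A c →
                  nullity A ℕ.* card ℕ.^ k ≡ card ℕ.^ n
  nullity-basis {n} {k} A c indep span = begin
    nullity A ℕ.* card ℕ.^ k
      ≡⟨ cong (nullity A ℕ.*_) (count-vectors k) ⟨
    nullity A ℕ.* ∑ℕ.∑ (allVectors k) (λ _ → 1)
      ≡⟨ ∑ℕ.∑-*ˡ (allVectors k) (nullity A) _ ⟩
    ∑ℕ.∑ (allVectors k) (λ _ → nullity A ℕ.* 1)
      ≡⟨ ∑ℕ.∑-cong (allVectors k) (λ a → trans (ℕₚ.*-identityʳ _) (translate a)) ⟩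
    ∑ℕ.∑ (allVectors k) (λ a → ∑ℕ.∑ (allVectors n) (λ w → ∑ℕ.⟦ A ⊛ w ≋? comb A c a ⟧))
      ≡⟨ ∑ℕ.∑-swap (allVectors k) (allVectors n) _ ⟩
    ∑ℕ.∑ (allVectors n) (λ w → ∑ℕ.∑ (allVectors k) (λ a → ∑ℕ.⟦ A ⊛ w ≋? comb A c a ⟧))
      ≡⟨ ∑ℕ.∑-cong (allVectors n) (λ w → trans
           (∑ℕ.∑-cong (allVectors k) (λ a → ∑ℕ.⟦⟧-cong (A ⊛ w ≋? comb A c a) (a ≋? coord w) (to w a) (from w a)))
           (∑ℕ.once (enumerates-vectors ℕₚ.+-*-commutativeSemiring k) (coord w))) ⟩
    ∑ℕ.∑ (allVectors n) (λ _ → 1)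
      ≡⟨ count-vectors n ⟩
    card ℕ.^ n ∎
    where
    coord : Vector n → Vector k
    coord w l = sumF n (λ j → w j * proj₁ (span j) l)

    comb-coord : ∀ w → A ⊛ w ≋ comb A c (coord w)
    comb-coord w i = begin
      sumF n (λ j → A i j * w j)
        ≡⟨ sumF-cong n (λ j → trans (cong (_* w j) (proj₂ (span j) i)) (sumF-*ʳ k (w j) _)) ⟩
      sumF n (λ j → sumF k (λ l → proj₁ (span j) l * A i (c l) * w j))
        ≡⟨ sumF-swap n k _ ⟩
      sumF k (λ l → sumF n (λ j → proj₁ (span j) l * A i (c l) * w j))
        ≡⟨ sumF-cong k (λ l → trans
             (sumF-cong n (λ j → solve 3 (λ x y z → x :* y :* z := (z :* x) :* y) ≡.refl _ _ _))
             (sym (sumF-*ʳ n (A i (c l)) _))) ⟩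
      comb A c (coord w) i ∎

    to : ∀ w a → A ⊛ w ≋ comb A c a → a ≋ coord w
    to w a e l = -≡0 (indep (λ l → a l - coord w l)
      (λ i → trans (comb-minus A c a (coord w) i)
        (trans (cong₂ _-_ (sym (e i)) (sym (comb-coord w i))) (FR.-‿inverseʳ _))) l)

    from : ∀ w a → a ≋ coord w → A ⊛ w ≋ comb A c a
    from w a e i = trans (comb-coord w i) (sumF-cong k (λ l → cong (_* A i (c l)) (sym (e l))))

    embed : Vector k → Vector n
    embed a j = sumF k (λ l → a l * δ (c l) j)

    ⊛-embed : ∀ a → A ⊛ embed a ≋ comb A c a
    ⊛-embed a i = begin
      sumF n (λ j → A i j * sumF k (λ l → a l * δ (c l) j))
        ≡⟨ sumF-cong n (λ j → sumF-*ˡ k (A i j) _) ⟩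
      sumF n (λ j → sumF k (λ l → A i j * (a l * δ (c l) j)))
        ≡⟨ sumF-swap n k _ ⟩
      sumF k (λ l → sumF n (λ j → A i j * (a l * δ (c l) j)))
        ≡⟨ sumF-cong k (λ l → trans
             (sumF-cong n (λ j → solve 3 (λ x y z → x :* (y :* z) := y :* (z :* x)) ≡.refl (A i j) (a l) (δ (c l) j)))
             (trans (sym (sumF-*ˡ n (a l) _)) (cong (a l *_) (sumF-δ (c l) (A i))))) ⟩
      comb A c a i ∎

    translate : ∀ a → nullity A ≡ ∑ℕ.∑ (allVectors n) (λ w → ∑ℕ.⟦ A ⊛ w ≋? comb A c a ⟧)
    translate a = sym (trans
      (∑ℕ.∑-reindex (enumerates-vectors ℕₚ.+-*-commutativeSemiring n) (enumerates-vectors ℕₚ.+-*-commutativeSemiring n)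
        (λ w i → w i + embed a i) (λ w i → w i - embed a i)
        (λ x y e i → trans (solve 2 (λ x y → x := (x :- y) :+ y) ≡.refl (x i) (embed a i)) (cong (_+ embed a i) (sym (e i))))
        (λ x y e i → trans (solve 2 (λ x y → x := (x :+ y) :- y) ≡.refl (y i) (embed a i)) (cong (_- embed a i) (sym (e i))))
        (λ w → ∑ℕ.⟦ A ⊛ w ≋? comb A c a ⟧)
        (λ x y e → ∑ℕ.⟦⟧-cong (A ⊛ x ≋? comb A c a) (A ⊛ y ≋? comb A c a)
          (λ h i → trans (sym (⊛-cong A e i)) (h i)) (λ h i → trans (⊛-cong A e i) (h i))))
      (∑ℕ.∑-cong (allVectors n) (λ w → ∑ℕ.⟦⟧-cong (A ⊛ (λ i → w i + embed a i) ≋? comb A c a) (A ⊛ w ≋? 0ᵛ)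
        (λ h i → FP.+-cancelʳ (comb A c a i) _ _ (trans (sym (shifted w i)) (trans (h i) (sym (FR.+-identityˡ _)))))
        (λ h i → trans (shifted w i) (trans (cong (_+ comb A c a i) (h i)) (FR.+-identityˡ _))))))
      where
      shifted : ∀ w i → (A ⊛ (λ i → w i + embed a i)) i ≡ (A ⊛ w) i + comb A c a i
      shifted w i = trans (⊛-+ A w (embed a) i) (cong ((A ⊛ w) i +_) (⊛-embed a i))

  -- The rank search produces a column basis

  isZeroVecB⁻ : ∀ {k} (v : Vector k) → isZeroVecB v ≡ true → v ≋ 0ᵛ
  isZeroVecB⁻ v e i = does⁻ (v i ≟ 0#) (allB⁻ _ e i)

  isZeroVecB⁺ : ∀ {k} (v : Vector k) → v ≋ 0ᵛ → isZeroVecB v ≡ true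
  isZeroVecB⁺ v v≋0 = allB⁺ _ (λ i → does⁺ (v i ≟ 0#) (v≋0 i))

  independentB⁻ : ∀ {n k} (A : Matrix n) (c : Fin k → Fin n) → independentB A c ≡ true → Independent A c
  independentB⁻ {k = k} A c e a comb≋0 i with covers-vectors k a
  ... | b , b∈ , b≋a = trans (sym (b≋a i)) (isZeroVecB⁻ b
      (subst (λ t → not t ∨ isZeroVecB b ≡ true)
        (isZeroVecB⁺ (comb A c b) (λ r → trans (sumF-cong k (λ j → cong (_* A r (c j)) (b≋a j))) (comb≋0 r)))
        (foldr-∧-true _ (allVectors k) e b∈)) i)

  independentB-false : ∀ {n k} (A : Matrix n) (c : Fin k → Fin n) → independentB A c ≡ false →
                       ∃ λ a → comb A c a ≋ 0ᵛ × ¬ (a ≋ 0ᵛ)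
  independentB-false {k = k} A c e with foldr-∧-false _ (allVectors k) e
  ... | a , fa with isZeroVecB (comb A c a) in eq
  ... | true = a , isZeroVecB⁻ (comb A c a) eq , λ a≋0 → contradiction (trans (sym fa) (isZeroVecB⁺ a a≋0)) λ ()

  injectiveB⁻ : ∀ {n k} (c : Fin k → Fin n) → injectiveB c ≡ true → ∀ i j → c i ≡ c j → i ≡ j
  injectiveB⁻ c e i j ci≡cj = does⁻ (i Finₚ.≟ j)
    (subst (λ t → not t ∨ does (i Finₚ.≟ j) ≡ true) (does⁺ (c i Finₚ.≟ c j) ci≡cj) (allB⁻ _ (allB⁻ _ e i) j))

  injectiveB⁺ : ∀ {n k} (c : Fin k → Fin n) → (∀ i j → c i ≡ c j → i ≡ j) → injectiveB c ≡ true
  injectiveB⁺ c inj = allB⁺ _ (λ i → allB⁺ _ (λ j → entry i j))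
    where
    entry : ∀ i j → not (does (c i Finₚ.≟ c j)) ∨ does (i Finₚ.≟ j) ≡ true
    entry i j with c i Finₚ.≟ c j
    ... | yes e = does⁺ (i Finₚ.≟ j) (inj i j e)
    ... | no _  = ≡.refl

  -- Choosing the same column at positions `i` and `j` gives the relation `δ i - δ j`, which is
  -- nontrivial when the positions differ.
  independent⇒injective : ∀ {n k} (A : Matrix n) (c : Fin k → Fin n) → Independent A c →
                          ∀ i j → c i ≡ c j → i ≡ j
  independent⇒injective {k = k} A c indep i j ci≡cj with i Finₚ.≟ j
  ... | yes i≡j = i≡j
  ... | no  i≢j = contradiction (begin
    0#                    ≡⟨ indep (λ l → δ i l - δ j l) dependent i ⟨
    δ i i - δ j i         ≡⟨ cong₂ _-_ (δ-diag i) (δ-off (i≢j ∘ sym)) ⟩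
    1# - 0#               ≡⟨ trans (cong (1# +_) FP.-0#≈0#) (FR.+-identityʳ 1#) ⟩
    1#                    ∎) 0≢1
    where
    dependent : comb A c (λ l → δ i l - δ j l) ≋ 0ᵛ
    dependent r = begin
      comb A c (λ l → δ i l - δ j l) r          ≡⟨ comb-minus A c (δ i) (δ j) r ⟩
      comb A c (δ i) r - comb A c (δ j) r       ≡⟨ cong₂ _-_ (sumF-δ i _) (sumF-δ j _) ⟩
      A r (c i) - A r (c j)                     ≡⟨ cong (λ x → A r x - A r (c j)) ci≡cj ⟩
      A r (c j) - A r (c j)                     ≡⟨ FR.-‿inverseʳ _ ⟩
      0#                                        ∎

  hasIndepB-0 : ∀ {n} (A : Matrix n) → hasIndepB A 0 ≡ true
  hasIndepB-0 A = trans (Boolₚ.∨-identityʳ _) (trans (Boolₚ.∧-identityʳ _) (Boolₚ.∨-zeroʳ _))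

  hasIndepB-suc-n : ∀ {n} (A : Matrix n) → hasIndepB A (suc n) ≡ false
  hasIndepB-suc-n {n} A with hasIndepB A (suc n) in e
  ... | false = ≡.refl
  ... | true with foldr-∨-true _ (allMaps n (suc n)) e
  ... | c , fc with injectiveB c in inj
  ... | true with Finₚ.pigeonhole (ℕₚ.n<1+n n) c
  ... | i , j , i<j , ci≡cj = contradiction (injectiveB⁻ c inj i j ci≡cj) (Finₚ.<⇒≢ i<j)

  -- Only the next larger size is required to fail. That is what the descending search has just
  -- tested when it stops, and it is enough to make the family found span the columns.
  MaximalIndep : ∀ {n} → Matrix n → ℕ → Set
  MaximalIndep A r = hasIndepB A r ≡ true × hasIndepB A (suc r) ≡ false

  -- The failure at `suc k` is carried down as an invariant of the search. It starts at `suc n`,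
  -- where the pigeonhole principle rules out an injective choice of columns.
  rank-maximal : ∀ {n} (A : Matrix n) → rank A ℕ.≤ n × MaximalIndep A (rank A)
  rank-maximal {n} A = go n (hasIndepB-suc-n A)
    where
    go : ∀ k → hasIndepB A (suc k) ≡ false → rankGo A k ℕ.≤ k × MaximalIndep A (rankGo A k)
    go zero    e = z≤n , hasIndepB-0 A , e
    go (suc k) e with hasIndepB A (suc k) in e′
    ... | true  = ℕₚ.≤-refl , e′ , e
    ... | false = let r≤k , max = go k e′ in ℕₚ.m≤n⇒m≤1+n r≤k , max

  rank≤ : ∀ {n} (A : Matrix n) → rank A ℕ.≤ n
  rank≤ A = proj₁ (rank-maximal A)

  -- Adjoining any column `j` to a largest independent family creates a relation. Its coefficient at
  -- `j` is nonzero, since otherwise the family itself would be dependent, so the relation can be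
  -- solved for column `j`.
  rank-basis : ∀ {n} (A : Matrix n) → ∃ λ (c : Fin (rank A) → Fin n) → Independent A c × Spanning A c
  rank-basis {n} A with rank-maximal A
  ... | _ , has , hasn't with foldr-∨-true _ (allMaps n (rank A)) has
  ... | c , fc = c , indep , span
    where
    r = rank A
    indep : Independent A c
    indep = independentB⁻ A c (Boolₚ.∧-conicalʳ _ _ fc)

    -- The search may reject `cons j c` because a column repeats or because the family is dependent.
    -- A repeated column is also a dependence, so a relation exists in both cases, in particular
    -- when `j` already occurs in `c`.
    dependency : ∀ j → ∃ λ a → comb A (cons j c) a ≋ 0ᵛ × ¬ (a ≋ 0ᵛ)
    dependency j with covers-maps n (suc r) (cons j c)
    ... | w , w∈ , w≗ = decide (independentB A w) ≡.refl
      where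
      decide : ∀ b → independentB A w ≡ b → ∃ λ a → comb A (cons j c) a ≋ 0ᵛ × ¬ (a ≋ 0ᵛ)
      decide true e = contradiction
        (trans (sym (foldr-∨-false _ (allMaps n (suc r)) hasn't w∈))
          (cong₂ _∧_ (injectiveB⁺ w (independent⇒injective A w (independentB⁻ A w e))) e)) λ ()
      decide false e with independentB-false A w e
      ... | a , comb≋0 , a≢0 = a
        , (λ i → trans (sumF-cong (suc r) (λ l → cong (λ x → a l * A i x) (sym (w≗ l)))) (comb≋0 i)) , a≢0

    span : Spanning A c
    span j with dependency j
    ... | a , comb≋0 , a≢0 = s , λ i → *-cancelˡ a₀ a₀≢0 (begin
        a₀ * A i j
          ≡⟨ FP.+-inverseˡ-unique _ _ (comb≋0 i) ⟩
        - comb A c (a ∘ Fin.suc) i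
          ≡⟨ FP.-1*x≈-x _ ⟨
        - 1# * comb A c (a ∘ Fin.suc) i
          ≡⟨ sumF-*ˡ r (- 1#) _ ⟩
        sumF r (λ l → - 1# * (a (Fin.suc l) * A i (c l)))
          ≡⟨ sumF-cong r (λ l → term i l) ⟩
        sumF r (λ l → a₀ * (s l * A i (c l)))
          ≡⟨ sumF-*ˡ r a₀ _ ⟨
        a₀ * comb A c s i ∎)
      where
      a₀ = a Fin.zero
      a₀≢0 : a₀ ≢ 0#
      a₀≢0 a₀≡0 = a≢0 λ where
        Fin.zero    → a₀≡0
        (Fin.suc l) → indep (a ∘ Fin.suc) (λ i → trans
          (sym (trans (cong (_+ comb A c (a ∘ Fin.suc) i) (trans (cong (_* A i j) a₀≡0) (FR.zeroˡ _))) (FR.+-identityˡ _)))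
          (comb≋0 i)) l
      s : Vector r
      s l = - (inv a₀ a₀≢0 * a (Fin.suc l))
      term : ∀ i l → - 1# * (a (Fin.suc l) * A i (c l)) ≡ a₀ * (s l * A i (c l))
      term i l = begin
        - 1# * (a (Fin.suc l) * A i (c l))
          ≡⟨ cong (λ x → - x * (a (Fin.suc l) * A i (c l))) (inv-r a₀ a₀≢0) ⟨
        - (a₀ * inv a₀ a₀≢0) * (a (Fin.suc l) * A i (c l))
          ≡⟨ solve 4 (λ x w y z → :- (x :* w) :* (y :* z) := x :* (:- (w :* y) :* z)) ≡.refl a₀ _ _ _ ⟩
        a₀ * (s l * A i (c l)) ∎

  nullity-rank : ∀ {n} (A : Matrix n) → nullity A ℕ.* card ℕ.^ rank A ≡ card ℕ.^ n
  nullity-rank A = let c , indep , span = rank-basis A in nullity-basis A c indep span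

-- Computing ranks, Hermitian matrices and the diagonal representatives

module HermitianForms (F : FiniteField) (q : ℕ) (q-primePower : IsPrimePower q)
                      (card≡ : FiniteField.card F ≡ q ℕ.* q) where
  open FiniteField F
  open Matrices F q hiding (_*)
  open Field F
  open QuadraticExtension F q q-primePower card≡
  open NormFibres F q q-primePower card≡
  open LinearAlgebra F q
  open ≡.≡-Reasoning
  open FSolver using (solve; _:=_; _:+_; _:*_; _:-_; :-_; con)

  1<card : 1 ℕ.< card
  1<card = subst (1 ℕ.<_) (sym card≡) (ℕₚ.≤-trans 2≤q (ℕₚ.m≤m*n q q {{ℕ.>-nonZero (ℕₚ.<-trans ℕₚ.0<1+n 2≤q)}}))

  card^-injective : ∀ {a b} → card ℕ.^ a ≡ card ℕ.^ b → a ≡ b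
  card^-injective {a} {b} e with ℕₚ.<-cmp a b
  ... | tri< a<b _ _ = contradiction e (ℕₚ.<⇒≢ (ℕₚ.^-monoʳ-< card 1<card a<b))
  ... | tri≈ _ a≡b _ = a≡b
  ... | tri> _ _ b<a = contradiction (sym e) (ℕₚ.<⇒≢ (ℕₚ.^-monoʳ-< card 1<card b<a))

  -- Any independent spanning family of `k` columns gives `nullity A * card ^ k = card ^ n`, as does
  -- the family behind `rank A`. The nullity is positive and cancels, so the two sizes agree, and
  -- ranks can be computed by exhibiting a basis instead of running the search.
  rank-unique : ∀ {n k} (A : Matrix n) (c : Fin k → Fin n) → Independent A c → Spanning A c → rank A ≡ k
  rank-unique {n} {k} A c indep span = card^-injective
    (ℕₚ.*-cancelˡ-≡ _ _ (nullity A) {{ℕ.≢-nonZero nullity≢0}}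
      (trans (nullity-rank A) (sym (nullity-basis A c indep span))))
    where
    nullity≢0 : nullity A ≢ 0
    nullity≢0 e = contradiction (trans (sym (cong (ℕ._* card ℕ.^ rank A) e)) (nullity-rank A))
      (ℕₚ.<⇒≢ (ℕₚ.m^n>0 card {{ℕ.>-nonZero (ℕₚ.<-trans ℕₚ.0<1+n 1<card)}} n))

  -- The search sees matrices as functions, and entrywise equal ones need not be identical; a column
  -- basis of one is therefore carried over to the other.
  rank-cong : ∀ {n} (A B : Matrix n) → Pointwise _≋_ A B → rank B ≡ rank A
  rank-cong A B A≋B = let c , indep , span = rank-basis A in rank-unique B c
    (λ a e → indep a (λ i → trans (comb-cong c a i) (e i)))
    (λ j → proj₁ (span j) , λ i → trans (sym (A≋B i j)) (trans (proj₂ (span j) i) (comb-cong c _ i)))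
    where
    comb-cong : ∀ {k} (c : Fin k → Fin _) a i → comb A c a i ≡ comb B c a i
    comb-cong {k} c a i = sumF-cong k (λ l → cong (a l *_) (A≋B i (c l)))

  Hermitian : ∀ {n} → Matrix n → Set
  Hermitian A = ∀ i j → conj (A j i) ≡ A i j

  hermitian? : ∀ {n} (A : Matrix n) → Dec (Hermitian A)
  hermitian? A = Finₚ.all? (λ i → Finₚ.all? (λ j → conj (A j i) ≟ A i j))

  isHermitianB⁻ : ∀ {n} (A : Matrix n) → isHermitianB A ≡ true → Hermitian A
  isHermitianB⁻ A e i j = does⁻ (conj (A j i) ≟ A i j) (allB⁻ _ (allB⁻ _ e i) j)

  isHermitianB⁺ : ∀ {n} (A : Matrix n) → Hermitian A → isHermitianB A ≡ true
  isHermitianB⁺ A h = allB⁺ _ (λ i → allB⁺ _ (λ j → does⁺ (conj (A j i) ≟ A i j) (h i j)))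

  hermitian-cong : ∀ {n} (A B : Matrix n) → Pointwise _≋_ A B → Hermitian A → Hermitian B
  hermitian-cong A B e h i j = trans (cong conj (sym (e j i))) (trans (h i j) (e i j))

  hermitian-+ : ∀ {n} (A B : Matrix n) → Hermitian A → Hermitian B → Hermitian (λ i j → A i j + B i j)
  hermitian-+ A B hA hB i j = trans (conj-+ _ _) (cong₂ _+_ (hA i j) (hB i j))

  hermitian-minus : ∀ {n} (A B : Matrix n) → Hermitian A → Hermitian B → Hermitian (A -ᴹ B)
  hermitian-minus A B hA hB i j = trans (conj-+ _ _) (cong₂ _+_ (hA i j) (trans (conj-neg _) (cong -_ (hB i j))))

  diagOnes-yes : ∀ {n} r (i j : Fin n) → Fin.toℕ i ℕ.< r → diagOnes n r i j ≡ δ i j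
  diagOnes-yes r i j i<r
    rewrite does⁺ (Fin.toℕ i ℕ.<? r) i<r | Boolₚ.∧-identityʳ (does (i Finₚ.≟ j)) = ≡.refl

  diagOnes-no : ∀ {n} r (i j : Fin n) → ¬ Fin.toℕ i ℕ.< r → diagOnes n r i j ≡ 0#
  diagOnes-no r i j i≮r
    rewrite does-false (Fin.toℕ i ℕ.<? r) i≮r | Boolₚ.∧-zeroʳ (does (i Finₚ.≟ j)) = ≡.refl

  diagOnes-off : ∀ {n} r {i j : Fin n} → i ≢ j → diagOnes n r i j ≡ 0#
  diagOnes-off r {i} {j} i≢j rewrite does-false (i Finₚ.≟ j) i≢j = ≡.refl

  diagOnes-hermitian : ∀ n r → Hermitian (diagOnes n r)
  diagOnes-hermitian n r i j = cases (i Finₚ.≟ j) (Fin.toℕ i ℕ.<? r)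
    where
    cases : Dec (i ≡ j) → Dec (Fin.toℕ i ℕ.< r) → conj (diagOnes n r j i) ≡ diagOnes n r i j
    cases (no i≢j) _ = trans (cong conj (diagOnes-off r (i≢j ∘ sym))) (trans conj-0 (sym (diagOnes-off r i≢j)))
    cases (yes ≡.refl) (yes i<r) = trans (cong conj D≡1) (trans conj-1 (sym D≡1))
      where
      D≡1 : diagOnes n r i i ≡ 1#
      D≡1 = trans (diagOnes-yes r i i i<r) (δ-diag i)
    cases (yes ≡.refl) (no i≮r) =
      trans (cong conj (diagOnes-no r i i i≮r)) (trans conj-0 (sym (diagOnes-no r i i i≮r)))

  rank-diagOnes : ∀ {n r} → r ℕ.≤ n → rank (diagOnes n r) ≡ r
  rank-diagOnes {n} {r} r≤n = rank-unique D c indep span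
    where
    D = diagOnes n r
    c : Fin r → Fin n
    c l = Fin.inject≤ l r≤n
    c<r : ∀ l → Fin.toℕ (c l) ℕ.< r
    c<r l = subst (ℕ._< r) (sym (Finₚ.toℕ-inject≤ l r≤n)) (Finₚ.toℕ<n l)
    δ-c : ∀ l l′ → δ (c l) (c l′) ≡ δ l l′
    δ-c l l′ with l Finₚ.≟ l′
    ... | yes ≡.refl = δ-diag (c l)
    ... | no  l≢l′   = δ-off (l≢l′ ∘ Finₚ.inject≤-injective r≤n r≤n l l′)
    indep : Independent D c
    indep a e l = begin
      a l                                      ≡⟨ sumF-δ l a ⟨
      sumF r (λ l′ → δ l l′ * a l′)
        ≡⟨ sumF-cong r (λ l′ → trans (cong (_* a l′) (trans (sym (δ-c l l′)) (sym (diagOnes-yes r (c l) (c l′) (c<r l)))))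
                                     (FR.*-comm _ (a l′))) ⟩
      comb D c a (c l)                         ≡⟨ e (c l) ⟩
      0#                                       ∎
    span : Spanning D c
    span j with Fin.toℕ j ℕ.<? r
    ... | yes j<r = δ l₀ , λ i → sym (trans (sumF-δ l₀ (λ l → D i (c l))) (cong (D i) cl₀≡j))
      where
      l₀ = Fin.fromℕ< j<r
      cl₀≡j : c l₀ ≡ j
      cl₀≡j = Finₚ.toℕ-injective (trans (Finₚ.toℕ-inject≤ l₀ r≤n) (Finₚ.toℕ-fromℕ< j<r))
    ... | no j≮r = 0ᵛ , λ i → trans (column i) (sym (sumF-zero r (λ l → FR.zeroˡ _)))
      where
      column : ∀ i → D i j ≡ 0#
      column i = [ (λ { ≡.refl → diagOnes-no r i i j≮r }) , diagOnes-off r ]′ (toSum (i Finₚ.≟ j))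

  -- Hermitian matrices of rank one as outer products

  outer : ∀ {n} → Vector n → Matrix n
  outer v i j = v i * conj (v j)

  outer-hermitian : ∀ {n} (v : Vector n) → Hermitian (outer v)
  outer-hermitian v i j = trans (conj-* _ _) (trans (cong (conj (v j) *_) (conj-conj (v i))) (FR.*-comm _ _))

  nonzero-entry : ∀ {n} (v : Vector n) → ¬ (v ≋ 0ᵛ) → ∃ λ j → v j ≢ 0#
  nonzero-entry {n} v v≢0 = Finₚ.¬∀⟶∃¬ n (λ j → v j ≡ 0#) (λ j → v j ≟ 0#) v≢0

  rank-outer-at : ∀ {n} (v : Vector n) j → v j ≢ 0# → rank (outer v) ≡ 1
  rank-outer-at {n} v j vj≢0 = rank-unique (outer v) c indep span
    where
    c : Fin 1 → Fin n
    c _ = j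
    w = inv (conj (v j)) (conj-nonzero vj≢0)
    indep : Independent (outer v) c
    indep a e Fin.zero = *-cancelˡ (norm (v j)) (*-nonzero vj≢0 (conj-nonzero vj≢0))
      (trans (FR.*-comm _ _) (trans (sym (FR.+-identityʳ _)) (trans (e j) (sym (FR.zeroʳ _)))))
    span : Spanning (outer v) c
    span b = (λ _ → conj (v b) * w) , λ i → sym (begin
      conj (v b) * w * (v i * conj (v j)) + 0#
        ≡⟨ solve 4 (λ x w y z → x :* w :* (y :* z) :+ con (ℤ.+ 0) := y :* x :* (z :* w)) ≡.refl (conj (v b)) w (v i) (conj (v j)) ⟩
      v i * conj (v b) * (conj (v j) * w)
        ≡⟨ cong (v i * conj (v b) *_) (inv-r _ (conj-nonzero vj≢0)) ⟩
      v i * conj (v b) * 1#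
        ≡⟨ FR.*-identityʳ _ ⟩
      v i * conj (v b) ∎)

  rank-outer : ∀ {n} (v : Vector n) → ¬ (v ≋ 0ᵛ) → rank (outer v) ≡ 1
  rank-outer v v≢0 = let j , vj≢0 = nonzero-entry v v≢0 in rank-outer-at v j vj≢0

  -- A nonzero diagonal pivot through which all two-by-two minors vanish: the matrix is recovered
  -- from column `j` and row `j` divided by `A j j`.
  OneColumn : ∀ {n} → Matrix n → Set
  OneColumn A = ∃ λ j → A j j ≢ 0# × (∀ a b → A a b * A j j ≡ A a j * A j b)

  -- Every column is a multiple of column `j`. If `A j j` were zero, all of row `j` would vanish,
  -- hence by Hermitian symmetry column `j` too, against its independence.
  basis-one-column : ∀ {n} (A : Matrix n) → Hermitian A → (c : Fin 1 → Fin n) →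
                     Independent A c → Spanning A c → OneColumn A
  basis-one-column {n} A herm c indep span = j , Ajj≢0 , λ a b → begin
      A a b * A j j                   ≡⟨ cong (_* A j j) (col a b) ⟩
      s b * A a j * A j j             ≡⟨ solve 3 (λ x y z → x :* y :* z := y :* (x :* z)) ≡.refl _ _ _ ⟩
      A a j * (s b * A j j)           ≡⟨ cong (A a j *_) (col j b) ⟨
      A a j * A j b                   ∎
    where
    j = c Fin.zero
    s : Fin n → Carrier
    s b = proj₁ (span b) Fin.zero
    col : ∀ a b → A a b ≡ s b * A a j
    col a b = trans (proj₂ (span b) a) (FR.+-identityʳ _)
    Ajj≢0 : A j j ≢ 0#
    Ajj≢0 Ajj≡0 = contradiction (sym (indep (λ _ → 1#) (λ i → begin
        1# * A i j + 0#        ≡⟨ trans (FR.+-identityʳ _) (FR.*-identityˡ _) ⟩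
        A i j                  ≡⟨ herm i j ⟨
        conj (A j i)           ≡⟨ cong conj (trans (col j i) (trans (cong (s i *_) Ajj≡0) (FR.zeroʳ _))) ⟩
        conj 0#                ≡⟨ conj-0 ⟩
        0#                     ∎) Fin.zero)) 0≢1

  rank-one-column : ∀ {n} (A : Matrix n) → Hermitian A → rank A ≡ 1 → OneColumn A
  rank-one-column {n} A herm r≡1 =
    let c , indep , span = subst (λ r → ∃ λ (c : Fin r → Fin n) → Independent A c × Spanning A c) r≡1 (rank-basis A)
    in basis-one-column A herm c indep span

  Decomposes : ∀ {n} → Matrix n → Vector n → Set
  Decomposes A v = ¬ (v ≋ 0ᵛ) × Pointwise _≋_ A (outer v)

  decomposes? : ∀ {n} (A : Matrix n) (v : Vector n) → Dec (Decomposes A v)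
  decomposes? A v = ¬? (v ≋? 0ᵛ) ×-dec (A ≋ᴹ? outer v)

  -- A decomposing vector is determined by its entry `x = v j`: multiplying
  -- `A a j = v a * conj (v j)` by `x` gives `v a * A j j`, whence the formula `φ`. The condition on
  -- `x` is `norm x = A j j`, so the count is the size of a norm fibre.
  count-one-column : ∀ {n} (A : Matrix n) → Hermitian A → OneColumn A →
                     ∑ℕ.∑ (allVectors n) (λ v → ∑ℕ.⟦ decomposes? A v ⟧) ≡ suc q
  count-one-column {n} A herm (j , d≢0 , factor) = trans
      (∑ℕ.∑-bijection (enumerates-vectors ℕₚ.+-*-commutativeSemiring n) (enumerates ℕₚ.+-*-commutativeSemiring)
        φ (λ v → v j) (decomposes? A) (λ x → norm x ≟ d) to from)
      (norm-fibre d d≢0 (herm j j))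
    where
    d = A j j
    w = inv d d≢0
    w-fixed : conj w ≡ w
    w-fixed = *-cancelˡ d d≢0 (begin
      d * conj w         ≡⟨ cong (_* conj w) (herm j j) ⟨
      conj d * conj w    ≡⟨ conj-* d w ⟨
      conj (d * w)       ≡⟨ cong conj (inv-r d d≢0) ⟩
      conj 1#            ≡⟨ conj-1 ⟩
      1#                 ≡⟨ inv-r d d≢0 ⟨
      d * w              ∎)
    φ : Carrier → Vector n
    φ x a = A a j * x * w
    to : ∀ v x → Decomposes A v → x ≡ v j → norm x ≡ d × v ≋ φ x
    to v .(v j) (_ , A≋vv*) ≡.refl = sym (A≋vv* j j) , λ a → sym (begin
      A a j * v j * w                 ≡⟨ cong (λ y → y * v j * w) (A≋vv* a j) ⟩
      v a * conj (v j) * v j * w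
        ≡⟨ solve 4 (λ x y z w → x :* y :* z :* w := x :* (z :* y :* w)) ≡.refl (v a) (conj (v j)) (v j) w ⟩
      v a * (norm (v j) * w)          ≡⟨ cong (λ y → v a * (y * w)) (A≋vv* j j) ⟨
      v a * (d * w)                   ≡⟨ cong (v a *_) (inv-r d d≢0) ⟩
      v a * 1#                        ≡⟨ FR.*-identityʳ _ ⟩
      v a                             ∎)
    from : ∀ v x → norm x ≡ d → v ≋ φ x → Decomposes A v × x ≡ v j
    from v x norm-x v≋ = (v≢0 , A≋vv*) , x≡vj
      where
      x≡vj : x ≡ v j
      x≡vj = sym (begin
        v j          ≡⟨ v≋ j ⟩
        d * x * w    ≡⟨ solve 3 (λ d x w → d :* x :* w := x :* (d :* w)) ≡.refl d x w ⟩
        x * (d * w)  ≡⟨ cong (x *_) (inv-r d d≢0) ⟩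
        x * 1#       ≡⟨ FR.*-identityʳ x ⟩
        x            ∎)
      v≢0 : ¬ (v ≋ 0ᵛ)
      v≢0 v≋0 = d≢0 (trans (sym norm-x) (trans (cong (_* conj x) (trans x≡vj (v≋0 j))) (FR.zeroˡ _)))
      A≋vv* : Pointwise _≋_ A (outer v)
      A≋vv* a b = sym (begin
        v a * conj (v b)
          ≡⟨ cong₂ (λ s t → s * conj t) (v≋ a) (v≋ b) ⟩
        A a j * x * w * conj (A b j * x * w)
          ≡⟨ cong (A a j * x * w *_) (trans (conj-* _ _) (cong₂ _*_ (conj-* _ _) w-fixed)) ⟩
        A a j * x * w * (conj (A b j) * conj x * w)
          ≡⟨ cong (λ y → A a j * x * w * (y * conj x * w)) (herm j b) ⟩
        A a j * x * w * (A j b * conj x * w)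
          ≡⟨ solve 5 (λ s x w t y → s :* x :* w :* (t :* y :* w) := s :* t :* (x :* y) :* (w :* w)) ≡.refl _ x w _ _ ⟩
        A a j * A j b * norm x * (w * w)
          ≡⟨ cong₂ (λ s t → s * t * (w * w)) (factor a b) (sym norm-x) ⟨
        A a b * d * d * (w * w)
          ≡⟨ solve 3 (λ s d w → s :* d :* d :* (w :* w) := s :* (d :* w) :* (d :* w)) ≡.refl (A a b) d w ⟩
        A a b * (d * w) * (d * w)
          ≡⟨ cong (λ y → A a b * y * y) (inv-r d d≢0) ⟩
        A a b * 1# * 1#
          ≡⟨ trans (FR.*-identityʳ _) (FR.*-identityʳ _) ⟩
        A a b ∎)

  count-decompositions : ∀ {n} (A : Matrix n) → Hermitian A → rank A ≡ 1 →
                         ∑ℕ.∑ (allVectors n) (λ v → ∑ℕ.⟦ decomposes? A v ⟧) ≡ suc q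
  count-decompositions A herm r≡1 = count-one-column A herm (rank-one-column A herm r≡1)

  -- Sesquilinear forms and the trace pairing

  sesq : ∀ {n} → Matrix n → Vector n → Vector n → Carrier
  sesq {n} B u v = sumF n (λ i → conj (u i) * (B ⊛ v) i)

  form : ∀ {n} → Matrix n → Vector n → Carrier
  form B v = sesq B v v

  sesq-cong : ∀ {n} (B : Matrix n) {u u′ v v′ : Vector n} → u ≋ u′ → v ≋ v′ → sesq B u v ≡ sesq B u′ v′
  sesq-cong {n} B e f = sumF-cong n (λ i → cong₂ _*_ (cong conj (e i)) (⊛-cong B f i))

  sesq-+ʳ : ∀ {n} (B : Matrix n) u v w → sesq B u (λ i → v i + w i) ≡ sesq B u v + sesq B u w
  sesq-+ʳ {n} B u v w = trans
    (sumF-cong n (λ i → trans (cong (conj (u i) *_) (⊛-+ B v w i)) (FR.distribˡ _ _ _))) (sumF-+ n _ _)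

  sesq-+ˡ : ∀ {n} (B : Matrix n) u v w → sesq B (λ i → u i + v i) w ≡ sesq B u w + sesq B v w
  sesq-+ˡ {n} B u v w = trans
    (sumF-cong n (λ i → trans (cong (_* (B ⊛ w) i) (conj-+ (u i) (v i))) (FR.distribʳ _ _ _))) (sumF-+ n _ _)

  conj-sumF : ∀ k (f : Fin k → Carrier) → conj (sumF k f) ≡ sumF k (conj ∘ f)
  conj-sumF zero    f = conj-0
  conj-sumF (suc k) f = trans (conj-+ _ _) (cong (conj (f Fin.zero) +_) (conj-sumF k (f ∘ Fin.suc)))

  sesq-expand : ∀ {n} (B : Matrix n) u v → sesq B u v ≡ sumF n (λ i → sumF n (λ j → conj (u i) * (B i j * v j)))
  sesq-expand {n} B u v = sumF-cong n (λ i → sumF-*ˡ n _ _)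

  sesq-conj : ∀ {n} (B : Matrix n) → Hermitian B → ∀ u v → conj (sesq B u v) ≡ sesq B v u
  sesq-conj {n} B herm u v = begin
    conj (sesq B u v)
      ≡⟨ cong conj (sesq-expand B u v) ⟩
    conj (sumF n (λ i → sumF n (λ j → conj (u i) * (B i j * v j))))
      ≡⟨ trans (conj-sumF n _) (sumF-cong n (λ i → conj-sumF n _)) ⟩
    sumF n (λ i → sumF n (λ j → conj (conj (u i) * (B i j * v j))))
      ≡⟨ sumF-swap n n _ ⟩
    sumF n (λ j → sumF n (λ i → conj (conj (u i) * (B i j * v j))))
      ≡⟨ sumF-cong n (λ j → sumF-cong n (λ i → entry i j)) ⟩
    sumF n (λ j → sumF n (λ i → conj (v j) * (B j i * u i)))
      ≡⟨ sesq-expand B v u ⟨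
    sesq B v u ∎
    where
    entry : ∀ i j → conj (conj (u i) * (B i j * v j)) ≡ conj (v j) * (B j i * u i)
    entry i j = begin
      conj (conj (u i) * (B i j * v j))
        ≡⟨ trans (conj-* _ _) (cong₂ _*_ (conj-conj (u i)) (trans (conj-* _ _) (cong (_* conj (v j)) (herm j i)))) ⟩
      u i * (B j i * conj (v j))
        ≡⟨ solve 3 (λ x y z → x :* (y :* z) := z :* (y :* x)) ≡.refl _ _ _ ⟩
      conj (v j) * (B j i * u i) ∎

  form-fixed : ∀ {n} (B : Matrix n) → Hermitian B → ∀ v → Fixed (form B v)
  form-fixed B herm v = sesq-conj B herm v v

  form-scale : ∀ {n} (B : Matrix n) x v → form B (λ i → x * v i) ≡ norm x * form B v
  form-scale {n} B x v = begin
    form B (λ i → x * v i)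
      ≡⟨ sesq-expand B _ _ ⟩
    sumF n (λ i → sumF n (λ j → conj (x * v i) * (B i j * (x * v j))))
      ≡⟨ sumF-cong n (λ i → sumF-cong n (λ j → trans (cong (_* (B i j * (x * v j))) (conj-* x (v i)))
           (solve 5 (λ x y z b w → y :* z :* (b :* (x :* w)) := x :* y :* (z :* (b :* w))) ≡.refl x (conj x) _ _ _))) ⟩
    sumF n (λ i → sumF n (λ j → norm x * (conj (v i) * (B i j * v j))))
      ≡⟨ trans (sumF-*ˡ n (norm x) _) (sumF-cong n (λ i → sumF-*ˡ n (norm x) _)) ⟨
    norm x * sumF n (λ i → sumF n (λ j → conj (v i) * (B i j * v j)))
      ≡⟨ cong (norm x *_) (sesq-expand B v v) ⟨
    norm x * form B v ∎

  form-0 : ∀ {n} (B : Matrix n) → form B 0ᵛ ≡ 0#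
  form-0 {n} B = sumF-zero n (λ i → trans (cong (_* (B ⊛ 0ᵛ) i) conj-0) (FR.zeroˡ _))

  form-+ : ∀ {n} (B : Matrix n) v w →
           form B (λ i → v i + w i) ≡ form B w + (sesq B v w + sesq B w v) + form B v
  form-+ B v w = begin
    sesq B (λ i → v i + w i) (λ i → v i + w i)
      ≡⟨ sesq-+ˡ B v w _ ⟩
    sesq B v (λ i → v i + w i) + sesq B w (λ i → v i + w i)
      ≡⟨ cong₂ _+_ (sesq-+ʳ B v v w) (sesq-+ʳ B w v w) ⟩
    (sesq B v v + sesq B v w) + (sesq B w v + sesq B w w)
      ≡⟨ solve 4 (λ a b c d → (a :+ b) :+ (c :+ d) := d :+ (b :+ c) :+ a) ≡.refl _ _ _ _ ⟩
    form B w + (sesq B v w + sesq B w v) + form B v ∎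

  form-matrix-+ : ∀ {n} (A B : Matrix n) v → form (λ i j → A i j + B i j) v ≡ form A v + form B v
  form-matrix-+ {n} A B v = trans
    (sumF-cong n (λ i → trans (cong (conj (v i) *_)
      (trans (sumF-cong n (λ j → FR.distribʳ _ _ _)) (sumF-+ n _ _))) (FR.distribˡ _ _ _)))
    (sumF-+ n _ _)

  form-matrix-cong : ∀ {n} (A B : Matrix n) → Pointwise _≋_ A B → ∀ v → form A v ≡ form B v
  form-matrix-cong {n} A B e v = sumF-cong n (λ i → cong (conj (v i) *_) (sumF-cong n (λ j → cong (_* v j) (e i j))))

  form-matrix-minus : ∀ {n} (A B : Matrix n) v → form (A -ᴹ B) v ≡ form A v - form B v
  form-matrix-minus A B v = begin
    form (A -ᴹ B) v
      ≡⟨ solve 2 (λ x y → x := x :+ y :- y) ≡.refl _ (form B v) ⟩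
    (form (A -ᴹ B) v + form B v) - form B v
      ≡⟨ cong (_- form B v) (form-matrix-+ (A -ᴹ B) B v) ⟨
    form (λ i j → (A i j - B i j) + B i j) v - form B v
      ≡⟨ cong (_- form B v) (form-matrix-cong _ A (λ i j → solve 2 (λ x y → x :- y :+ y := x) ≡.refl _ _) v) ⟩
    form A v - form B v ∎

  pairing : ∀ {n} → Matrix n → Matrix n → Carrier
  pairing A B = trace (Matrices._* F q A ·ᴹ B)

  pairing-congˡ : ∀ {n} (A A′ B : Matrix n) → Pointwise _≋_ A A′ → pairing A B ≡ pairing A′ B
  pairing-congˡ {n} A A′ B e = sumF-cong n (λ i → sumF-cong n (λ k → cong (λ x → conj x * B k i) (e k i)))

  pairing-outer : ∀ {n} (v : Vector n) (B : Matrix n) → pairing (outer v) B ≡ form B v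
  pairing-outer {n} v B = begin
    sumF n (λ i → sumF n (λ k → conj (v k * conj (v i)) * B k i))
      ≡⟨ sumF-cong n (λ i → sumF-cong n (λ k → trans
           (cong (_* B k i) (trans (conj-* _ _) (cong (conj (v k) *_) (conj-conj (v i)))))
           (solve 3 (λ x y z → x :* y :* z := x :* (z :* y)) ≡.refl _ _ _))) ⟩
    sumF n (λ i → sumF n (λ k → conj (v k) * (B k i * v i)))
      ≡⟨ sumF-swap n n _ ⟩
    sumF n (λ k → sumF n (λ i → conj (v k) * (B k i * v i)))
      ≡⟨ sesq-expand B v v ⟨
    form B v ∎

  -- The matrix with `x` at `(i , j)`, `conj x` at `(j , i)` and zeros elsewhere when `i` and `j`
  -- differ. Its form at `v` is the trace of `conj (v i) * v j * x`, so a suitable `x` reaches any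
  -- fixed value once `v i` and `v j` are nonzero.
  elementary : ∀ {n} → Fin n → Fin n → Carrier → Matrix n
  elementary i j x a b = x * (δ i a * δ j b) + conj x * (δ j a * δ i b)

  conj-δ : ∀ {k} (i j : Fin k) → conj (δ i j) ≡ δ i j
  conj-δ i j with does (i Finₚ.≟ j)
  ... | true  = conj-1
  ... | false = conj-0

  elementary-hermitian : ∀ {n} (i j : Fin n) x → Hermitian (elementary i j x)
  elementary-hermitian i j x a b = begin
    conj (x * (δ i b * δ j a) + conj x * (δ j b * δ i a))
      ≡⟨ trans (conj-+ _ _) (cong₂ _+_
           (trans (conj-* _ _) (cong (conj x *_) (trans (conj-* _ _) (cong₂ _*_ (conj-δ i b) (conj-δ j a)))))
           (trans (conj-* _ _) (cong₂ _*_ (conj-conj x) (trans (conj-* _ _) (cong₂ _*_ (conj-δ j b) (conj-δ i a)))))) ⟩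
    conj x * (δ i b * δ j a) + x * (δ j b * δ i a)
      ≡⟨ solve 6 (λ x y p r s t → y :* (p :* r) :+ x :* (s :* t) := x :* (t :* s) :+ y :* (r :* p)) ≡.refl x (conj x) _ _ _ _ ⟩
    elementary i j x a b ∎

  elementary-diagonal : ∀ {n} {i j : Fin n} → i ≢ j → ∀ x a → elementary i j x a a ≡ 0#
  elementary-diagonal {i = i} {j} i≢j x a with i Finₚ.≟ a
  ... | no _ = solve 3 (λ x y p → x :* (con (ℤ.+ 0) :* p) :+ y :* (p :* con (ℤ.+ 0)) := con (ℤ.+ 0)) ≡.refl x (conj x) (δ j a)
  ... | yes ≡.refl rewrite δ-off (i≢j ∘ sym) =
    solve 2 (λ x y → x :* (con (ℤ.+ 1) :* con (ℤ.+ 0)) :+ y :* (con (ℤ.+ 0) :* con (ℤ.+ 1)) := con (ℤ.+ 0)) ≡.refl x (conj x)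

  form-elementary : ∀ {n} (i j : Fin n) x v →
                    form (elementary i j x) v ≡ conj (v i) * v j * x + conj (conj (v i) * v j * x)
  form-elementary {n} i j x v = begin
    sumF n (λ a → conj (v a) * sumF n (λ b → elementary i j x a b * v b))
      ≡⟨ sumF-cong n (λ a → cong (conj (v a) *_) (row a)) ⟩
    sumF n (λ a → conj (v a) * (δ i a * (x * v j) + δ j a * (conj x * v i)))
      ≡⟨ sumF-cong n (λ a → solve 5 (λ y p r s t → y :* (p :* r :+ s :* t) := p :* (y :* r) :+ s :* (y :* t))
           ≡.refl (conj (v a)) (δ i a) (x * v j) (δ j a) (conj x * v i)) ⟩
    sumF n (λ a → δ i a * (conj (v a) * (x * v j)) + δ j a * (conj (v a) * (conj x * v i)))
      ≡⟨ trans (sumF-+ n _ _) (cong₂ _+_ (sumF-δ i _) (sumF-δ j _)) ⟩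
    conj (v i) * (x * v j) + conj (v j) * (conj x * v i)
      ≡⟨ solve 6 (λ a x b a′ y b′ → a :* (x :* b) :+ a′ :* (y :* b′) := a :* b :* x :+ b′ :* a′ :* y)
           ≡.refl (conj (v i)) x (v j) (conj (v j)) (conj x) (v i) ⟩
    conj (v i) * v j * x + v i * conj (v j) * conj x
      ≡⟨ cong (conj (v i) * v j * x +_) (trans (conj-* _ _)
           (cong (_* conj x) (trans (conj-* _ _) (cong (_* conj (v j)) (conj-conj (v i)))))) ⟨
    conj (v i) * v j * x + conj (conj (v i) * v j * x) ∎
    where
    row : ∀ a → sumF n (λ b → elementary i j x a b * v b) ≡ δ i a * (x * v j) + δ j a * (conj x * v i)
    row a = begin
      sumF n (λ b → (x * (δ i a * δ j b) + conj x * (δ j a * δ i b)) * v b)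
        ≡⟨ sumF-cong n (λ b → solve 7 (λ x y p r s t z → (x :* (p :* r) :+ y :* (s :* t)) :* z
                                     := r :* (p :* (x :* z)) :+ t :* (s :* (y :* z)))
             ≡.refl x (conj x) (δ i a) (δ j b) (δ j a) (δ i b) (v b)) ⟩
      sumF n (λ b → δ j b * (δ i a * (x * v b)) + δ i b * (δ j a * (conj x * v b)))
        ≡⟨ trans (sumF-+ n _ _) (cong₂ _+_ (sumF-δ j _) (sumF-δ i _)) ⟩
      δ i a * (x * v j) + δ j a * (conj x * v i) ∎

  -- An off-diagonal term contains a zero entry of `v`, a diagonal term a zero entry of `B`.
  form-single : ∀ {n} (B : Matrix n) v → (∀ i → B i i ≡ 0#) → (∀ i j → i ≢ j → v i ≡ 0# ⊎ v j ≡ 0#) → form B v ≡ 0#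
  form-single {n} B v diag single = trans (sesq-expand B v v) (sumF-zero n (λ i → sumF-zero n (λ j → entry i j)))
    where
    entry : ∀ i j → conj (v i) * (B i j * v j) ≡ 0#
    entry i j with i Finₚ.≟ j
    ... | yes ≡.refl = trans (cong (λ b → conj (v i) * (b * v i)) (diag i)) (trans (cong (conj (v i) *_) (FR.zeroˡ _)) (FR.zeroʳ _))
    ... | no i≢j with single i j i≢j
    ... | inj₁ vi≡0 = trans (cong (_* (B i j * v j)) (trans (cong conj vi≡0) conj-0)) (FR.zeroˡ _)
    ... | inj₂ vj≡0 = trans (cong (λ y → conj (v i) * (B i j * y)) vj≡0) (trans (cong (conj (v i) *_) (FR.zeroʳ _)) (FR.zeroʳ _))

  sesq-kernelʳ : ∀ {n} (B : Matrix n) u w → B ⊛ w ≋ 0ᵛ → sesq B u w ≡ 0#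
  sesq-kernelʳ {n} B u w e = sumF-zero n (λ i → trans (cong (conj (u i) *_) (e i)) (FR.zeroʳ _))

  sesq-basis : ∀ {n} (B : Matrix n) w i x → sesq B (λ a → δ i a * x) w ≡ conj x * (B ⊛ w) i
  sesq-basis {n} B w i x = trans
    (sumF-cong n (λ a → trans (cong (_* (B ⊛ w) a) (trans (conj-* _ _) (cong (_* conj x) (conj-δ i a)))) (FR.*-assoc _ _ _)))
    (sumF-δ i (λ a → conj x * (B ⊛ w) a))

-- Character sums of Hermitian forms

module CharacterSums (F : FiniteField) (q : ℕ) (q-primePower : IsPrimePower q)
                     (card≡ : FiniteField.card F ≡ q ℕ.* q)
                     {c ℓ : Level} (R : CommutativeRing c ℓ) (domain : IntegralDomainChar0 R)
                     (χ : FiniteField.Carrier F → CommutativeRing.Carrier R)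
                     (χ-character : NontrivialCharacter F q R χ) where
  open FiniteField F using (elements; card; _≟_) renaming
    (Carrier to 𝔽; _+_ to _+ᶠ_; _*_ to _*ᶠ_; -_ to -ᶠ_; _-_ to _-ᶠ_; 0# to 0ᶠ; 1# to 1ᶠ; 0≢1 to 0ᶠ≢1ᶠ)
  open Matrices F q hiding (_*)
  open Field F hiding (commutativeRing)
  open QuadraticExtension F q q-primePower card≡
  open LinearAlgebra F q
  open HermitianForms F q q-primePower card≡
  open CommutativeRing R renaming (sym to ≈-sym; trans to ≈-trans)
  open IntegralDomainChar0 domain
  open NontrivialCharacter χ-character
  open Sums commutativeSemiring
  open Algebra.Properties.Semiring.Mult semiring
    using (×-homo-+; ×1-homo-*) renaming (_×_ to _·_)
  open import Relation.Binary.Reasoning.Setoid setoid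
  private
    module RP = Algebra.Properties.Ring ring
    module RS = IntegerSolver R
    module FS = IntegerSolver (Field.commutativeRing F)

  cast : ℕ → Carrier
  cast n = n · 1#

  fromℕR≡ : ∀ n → fromℕR R n ≡ cast n
  fromℕR≡ zero    = ≡.refl
  fromℕR≡ (suc n) = cong (1# +_) (fromℕR≡ n)

  cast-+ : ∀ m n → cast (m ℕ.+ n) ≈ cast m + cast n
  cast-+ = ×-homo-+ 1#

  cast-* : ∀ m n → cast (m ℕ.* n) ≈ cast m * cast n
  cast-* = ×1-homo-*

  cast-nonzero : ∀ n → ¬ (cast (suc n) ≈ 0#)
  cast-nonzero n e = char0 n (≈-trans (reflexive (fromℕR≡ (suc n))) e)

  -- Equations between sums in `R` are pulled back along this to the natural numbers, where
  -- divisibility by `suc q` can be used.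
  cast-injective : ∀ m n → cast m ≈ cast n → m ≡ n
  cast-injective zero    zero    e = ≡.refl
  cast-injective zero    (suc n) e = contradiction (≈-sym e) (cast-nonzero n)
  cast-injective (suc m) zero    e = contradiction e (cast-nonzero m)
  cast-injective (suc m) (suc n) e = cong suc (cast-injective m n (RP.+-cancelˡ 1# _ _ e))

  cast-⟦⟧ : ∀ {p} {P : Set p} (d : Dec P) → cast ∑ℕ.⟦ d ⟧ ≈ ⟦ d ⟧
  cast-⟦⟧ (yes _) = +-identityʳ 1#
  cast-⟦⟧ (no _)  = refl

  cast-∑ : ∀ {a} {A : Set a} (L : List A) (f : A → ℕ) → cast (∑ℕ.∑ L f) ≈ ∑ L (λ x → cast (f x))
  cast-∑ []      f = refl
  cast-∑ (x ∷ L) f = ≈-trans (cast-+ (f x) _) (+-congˡ (cast-∑ L f))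

  cast-count : ∀ {a p} {A : Set a} {P : A → Set p} (L : List A) (P? : ∀ x → Dec (P x)) →
               cast (∑ℕ.∑ L (λ x → ∑ℕ.⟦ P? x ⟧)) ≈ ∑ L (λ x → ⟦ P? x ⟧)
  cast-count L P? = ≈-trans (cast-∑ L _) (∑-cong L (λ x → cast-⟦⟧ (P? x)))

  -- Summing g over all x and over all τ x gives the same value T, so T = u T.
  ∑-eigen : ∀ {a r} {A : Set a} {_~_ : Rel A r} {_≟_ : Decidable _~_} {L : List A} →
            Enumerates _≟_ L → (τ τ⁻¹ : A → A) →
            (∀ x y → y ~ τ⁻¹ x → x ~ τ y) → (∀ x y → x ~ τ y → y ~ τ⁻¹ x) →
            (g : A → Carrier) → (∀ x y → x ~ y → g x ≈ g y) →
            ∀ u → (∀ x → g (τ x) ≈ u * g x) → ¬ (u ≈ 1#) → ∑ L g ≈ 0#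
  ∑-eigen {L = L} enum τ τ⁻¹ to from g g-resp u g-τ u≉1 =
    [ (λ u-1≈0 → contradiction (RP.x∙y⁻¹≈ε⇒x≈y u 1# u-1≈0) u≉1) , (λ z → z) ]′
      (noZeroDivisors (u - 1#) T (begin
        (u - 1#) * T      ≈⟨ RS.solve 2 (λ u t → (u RS.:- RS.con (ℤ.+ 1)) RS.:* t
                               RS.:= u RS.:* t RS.:- t) refl u T ⟩
        u * T - T         ≈⟨ +-congʳ uT≈T ⟩
        T - T             ≈⟨ -‿inverseʳ T ⟩
        0#                ∎))
    where
    T = ∑ L g
    uT≈T : u * T ≈ T
    uT≈T = begin
      u * T                    ≈⟨ ∑-*ˡ L u g ⟩
      ∑ L (λ x → u * g x)      ≈⟨ ∑-cong L g-τ ⟨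
      ∑ L (λ x → g (τ x))      ≈⟨ ∑-reindex enum enum τ τ⁻¹ to from g g-resp ⟨
      T                        ∎

  χ-cong : ∀ {x y} → x ≡ y → χ x ≈ χ y
  χ-cong e = reflexive (cong χ e)

  t : 𝔽
  t = proj₁ nontrivial

  t-fixed : Fixed t
  t-fixed = proj₁ (proj₂ nontrivial)

  χt≉1 : ¬ (χ t ≈ 1#)
  χt≉1 = proj₂ (proj₂ nontrivial)

  fixed? : ∀ x → Dec (Fixed x)
  fixed? x = conj x ≟ x

  fixed-+ : ∀ {x y} → Fixed x → Fixed y → Fixed (x +ᶠ y)
  fixed-+ fx fy = trans (conj-+ _ _) (cong₂ _+ᶠ_ fx fy)

  fixed-neg : ∀ {x} → Fixed x → Fixed (-ᶠ x)
  fixed-neg fx = trans (conj-neg _) (cong -ᶠ_ fx)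

  +ᶠ-ᶠ : ∀ x y → (x +ᶠ y) -ᶠ y ≡ x
  +ᶠ-ᶠ x y = FS.solve 2 (λ x y → (x FS.:+ y) FS.:- y FS.:= x) ≡.refl x y

  -ᶠ+ᶠ : ∀ x y → (x -ᶠ y) +ᶠ y ≡ x
  -ᶠ+ᶠ x y = FS.solve 2 (λ x y → (x FS.:- y) FS.:+ y FS.:= x) ≡.refl x y

  enumF : Enumerates _≟_ elements
  enumF = enumerates commutativeSemiring

  -- The sum over the subfield, cut out of the field by an indicator: translation by `t` preserves
  -- the fixed elements and multiplies `χ` by `χ t`. As `χ` is multiplicative only on fixed
  -- arguments, the indicator also guards that step.
  ∑-χ : ∑ elements (λ a → ⟦ fixed? a ⟧ * χ a) ≈ 0#
  ∑-χ = ∑-eigen enumF (_+ᶠ t) (_-ᶠ t)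
    (λ x y e → trans (sym (-ᶠ+ᶠ x t)) (cong (_+ᶠ t) (sym e)))
    (λ x y e → trans (sym (+ᶠ-ᶠ y t)) (cong (_-ᶠ t) (sym e)))
    _ (λ { x .x ≡.refl → refl }) (χ t)
    (λ a → begin
      ⟦ fixed? (a +ᶠ t) ⟧ * χ (a +ᶠ t)
        ≈⟨ *-congʳ (⟦⟧-cong (fixed? (a +ᶠ t)) (fixed? a)
             (λ f → subst Fixed (+ᶠ-ᶠ a t) (fixed-+ f (fixed-neg t-fixed))) (λ f → fixed-+ f t-fixed)) ⟩
      ⟦ fixed? a ⟧ * χ (a +ᶠ t)       ≈⟨ ⟦⟧-guard (fixed? a) (λ f → χ-+ a t f t-fixed) ⟩
      ⟦ fixed? a ⟧ * (χ a * χ t)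
        ≈⟨ RS.solve 3 (λ i x y → i RS.:* (x RS.:* y) RS.:= y RS.:* (i RS.:* x)) refl _ _ _ ⟩
      χ t * (⟦ fixed? a ⟧ * χ a)      ∎)
    χt≉1

  module Size (n : ℕ) where
    private
      𝓥 = allVectors n
      𝓜 = allMatrices n

    enumV : Enumerates _≋?_ 𝓥
    enumV = enumerates-vectors commutativeSemiring n

    enumM : Enumerates _≋ᴹ?_ 𝓜
    enumM = enumerates-matrices commutativeSemiring n

    scale-to : ∀ x (x≢0 : x ≢ 0ᶠ) (u v : Vector n) → v ≋ (λ i → inv x x≢0 *ᶠ u i) → u ≋ (λ i → x *ᶠ v i)
    scale-to x x≢0 u v e i = sym (trans (cong (x *ᶠ_) (e i))
      (trans (sym (FR.*-assoc _ _ _)) (trans (cong (_*ᶠ u i) (inv-r x x≢0)) (FR.*-identityˡ _))))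

    scale-from : ∀ x (x≢0 : x ≢ 0ᶠ) (u v : Vector n) → u ≋ (λ i → x *ᶠ v i) → v ≋ (λ i → inv x x≢0 *ᶠ u i)
    scale-from x x≢0 u v e i = *-cancelˡ x x≢0
      (trans (sym (e i)) (scale-to x x≢0 u _ (λ _ → ≡.refl) i))

    ∑-scale : ∀ x → x ≢ 0ᶠ → (g : Vector n → Carrier) → (∀ u v → u ≋ v → g u ≈ g v) →
              ∑ 𝓥 g ≈ ∑ 𝓥 (λ v → g (λ i → x *ᶠ v i))
    ∑-scale x x≢0 g g-resp = ∑-reindex enumV enumV (λ v i → x *ᶠ v i) (λ v i → inv x x≢0 *ᶠ v i)
      (scale-to x x≢0) (scale-from x x≢0) g g-resp

    shift-to : ∀ (w u v : Vector n) → v ≋ (λ i → u i -ᶠ w i) → u ≋ (λ i → v i +ᶠ w i)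
    shift-to w u v e i = trans (sym (-ᶠ+ᶠ (u i) (w i))) (cong (_+ᶠ w i) (sym (e i)))

    shift-from : ∀ (w u v : Vector n) → u ≋ (λ i → v i +ᶠ w i) → v ≋ (λ i → u i -ᶠ w i)
    shift-from w u v e i = trans (sym (+ᶠ-ᶠ (v i) (w i))) (cong (_-ᶠ w i) (sym (e i)))

    form-resp : ∀ B (u v : Vector n) → u ≋ v → χ (form B u) ≈ χ (form B v)
    form-resp B u v e = χ-cong (sesq-cong B e e)

    nonzero-vec? : ∀ (v : Vector n) → Dec (¬ (v ≋ 0ᵛ))
    nonzero-vec? v = ¬? (v ≋? 0ᵛ)

    S S₀ : Matrix n → Carrier
    S  B = ∑ 𝓥 (λ v → χ (form B v))
    S₀ B = ∑ 𝓥 (λ v → ⟦ nonzero-vec? v ⟧ * χ (form B v))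

    S-split : ∀ B → S B ≈ 1# + S₀ B
    S-split B = begin
      S B
        ≈⟨ ∑-cong 𝓥 (λ v → ⟦⟧-split (v ≋? 0ᵛ) (χ (form B v))) ⟩
      ∑ 𝓥 (λ v → ⟦ v ≋? 0ᵛ ⟧ * χ (form B v) + ⟦ nonzero-vec? v ⟧ * χ (form B v))
        ≈⟨ ∑-+ 𝓥 _ _ ⟩
      ∑ 𝓥 (λ v → ⟦ v ≋? 0ᵛ ⟧ * χ (form B v)) + S₀ B
        ≈⟨ +-congʳ (∑-pick _≋?_ 𝓥 0ᵛ (once enumV 0ᵛ) (λ v → χ (form B v)) (λ v → form-resp B v 0ᵛ)) ⟩
      χ (form B 0ᵛ) + S₀ B
        ≈⟨ +-congʳ (≈-trans (χ-cong (form-0 B)) χ-0) ⟩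
      1# + S₀ B ∎

    hermitianRankOne? : ∀ (A : Matrix n) → Dec (Hermitian A × rank A ≡ 1)
    hermitianRankOne? A = hermitian? A ×-dec (rank A ℕ.≟ 1)

    count-outer : ∀ A → ∑ 𝓥 (λ v → ⟦ decomposes? A v ⟧) ≈ cast (suc q) * ⟦ hermitianRankOne? A ⟧
    count-outer A = go (hermitianRankOne? A)
      where
      go : (d : Dec (Hermitian A × rank A ≡ 1)) → ∑ 𝓥 (λ v → ⟦ decomposes? A v ⟧) ≈ cast (suc q) * ⟦ d ⟧
      go (yes (herm , r≡1)) = begin
        ∑ 𝓥 (λ v → ⟦ decomposes? A v ⟧)                   ≈⟨ cast-count 𝓥 (decomposes? A) ⟨
        cast (∑ℕ.∑ 𝓥 (λ v → ∑ℕ.⟦ decomposes? A v ⟧))      ≡⟨ cong cast (count-decompositions A herm r≡1) ⟩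
        cast (suc q)                                      ≈⟨ *-identityʳ _ ⟨
        cast (suc q) * 1#                                 ∎
      go (no ¬hr) = ≈-trans
        (∑-zero 𝓥 (λ v → ⟦⟧-no (decomposes? A v) (λ (v≢0 , A≋) → ¬hr
          ( hermitian-cong (outer v) A (λ i j → sym (A≋ i j)) (outer-hermitian v)
          , trans (rank-cong (outer v) A (λ i j → sym (A≋ i j))) (rank-outer v v≢0)))))
        (≈-sym (zeroʳ _))

    -- Applied to `χ` of the pairing this links `Q` with `S₀`; applied to the indicator of a value
    -- of the pairing it shows that vector counts are multiples of `suc q`.
    ∑-outer : (g : Matrix n → Carrier) → (∀ A B → Pointwise _≋_ A B → g A ≈ g B) →
              ∑ 𝓥 (λ v → ⟦ nonzero-vec? v ⟧ * g (outer v)) ≈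
              cast (suc q) * ∑ 𝓜 (λ A → ⟦ hermitianRankOne? A ⟧ * g A)
    ∑-outer g g-resp = begin
      ∑ 𝓥 (λ v → ⟦ nonzero-vec? v ⟧ * g (outer v))
        ≈⟨ ∑-cong 𝓥 (λ v → *-congˡ (∑-pick _≋ᴹ?_ 𝓜 (outer v) (once enumM _) g (λ A → g-resp A (outer v)))) ⟨
      ∑ 𝓥 (λ v → ⟦ nonzero-vec? v ⟧ * ∑ 𝓜 (λ A → ⟦ A ≋ᴹ? outer v ⟧ * g A))
        ≈⟨ ∑-cong 𝓥 (λ v → ≈-trans (∑-*ˡ 𝓜 _ _) (∑-cong 𝓜 (λ A →
             ≈-trans (≈-sym (*-assoc _ _ _))
               (*-congʳ (≈-sym (⟦⟧-× (nonzero-vec? v) (A ≋ᴹ? outer v))))))) ⟩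
      ∑ 𝓥 (λ v → ∑ 𝓜 (λ A → ⟦ decomposes? A v ⟧ * g A))
        ≈⟨ ∑-swap 𝓥 𝓜 _ ⟩
      ∑ 𝓜 (λ A → ∑ 𝓥 (λ v → ⟦ decomposes? A v ⟧ * g A))
        ≈⟨ ∑-cong 𝓜 (λ A → ≈-trans (≈-sym (∑-*ʳ 𝓥 (g A) _))
             (≈-trans (*-congʳ (count-outer A)) (*-assoc _ _ _))) ⟩
      ∑ 𝓜 (λ A → cast (suc q) * (⟦ hermitianRankOne? A ⟧ * g A))
        ≈⟨ ∑-*ˡ 𝓜 (cast (suc q)) _ ⟨
      cast (suc q) * ∑ 𝓜 (λ A → ⟦ hermitianRankOne? A ⟧ * g A) ∎

    sumR≡∑ : ∀ {a} {A : Set a} (L : List A) (f : A → Carrier) → Designs.sumR F q R L f ≡ ∑ L f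
    sumR≡∑ []      f = ≡.refl
    sumR≡∑ (x ∷ L) f = cong (f x +_) (sumR≡∑ L f)

    ∑-hermitian : (f : Matrix n → Carrier) → ∑ (hermitian n) f ≈ ∑ 𝓜 (λ A → ⟦ hermitian? A ⟧ * f A)
    ∑-hermitian f = ≈-trans (∑-filter _ 𝓜 f) (∑-cong 𝓜 (λ A → *-congʳ
      (⟦⟧-cong (isHermitianB A Boolₚ.≟ true) (hermitian? A) (isHermitianB⁻ A) (isHermitianB⁺ A))))

    Q′-S₀ : ∀ B → cast (suc q) * Designs.Q′ F q R χ 1 B ≈ S₀ B
    Q′-S₀ B = begin
      cast (suc q) * Designs.Q′ F q R χ 1 B
        ≡⟨ cong (cast (suc q) *_) (sumR≡∑ (filter (λ A → rank A ℕ.≟ 1) (hermitian n)) (λ A → χ (pairing A B))) ⟩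
      cast (suc q) * ∑ (filter (λ A → rank A ℕ.≟ 1) (hermitian n)) (λ A → χ (pairing A B))
        ≈⟨ *-congˡ (≈-trans (∑-filter (λ A → rank A ℕ.≟ 1) (hermitian n) _)
             (≈-trans (∑-hermitian _) (∑-cong 𝓜 (λ A →
               ≈-trans (≈-sym (*-assoc _ _ _))
                 (*-congʳ (≈-sym (⟦⟧-× (hermitian? A) (rank A ℕ.≟ 1)))))))) ⟩
      cast (suc q) * ∑ 𝓜 (λ A → ⟦ hermitianRankOne? A ⟧ * χ (pairing A B))
        ≈⟨ ∑-outer (λ A → χ (pairing A B)) (λ A A′ e → χ-cong (pairing-congˡ A A′ B e)) ⟨
      ∑ 𝓥 (λ v → ⟦ nonzero-vec? v ⟧ * χ (pairing (outer v) B))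
        ≈⟨ ∑-cong 𝓥 (λ v → *-congˡ (χ-cong (pairing-outer v B))) ⟩
      S₀ B ∎

    -- Value distribution of a form and the square of its sum

    module _ (B : Matrix n) (B-herm : Hermitian B) where

      level : 𝔽 → Carrier
      level a = ∑ 𝓥 (λ v → ⟦ nonzero-vec? v ⟧ * ⟦ form B v ≟ a ⟧)

      -- It counts rank-one matrices where `level` counts vectors, so it is the quotient of
      -- `level a` by `suc q`, kept as a natural number.
      levelℕ : 𝔽 → ℕ
      levelℕ a = ∑ℕ.∑ 𝓜 (λ A → ∑ℕ.⟦ hermitianRankOne? A ×-dec (pairing A B ≟ a) ⟧)

      level-divisible : ∀ a → level a ≈ cast (suc q) * cast (levelℕ a)
      level-divisible a = begin
        level a
          ≈⟨ ∑-cong 𝓥 (λ v → *-congˡ (reflexive (cong (λ x → ⟦ x ≟ a ⟧) (pairing-outer v B)))) ⟨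
        ∑ 𝓥 (λ v → ⟦ nonzero-vec? v ⟧ * ⟦ pairing (outer v) B ≟ a ⟧)
          ≈⟨ ∑-outer (λ A → ⟦ pairing A B ≟ a ⟧)
               (λ A A′ e → reflexive (cong (λ x → ⟦ x ≟ a ⟧) (pairing-congˡ A A′ B e))) ⟩
        cast (suc q) * ∑ 𝓜 (λ A → ⟦ hermitianRankOne? A ⟧ * ⟦ pairing A B ≟ a ⟧)
          ≈⟨ *-congˡ (∑-cong 𝓜 (λ A → ⟦⟧-× (hermitianRankOne? A) (pairing A B ≟ a))) ⟨
        cast (suc q) * ∑ 𝓜 (λ A → ⟦ hermitianRankOne? A ×-dec (pairing A B ≟ a) ⟧)
          ≈⟨ *-congˡ (cast-count 𝓜 (λ A → hermitianRankOne? A ×-dec (pairing A B ≟ a))) ⟨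
        cast (suc q) * cast (levelℕ a) ∎

      -- `a` is the norm of some nonzero `x`, and replacing `v` by `x` times `v` multiplies the form
      -- by `a`.
      level-unit : ∀ a → a ≢ 0ᶠ → Fixed a → level a ≈ level 1ᶠ
      level-unit a a≢0 a-fixed with NormFibres.norm-surjective F q q-primePower card≡ a a≢0 a-fixed
      ... | x , ≡.refl = ≈-trans
        (∑-scale x x≢0 (λ v → ⟦ nonzero-vec? v ⟧ * ⟦ form B v ≟ a ⟧)
          (λ u v e → *-cong
            (⟦⟧-cong (nonzero-vec? u) (nonzero-vec? v)
              (λ u≢0 v≋0 → u≢0 (λ i → trans (e i) (v≋0 i))) (λ v≢0 u≋0 → v≢0 (λ i → trans (sym (e i)) (u≋0 i))))
            (reflexive (cong (λ y → ⟦ y ≟ a ⟧) (sesq-cong B e e)))))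
        (∑-cong 𝓥 (λ v → *-cong
          (⟦⟧-cong (nonzero-vec? (λ i → x *ᶠ v i)) (nonzero-vec? v)
            (λ xv≢0 v≋0 → xv≢0 (λ i → trans (cong (x *ᶠ_) (v≋0 i)) (FR.zeroʳ x)))
            (λ v≢0 xv≋0 → v≢0 (λ i → *-zero x (xv≋0 i) x≢0)))
          (⟦⟧-cong (form B (λ i → x *ᶠ v i) ≟ a) (form B v ≟ 1ᶠ)
            (λ e → *-cancelˡ a a≢0 (trans (sym (form-scale B x v)) (trans e (sym (FR.*-identityʳ a)))))
            (λ e → trans (form-scale B x v) (trans (cong (a *ᶠ_) e) (FR.*-identityʳ a))))))
        where
        x≢0 : x ≢ 0ᶠ
        x≢0 x≡0 = a≢0 (trans (cong (_*ᶠ conj x) x≡0) (FR.zeroˡ _))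

      -- Sort the vectors by the value of the form. All nonzero fixed values have the same
      -- multiplicity `level 1ᶠ`, and `χ` sums to -1 over them because its sum over all fixed
      -- elements is 0. The roots of unity thus cancel and only counts remain.
      S₀-levels : S₀ B ≈ level 0ᶠ - level 1ᶠ
      S₀-levels = begin
        S₀ B
          ≈⟨ ∑-cong 𝓥 (λ v → *-congˡ (begin
               χ (form B v)
                 ≈⟨ *-identityˡ _ ⟨
               1# * χ (form B v)
                 ≈⟨ *-congʳ (⟦⟧-yes (fixed? (form B v)) (form-fixed B B-herm v)) ⟨
               ⟦ fixed? (form B v) ⟧ * χ (form B v)
                 ≈⟨ ∑-pick _≟_ elements (form B v) (once enumF _) (λ a → ⟦ fixed? a ⟧ * χ a) (λ { _ ≡.refl → refl }) ⟨
               ∑ elements (λ a → ⟦ a ≟ form B v ⟧ * (⟦ fixed? a ⟧ * χ a)) ∎)) ⟩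
        ∑ 𝓥 (λ v → ⟦ nonzero-vec? v ⟧ * ∑ elements (λ a → ⟦ a ≟ form B v ⟧ * (⟦ fixed? a ⟧ * χ a)))
          ≈⟨ ∑-cong 𝓥 (λ v → ≈-trans (∑-*ˡ elements _ _) (∑-cong elements (λ a →
               ≈-trans (≈-sym (*-assoc _ _ _))
                 (*-congʳ (*-congˡ (⟦⟧-cong (a ≟ form B v) (form B v ≟ a) sym sym)))))) ⟩
        ∑ 𝓥 (λ v → ∑ elements (λ a → ⟦ nonzero-vec? v ⟧ * ⟦ form B v ≟ a ⟧ * (⟦ fixed? a ⟧ * χ a)))
          ≈⟨ ∑-swap 𝓥 elements _ ⟩
        ∑ elements (λ a → ∑ 𝓥 (λ v → ⟦ nonzero-vec? v ⟧ * ⟦ form B v ≟ a ⟧ * (⟦ fixed? a ⟧ * χ a)))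
          ≈⟨ ∑-cong elements (λ a → ≈-trans (≈-sym (∑-*ʳ 𝓥 _ _)) (split a (a ≟ 0ᶠ))) ⟩
        ∑ elements (λ a → ⟦ a ≟ 0ᶠ ⟧ * (level 0ᶠ - level 1ᶠ) + level 1ᶠ * (⟦ fixed? a ⟧ * χ a))
          ≈⟨ ∑-+ elements _ _ ⟩
        ∑ elements (λ a → ⟦ a ≟ 0ᶠ ⟧ * (level 0ᶠ - level 1ᶠ)) + ∑ elements (λ a → level 1ᶠ * (⟦ fixed? a ⟧ * χ a))
          ≈⟨ +-cong (∑-pick _≟_ elements 0ᶠ (once enumF 0ᶠ) (λ _ → level 0ᶠ - level 1ᶠ) (λ _ _ → refl))
               (≈-trans (≈-sym (∑-*ˡ elements _ _))
                 (≈-trans (*-congˡ ∑-χ) (zeroʳ _))) ⟩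
        level 0ᶠ - level 1ᶠ + 0#
          ≈⟨ +-identityʳ _ ⟩
        level 0ᶠ - level 1ᶠ ∎
        where
        -- Gives every value, 0 included, the multiplicity `level 1ᶠ`, so that the complete sum of
        -- `χ` can be factored out; the first term corrects the multiplicity at 0.
        split : ∀ a (d : Dec (a ≡ 0ᶠ)) → level a * (⟦ fixed? a ⟧ * χ a) ≈
                ⟦ d ⟧ * (level 0ᶠ - level 1ᶠ) + level 1ᶠ * (⟦ fixed? a ⟧ * χ a)
        split _ (yes ≡.refl) = begin
          level 0ᶠ * (⟦ fixed? 0ᶠ ⟧ * χ 0ᶠ)
            ≈⟨ *-congˡ one ⟩
          level 0ᶠ * 1#
            ≈⟨ RS.solve 2 (λ x y → x RS.:* RS.con (ℤ.+ 1) RS.:=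
                 RS.con (ℤ.+ 1) RS.:* (x RS.:- y) RS.:+ y RS.:* RS.con (ℤ.+ 1)) refl (level 0ᶠ) (level 1ᶠ) ⟩
          1# * (level 0ᶠ - level 1ᶠ) + level 1ᶠ * 1#
            ≈⟨ +-congˡ (*-congˡ one) ⟨
          1# * (level 0ᶠ - level 1ᶠ) + level 1ᶠ * (⟦ fixed? 0ᶠ ⟧ * χ 0ᶠ) ∎
          where
          one : ⟦ fixed? 0ᶠ ⟧ * χ 0ᶠ ≈ 1#
          one = ≈-trans (*-cong (⟦⟧-yes (fixed? 0ᶠ) conj-0) χ-0) (*-identityˡ 1#)
        split a (no a≢0) = begin
          level a * (⟦ fixed? a ⟧ * χ a)
            ≈⟨ RS.solve 3 (λ x y z → x RS.:* (y RS.:* z) RS.:= y RS.:* (x RS.:* z)) refl _ _ _ ⟩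
          ⟦ fixed? a ⟧ * (level a * χ a)
            ≈⟨ ⟦⟧-guard (fixed? a) (λ f → *-congʳ (level-unit a a≢0 f)) ⟩
          ⟦ fixed? a ⟧ * (level 1ᶠ * χ a)
            ≈⟨ RS.solve 4 (λ x y z w → y RS.:* (x RS.:* z) RS.:= RS.con (ℤ.+ 0) RS.:* w RS.:+ x RS.:* (y RS.:* z)) refl _ _ _ _ ⟩
          0# * (level 0ᶠ - level 1ᶠ) + level 1ᶠ * (⟦ fixed? a ⟧ * χ a) ∎

      -- With the subtracted count moved to the left, the congruence of `S B` to 1 modulo `suc q`
      -- involves only casts of natural numbers.
      S-mod-q+1 : S B + cast (suc q ℕ.* levelℕ 1ᶠ) ≈ cast (suc (suc q ℕ.* levelℕ 0ᶠ))
      S-mod-q+1 = begin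
        S B + cast (suc q ℕ.* levelℕ 1ᶠ)
          ≈⟨ +-cong (≈-trans (S-split B) (+-congˡ S₀-levels))
               (≈-trans (cast-* (suc q) (levelℕ 1ᶠ)) (≈-sym (level-divisible 1ᶠ))) ⟩
        1# + (level 0ᶠ - level 1ᶠ) + level 1ᶠ
          ≈⟨ RS.solve 3 (λ o x y → o RS.:+ (x RS.:- y) RS.:+ y RS.:= o RS.:+ x) refl 1# _ _ ⟩
        1# + level 0ᶠ
          ≈⟨ +-congˡ (≈-trans (cast-* (suc q) (levelℕ 0ᶠ)) (≈-sym (level-divisible 0ᶠ))) ⟨
        1# + cast (suc q ℕ.* levelℕ 0ᶠ) ∎

      -1-unit : (-ᶠ 1ᶠ) ≢ 0ᶠ
      -1-unit e = 0ᶠ≢1ᶠ (sym (trans (sym (FP.-‿involutive 1ᶠ)) (trans (cong -ᶠ_ e) FP.-0#≈0#)))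

      -- Scaling all vectors by an element of norm -1 negates the form. This takes the place of
      -- complex conjugation: it rewrites the second factor of `S B * S B` with negated arguments.
      S-neg : S B ≈ ∑ 𝓥 (λ v → χ (-ᶠ form B v))
      S-neg with NormFibres.norm-surjective F q q-primePower card≡ (-ᶠ 1ᶠ) -1-unit (fixed-neg conj-1)
      ... | x , norm-x = ≈-trans
        (∑-scale x x≢0 (λ v → χ (form B v)) (form-resp B))
        (∑-cong 𝓥 (λ v → χ-cong (trans (form-scale B x v) (trans (cong (_*ᶠ form B v) norm-x) (FP.-1*x≈-x _)))))
        where
        x≢0 : x ≢ 0ᶠ
        x≢0 x≡0 = -1-unit (trans (sym norm-x) (trans (cong (_*ᶠ conj x) x≡0) (FR.zeroˡ _)))

      -- The polarisation of the form: the difference between its value at `w + v` and the sum of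
      -- its values at `w` and `v`.
      cross : Vector n → Vector n → 𝔽
      cross w v = sesq B w v +ᶠ sesq B v w

      cross-trace : ∀ w v → cross w v ≡ conj (sesq B v w) +ᶠ sesq B v w
      cross-trace w v = cong (_+ᶠ sesq B v w) (sym (sesq-conj B B-herm v w))

      cross-fixed : ∀ w v → Fixed (cross w v)
      cross-fixed w v = trans (conj-+ _ _)
        (trans (cong₂ _+ᶠ_ (sesq-conj B B-herm w v) (sesq-conj B B-herm v w)) (FR.+-comm _ _))

      -- For fixed `w` the map `cross w` is additive in `v`. It vanishes when `w` is in the kernel
      -- of `B`; otherwise some translation of `v` adds `t` to it, and the sum is 0.
      ∑-cross : ∀ w → ∑ 𝓥 (λ v → χ (cross w v)) ≈ ⟦ B ⊛ w ≋? 0ᵛ ⟧ * cast (card ℕ.^ n)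
      ∑-cross w = go (B ⊛ w ≋? 0ᵛ)
        where
        go : (d : Dec (B ⊛ w ≋ 0ᵛ)) → ∑ 𝓥 (λ v → χ (cross w v)) ≈ ⟦ d ⟧ * cast (card ℕ.^ n)
        go (yes e) = begin
          ∑ 𝓥 (λ v → χ (cross w v))
            ≈⟨ ∑-cong 𝓥 (λ v → ≈-trans (χ-cong (trans (cross-trace w v)
                 (trans (cong (λ y → conj y +ᶠ y) (sesq-kernelʳ B v w e))
                   (trans (FR.+-identityʳ _) conj-0)))) (≈-trans χ-0 (≈-sym (+-identityʳ 1#)))) ⟩
          ∑ 𝓥 (λ v → cast 1)
            ≈⟨ cast-∑ 𝓥 (λ _ → 1) ⟨
          cast (∑ℕ.∑ 𝓥 (λ _ → 1))
            ≡⟨ cong cast (count-vectors n) ⟩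
          cast (card ℕ.^ n)
            ≈⟨ *-identityˡ _ ⟨
          1# * cast (card ℕ.^ n) ∎
        go (no ≢0) with nonzero-entry (B ⊛ w) ≢0 | trace-surjective t t-fixed
        ... | i , b≢0 | y , tr-y = ≈-trans
          (∑-eigen enumV (λ v a → v a +ᶠ v₀ a) (λ v a → v a -ᶠ v₀ a) (shift-to v₀) (shift-from v₀)
            (λ v → χ (cross w v)) (λ u v e → χ-cong (cong₂ _+ᶠ_ (sesq-cong B (λ _ → ≡.refl) e) (sesq-cong B e (λ _ → ≡.refl))))
            (χ t)
            (λ v → begin
              χ (cross w (λ a → v a +ᶠ v₀ a))    ≡⟨ cong χ (cross-shift v) ⟩
              χ (t +ᶠ cross w v)                 ≈⟨ χ-+ t (cross w v) t-fixed (cross-fixed w v) ⟩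
              χ t * χ (cross w v)                ∎)
            χt≉1)
          (≈-sym (zeroˡ _))
          where
          b = (B ⊛ w) i
          -- Chosen so that `sesq B v₀ w`, which is `conj x` times `b`, equals `y`, whose trace is
          -- `t`.
          x = conj (y *ᶠ inv b b≢0)
          v₀ : Vector n
          v₀ a = δ i a *ᶠ x
          sesq-v₀ : sesq B v₀ w ≡ y
          sesq-v₀ = trans (sesq-basis B w i x) (trans (cong (_*ᶠ b) (conj-conj _))
            (trans (FR.*-assoc _ _ _) (trans (cong (y *ᶠ_) (trans (FR.*-comm _ _) (inv-r b b≢0))) (FR.*-identityʳ y))))
          cross-v₀ : cross w v₀ ≡ t
          cross-v₀ = trans (cross-trace w v₀) (trans (cong (λ z → conj z +ᶠ z) sesq-v₀) (trans (FR.+-comm _ _) tr-y))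
          cross-shift : ∀ v → cross w (λ a → v a +ᶠ v₀ a) ≡ t +ᶠ cross w v
          cross-shift v = trans (cong₂ _+ᶠ_ (sesq-+ʳ B w v v₀) (sesq-+ˡ B v v₀ w))
            (trans (FS.solve 4 (λ p r s u → (p FS.:+ r) FS.:+ (s FS.:+ u) FS.:= (r FS.:+ u) FS.:+ (p FS.:+ s)) ≡.refl _ _ _ _)
              (cong (_+ᶠ cross w v) cross-v₀))

      -- Rewrite one factor by `S-neg` and substitute `w + v` for the other variable: the argument
      -- of `χ` becomes `form B w` plus `cross w v`. Summing over `v` first leaves only the `w` in
      -- the kernel, and there `form B w` is 0.
      S-squared : S B * S B ≈ cast (nullity B ℕ.* card ℕ.^ n)
      S-squared = begin
        S B * S B
          ≈⟨ *-congˡ S-neg ⟩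
        S B * ∑ 𝓥 (λ v → χ (-ᶠ form B v))
          ≈⟨ ∑-*ˡ 𝓥 (S B) _ ⟩
        ∑ 𝓥 (λ v → S B * χ (-ᶠ form B v))
          ≈⟨ ∑-cong 𝓥 (λ v → *-congʳ (∑-reindex enumV enumV (λ w i → w i +ᶠ v i) (λ w i → w i -ᶠ v i)
               (shift-to v) (shift-from v) (λ u → χ (form B u)) (form-resp B))) ⟩
        ∑ 𝓥 (λ v → ∑ 𝓥 (λ w → χ (form B (λ i → w i +ᶠ v i))) * χ (-ᶠ form B v))
          ≈⟨ ∑-cong 𝓥 (λ v → ≈-trans (∑-*ʳ 𝓥 _ _) (∑-cong 𝓥 (λ w → term v w))) ⟩
        ∑ 𝓥 (λ v → ∑ 𝓥 (λ w → χ (form B w) * χ (cross w v)))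
          ≈⟨ ∑-swap 𝓥 𝓥 _ ⟩
        ∑ 𝓥 (λ w → ∑ 𝓥 (λ v → χ (form B w) * χ (cross w v)))
          ≈⟨ ∑-cong 𝓥 (λ w → begin
               ∑ 𝓥 (λ v → χ (form B w) * χ (cross w v))
                 ≈⟨ ∑-*ˡ 𝓥 _ _ ⟨
               χ (form B w) * ∑ 𝓥 (λ v → χ (cross w v))
                 ≈⟨ *-congˡ (∑-cross w) ⟩
               χ (form B w) * (⟦ B ⊛ w ≋? 0ᵛ ⟧ * cast (card ℕ.^ n))
                 ≈⟨ RS.solve 3 (λ x y z → x RS.:* (y RS.:* z) RS.:= y RS.:* x RS.:* z) refl _ _ _ ⟩
               ⟦ B ⊛ w ≋? 0ᵛ ⟧ * χ (form B w) * cast (card ℕ.^ n)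
                 ≈⟨ *-congʳ (⟦⟧-guard (B ⊛ w ≋? 0ᵛ) (λ e → ≈-trans (χ-cong (sesq-kernelʳ B w w e)) χ-0)) ⟩
               ⟦ B ⊛ w ≋? 0ᵛ ⟧ * 1# * cast (card ℕ.^ n)
                 ≈⟨ *-congʳ (*-identityʳ _) ⟩
               ⟦ B ⊛ w ≋? 0ᵛ ⟧ * cast (card ℕ.^ n) ∎) ⟩
        ∑ 𝓥 (λ w → ⟦ B ⊛ w ≋? 0ᵛ ⟧ * cast (card ℕ.^ n))
          ≈⟨ ∑-*ʳ 𝓥 _ _ ⟨
        ∑ 𝓥 (λ w → ⟦ B ⊛ w ≋? 0ᵛ ⟧) * cast (card ℕ.^ n)
          ≈⟨ *-congʳ (cast-count 𝓥 (λ w → B ⊛ w ≋? 0ᵛ)) ⟨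
        cast (nullity B) * cast (card ℕ.^ n)
          ≈⟨ cast-* (nullity B) _ ⟨
        cast (nullity B ℕ.* card ℕ.^ n) ∎
        where
        term : ∀ v w → χ (form B (λ i → w i +ᶠ v i)) * χ (-ᶠ form B v) ≈ χ (form B w) * χ (cross w v)
        term v w = begin
          χ (form B (λ i → w i +ᶠ v i)) * χ (-ᶠ form B v)
            ≈⟨ χ-+ _ _ (form-fixed B B-herm _) (fixed-neg (form-fixed B B-herm v)) ⟨
          χ (form B (λ i → w i +ᶠ v i) -ᶠ form B v)
            ≡⟨ cong χ (trans (cong (_-ᶠ form B v) (form-+ B w v))
                 (FS.solve 3 (λ x y z → (x FS.:+ y FS.:+ z) FS.:- x FS.:= z FS.:+ y) ≡.refl _ _ _)) ⟩
          χ (form B w +ᶠ cross w v)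
            ≈⟨ χ-+ _ _ (form-fixed B B-herm w) (cross-fixed w v) ⟩
          χ (form B w) * χ (cross w v) ∎

    -- Both sums have the same square, and both are 1 modulo q + 1 ≥ 3, so they cannot be opposite.
    S-rank : ∀ B D → Hermitian B → Hermitian D → rank B ≡ rank D → S B ≈ S D
    S-rank B D B-herm D-herm rB≡rD = [ RP.x∙y⁻¹≈ε⇒x≈y (S B) (S D) , (λ e → contradiction e opposite) ]′
      (noZeroDivisors (S B - S D) (S B + S D) (begin
        (S B - S D) * (S B + S D)
          ≈⟨ RS.solve 2 (λ x y → (x RS.:- y) RS.:* (x RS.:+ y) RS.:= x RS.:* x RS.:- y RS.:* y) refl _ _ ⟩
        S B * S B - S D * S D
          ≈⟨ +-cong (S-squared B B-herm) (-‿cong (S-squared D D-herm)) ⟩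
        cast (nullity B ℕ.* card ℕ.^ n) - cast (nullity D ℕ.* card ℕ.^ n)
          ≡⟨ cong (λ k → cast (k ℕ.* card ℕ.^ n) - cast (nullity D ℕ.* card ℕ.^ n)) nullity≡ ⟩
        cast (nullity D ℕ.* card ℕ.^ n) - cast (nullity D ℕ.* card ℕ.^ n)
          ≈⟨ -‿inverseʳ _ ⟩
        0# ∎))
      where
      nullity≡ : nullity B ≡ nullity D
      nullity≡ = ℕₚ.*-cancelʳ-≡ _ _ (card ℕ.^ rank D)
        {{ℕ.>-nonZero (ℕₚ.m^n>0 card {{ℕ.>-nonZero (ℕₚ.<-trans ℕₚ.0<1+n 1<card)}} (rank D))}}
        (trans (subst (λ r → nullity B ℕ.* card ℕ.^ r ≡ card ℕ.^ n) rB≡rD (nullity-rank B)) (sym (nullity-rank D)))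
      opposite : ¬ (S B + S D ≈ 0#)
      opposite e = contradiction (∣⇒≤ q+1∣2) (ℕₚ.<⇒≱ (s≤s 2≤q))
        where
        a₁ = levelℕ B B-herm 1ᶠ
        a₀ = levelℕ B B-herm 0ᶠ
        b₁ = levelℕ D D-herm 1ᶠ
        b₀ = levelℕ D D-herm 0ᶠ
        equation : suc q ℕ.* a₁ ℕ.+ suc q ℕ.* b₁ ≡ suc (suc q ℕ.* a₀) ℕ.+ suc (suc q ℕ.* b₀)
        equation = cast-injective _ _ (begin
          cast (suc q ℕ.* a₁ ℕ.+ suc q ℕ.* b₁)
            ≈⟨ cast-+ (suc q ℕ.* a₁) _ ⟩
          cast (suc q ℕ.* a₁) + cast (suc q ℕ.* b₁)
            ≈⟨ +-identityˡ _ ⟨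
          0# + (cast (suc q ℕ.* a₁) + cast (suc q ℕ.* b₁))
            ≈⟨ +-congʳ e ⟨
          S B + S D + (cast (suc q ℕ.* a₁) + cast (suc q ℕ.* b₁))
            ≈⟨ RS.solve 4 (λ x y z w → x RS.:+ y RS.:+ (z RS.:+ w) RS.:= (x RS.:+ z) RS.:+ (y RS.:+ w)) refl _ _ _ _ ⟩
          (S B + cast (suc q ℕ.* a₁)) + (S D + cast (suc q ℕ.* b₁))
            ≈⟨ +-cong (S-mod-q+1 B B-herm) (S-mod-q+1 D D-herm) ⟩
          cast (suc (suc q ℕ.* a₀)) + cast (suc (suc q ℕ.* b₀))
            ≈⟨ cast-+ (suc (suc q ℕ.* a₀)) _ ⟨
          cast (suc (suc q ℕ.* a₀) ℕ.+ suc (suc q ℕ.* b₀)) ∎)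
        q+1∣2 : suc q ∣ 2
        q+1∣2 = ∣m+n∣m⇒∣n
          (subst (suc q ∣_)
            (trans equation (Data.Nat.Solver.+-*-Solver.solve 2
              (λ x y → (con 1 :+ x) :+ (con 1 :+ y) := (x :+ y) :+ con 2) ≡.refl (suc q ℕ.* a₀) (suc q ℕ.* b₀)))
            (∣m∣n⇒∣m+n (m∣m*n a₁) (m∣m*n b₁)))
          (∣m∣n⇒∣m+n (m∣m*n a₀) (m∣m*n b₀))
          where open Data.Nat.Solver.+-*-Solver using (con; _:+_; _:=_)

-- The enumeration contains a copy of the witness that also satisfies `P`. Term by term the sum
-- dominates the indicators of equality with the witness, which add up to 1.
∑ℕ-positive : ∀ {a r p} {A : Set a} {_~_ : Rel A r} {_≟_ : Decidable _~_} {L : List A} →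
              ∑ℕ.Enumerates _≟_ L → {P : A → Set p} (P? : ∀ x → Dec (P x)) →
              (∀ {x y} → x ~ y → P y → P x) → ∀ y → P y → 1 ≤ ∑ℕ.∑ L (λ x → ∑ℕ.⟦ P? x ⟧)
∑ℕ-positive {_≟_ = _≟_} {L = L} enum P? P-resp y py =
  subst (_≤ _) (∑ℕ.once enum y) (∑ℕ-≤ L bound)
  where
  bound : ∀ x → ∑ℕ.⟦ x ≟ y ⟧ ≤ ∑ℕ.⟦ P? x ⟧
  bound x with x ≟ y
  ... | no _    = z≤n
  ... | yes x~y = ℕₚ.≤-reflexive (sym (∑ℕ.⟦⟧-yes (P? x) (P-resp x~y py)))

-- The first dual coefficient of the zero-diagonal matrices

module ZeroDiagonal (F : FiniteField) (q : ℕ) (q-primePower : IsPrimePower q)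
                    (card≡ : FiniteField.card F ≡ q ℕ.* q)
                    {c ℓ : Level} (R : CommutativeRing c ℓ) (domain : IntegralDomainChar0 R)
                    (χ : FiniteField.Carrier F → CommutativeRing.Carrier R)
                    (χ-character : NontrivialCharacter F q R χ) (n : ℕ) where
  open FiniteField F using (elements; card; _≟_) renaming
    (Carrier to 𝔽; _+_ to _+ᶠ_; _*_ to _*ᶠ_; -_ to -ᶠ_; _-_ to _-ᶠ_; 0# to 0ᶠ; 1# to 1ᶠ; 0≢1 to 0ᶠ≢1ᶠ)
  open Matrices F q hiding (_*)
  open Field F hiding (commutativeRing)
  open QuadraticExtension F q q-primePower card≡
  open LinearAlgebra F q
  open HermitianForms F q q-primePower card≡
  open CommutativeRing R renaming (sym to ≈-sym; trans to ≈-trans)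
  open NontrivialCharacter χ-character
  open Sums commutativeSemiring
  open CharacterSums F q q-primePower card≡ R domain χ χ-character
  open Size n
  open import Relation.Binary.Reasoning.Setoid setoid
  private
    module RP = Algebra.Properties.Ring ring
    module RS = IntegerSolver R
    module FS = IntegerSolver (Field.commutativeRing F)
    𝓥 = allVectors n
    𝓜 = allMatrices n
    𝓩 = Designs.zeroDiagonal F q R n

  ZeroDiag : Matrix n → Set
  ZeroDiag A = Hermitian A × (∀ i → A i i ≡ 0ᶠ)

  zeroDiag? : ∀ A → Dec (ZeroDiag A)
  zeroDiag? A = hermitian? A ×-dec Finₚ.all? (λ i → A i i ≟ 0ᶠ)

  zeroDiag-cong : ∀ {A B} → Pointwise _≋_ A B → ZeroDiag A → ZeroDiag B
  zeroDiag-cong {A} {B} e (h , d) = hermitian-cong A B e h , λ i → trans (sym (e i i)) (d i)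

  ∑-zeroDiagonal : ∀ f → ∑ 𝓩 f ≈ ∑ 𝓜 (λ A → ⟦ zeroDiag? A ⟧ * f A)
  ∑-zeroDiagonal f = begin
    ∑ 𝓩 f
      ≈⟨ ∑-filter _ (hermitian n) f ⟩
    ∑ (hermitian n) (λ A → ⟦ diagB A Boolₚ.≟ true ⟧ * f A)
      ≈⟨ ∑-hermitian _ ⟩
    ∑ 𝓜 (λ A → ⟦ hermitian? A ⟧ * (⟦ diagB A Boolₚ.≟ true ⟧ * f A))
      ≈⟨ ∑-cong 𝓜 (λ A → *-congˡ (*-congʳ (⟦⟧-cong (diagB A Boolₚ.≟ true) (diag? A)
           (λ e i → does⁻ (A i i ≟ 0ᶠ) (allB⁻ _ e i)) (λ d → allB⁺ _ (λ i → does⁺ (A i i ≟ 0ᶠ) (d i)))))) ⟩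
    ∑ 𝓜 (λ A → ⟦ hermitian? A ⟧ * (⟦ diag? A ⟧ * f A))
      ≈⟨ ∑-cong 𝓜 (λ A → ≈-trans (≈-sym (*-assoc _ _ _)) (*-congʳ (≈-sym (⟦⟧-× (hermitian? A) (diag? A))))) ⟩
    ∑ 𝓜 (λ A → ⟦ zeroDiag? A ⟧ * f A) ∎
    where
    diagB : Matrix n → Bool
    diagB A = allB (λ i → does (A i i ≟ 0ᶠ))
    diag? : ∀ A → Dec (∀ i → A i i ≡ 0ᶠ)
    diag? A = Finₚ.all? (λ i → A i i ≟ 0ᶠ)

  fromℕ≡cast : ∀ k → Designs.fromℕ F q R k ≡ cast k
  fromℕ≡cast zero    = ≡.refl
  fromℕ≡cast (suc k) = cong (1# +_) (fromℕ≡cast k)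

  Q₁ : ℕ → Carrier
  Q₁ = Designs.Q F q R {n} χ 1

  scaledDual₁ : Carrier
  scaledDual₁ = Designs.scaledDual F q R {n} χ 𝓩 1

  pairCount-∑ : ∀ i → Designs.fromℕ F q R (Designs.pairCount F q R {n} χ 𝓩 i) ≈
                ∑ 𝓩 (λ X → ∑ 𝓩 (λ Y → ⟦ rank (X -ᴹ Y) ℕ.≟ i ⟧))
  pairCount-∑ i = begin
    Designs.fromℕ F q R (Designs.pairCount F q R {n} χ 𝓩 i)
      ≡⟨ trans (fromℕ≡cast (Designs.pairCount F q R {n} χ 𝓩 i)) (cong cast (length-filter rank? (List.cartesianProduct 𝓩 𝓩))) ⟩
    cast (∑ℕ.∑ (List.cartesianProduct 𝓩 𝓩) (λ XY → ∑ℕ.⟦ rank? XY ⟧))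
      ≈⟨ cast-count (List.cartesianProduct 𝓩 𝓩) rank? ⟩
    ∑ (List.cartesianProduct 𝓩 𝓩) (λ XY → ⟦ rank? XY ⟧)
      ≈⟨ ∑-cartesianProduct 𝓩 𝓩 _ ⟩
    ∑ 𝓩 (λ X → ∑ 𝓩 (λ Y → ⟦ rank (X -ᴹ Y) ℕ.≟ i ⟧)) ∎
    where
    rank? : ∀ XY → Dec (rank (proj₁ XY -ᴹ proj₂ XY) ≡ i)
    rank? XY = rank (proj₁ XY -ᴹ proj₂ XY) ℕ.≟ i

  -- Undoes the grouping of pairs by the rank of their difference: each pair meets exactly one index
  -- of the outer sum, since ranks are at most `n`.
  scaledDual-∑ : scaledDual₁ ≈ ∑ 𝓩 (λ X → ∑ 𝓩 (λ Y → Q₁ (rank (X -ᴹ Y))))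
  scaledDual-∑ = begin
    scaledDual₁
      ≡⟨ sumR≡∑ ranks _ ⟩
    ∑ ranks (λ i → Q₁ i * Designs.fromℕ F q R (Designs.pairCount F q R {n} χ 𝓩 i))
      ≈⟨ ∑-cong ranks (λ i → ≈-trans (*-congˡ (pairCount-∑ i))
           (≈-trans (∑-*ˡ 𝓩 _ _) (∑-cong 𝓩 (λ X → ∑-*ˡ 𝓩 _ _)))) ⟩
    ∑ ranks (λ i → ∑ 𝓩 (λ X → ∑ 𝓩 (λ Y → Q₁ i * ⟦ rank (X -ᴹ Y) ℕ.≟ i ⟧)))
      ≈⟨ ≈-trans (∑-swap ranks 𝓩 _) (∑-cong 𝓩 (λ X → ∑-swap ranks 𝓩 _)) ⟩
    ∑ 𝓩 (λ X → ∑ 𝓩 (λ Y → ∑ ranks (λ i → Q₁ i * ⟦ rank (X -ᴹ Y) ℕ.≟ i ⟧)))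
      ≈⟨ ∑-cong 𝓩 (λ X → ∑-cong 𝓩 (λ Y → pick (rank (X -ᴹ Y)) (rank≤ (X -ᴹ Y)))) ⟩
    ∑ 𝓩 (λ X → ∑ 𝓩 (λ Y → Q₁ (rank (X -ᴹ Y)))) ∎
    where
    ranks = List.upTo (suc n)
    pick : ∀ r → r ≤ n → ∑ ranks (λ i → Q₁ i * ⟦ r ℕ.≟ i ⟧) ≈ Q₁ r
    pick r r≤n = ≈-trans
      (∑-cong ranks (λ i → ≈-trans (*-comm _ _) (*-congʳ (⟦⟧-cong (r ℕ.≟ i) (i ℕ.≟ r) sym sym))))
      (∑-pick ℕ._≟_ ranks r (∑-unique ℕ._≟_ (Uniqueₚ.upTo⁺ (suc n)) (∈ₚ.∈-upTo⁺ (s≤s r≤n))) Q₁ (λ { _ ≡.refl → refl }))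

  -- `Q₁` is evaluated at the diagonal representative `D`, which has the same rank as `B`; `S-rank`
  -- moves the value from `D` to `B`, and removing the contribution 1 of the zero vector turns `S`
  -- into `S₀`.
  Q₁-rank : ∀ B → Hermitian B → cast (suc q) * Q₁ (rank B) ≈ S₀ B
  Q₁-rank B herm = ≈-trans (Q′-S₀ D) (RP.+-cancelˡ 1# _ _ (≈-trans (≈-sym (S-split D))
    (≈-trans (S-rank D B (diagOnes-hermitian n (rank B)) herm (rank-diagOnes (rank≤ B))) (S-split B))))
    where D = diagOnes n (rank B)

  z : Matrix n → Carrier
  z A = ⟦ zeroDiag? A ⟧

  -- Membership in the code is a weight `z` and the sums run over all matrices, because that full
  -- list is the one known to be an enumeration and hence open to reindexing by a translation. The
  -- argument `X` comes last as the variable to be translated.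
  twisted : Vector n → Matrix n → Matrix n → Carrier
  twisted v Y X = z X * (z Y * χ (form (X -ᴹ Y) v))

  dual-∑ : cast (suc q) * scaledDual₁ ≈
           ∑ 𝓥 (λ v → ⟦ nonzero-vec? v ⟧ * ∑ 𝓜 (λ Y → ∑ 𝓜 (twisted v Y)))
  dual-∑ = begin
    cast (suc q) * scaledDual₁
      ≈⟨ *-congˡ (≈-trans scaledDual-∑ (≈-trans (∑-zeroDiagonal _)
           (∑-cong 𝓜 (λ X → ≈-trans (*-congˡ (∑-zeroDiagonal _)) (∑-*ˡ 𝓜 _ _))))) ⟩
    cast (suc q) * ∑ 𝓜 (λ X → ∑ 𝓜 (λ Y → z X * (z Y * Q₁ (rank (X -ᴹ Y)))))
      ≈⟨ ≈-trans (∑-*ˡ 𝓜 _ _) (∑-cong 𝓜 (λ X → ≈-trans (∑-*ˡ 𝓜 _ _) (∑-cong 𝓜 (λ Y → term X Y)))) ⟩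
    ∑ 𝓜 (λ X → ∑ 𝓜 (λ Y → ∑ 𝓥 (λ v → ⟦ nonzero-vec? v ⟧ * twisted v Y X)))
      ≈⟨ ≈-trans (∑-swap 𝓜 𝓜 _) (∑-cong 𝓜 (λ Y → ∑-swap 𝓜 𝓥 _)) ⟩
    ∑ 𝓜 (λ Y → ∑ 𝓥 (λ v → ∑ 𝓜 (λ X → ⟦ nonzero-vec? v ⟧ * twisted v Y X)))
      ≈⟨ ∑-swap 𝓜 𝓥 _ ⟩
    ∑ 𝓥 (λ v → ∑ 𝓜 (λ Y → ∑ 𝓜 (λ X → ⟦ nonzero-vec? v ⟧ * twisted v Y X)))
      ≈⟨ ∑-cong 𝓥 (λ v → ≈-trans (∑-*ˡ 𝓜 _ _) (∑-cong 𝓜 (λ Y → ∑-*ˡ 𝓜 _ _))) ⟨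
    ∑ 𝓥 (λ v → ⟦ nonzero-vec? v ⟧ * ∑ 𝓜 (λ Y → ∑ 𝓜 (twisted v Y))) ∎
    where
    term : ∀ X Y → cast (suc q) * (z X * (z Y * Q₁ (rank (X -ᴹ Y)))) ≈
                   ∑ 𝓥 (λ v → ⟦ nonzero-vec? v ⟧ * twisted v Y X)
    term X Y = begin
      cast (suc q) * (z X * (z Y * Q₁ (rank (X -ᴹ Y))))
        ≈⟨ RS.solve 4 (λ k x y r → k RS.:* (x RS.:* (y RS.:* r)) RS.:= x RS.:* (y RS.:* (k RS.:* r))) refl _ _ _ _ ⟩
      z X * (z Y * (cast (suc q) * Q₁ (rank (X -ᴹ Y))))
        ≈⟨ ⟦⟧-guard (zeroDiag? X) (λ (hX , _) → ⟦⟧-guard (zeroDiag? Y) (λ (hY , _) →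
             Q₁-rank (X -ᴹ Y) (hermitian-minus X Y hX hY))) ⟩
      z X * (z Y * S₀ (X -ᴹ Y))
        ≈⟨ ≈-trans (*-congˡ (∑-*ˡ 𝓥 _ _)) (∑-*ˡ 𝓥 _ _) ⟩
      ∑ 𝓥 (λ v → z X * (z Y * (⟦ nonzero-vec? v ⟧ * χ (form (X -ᴹ Y) v))))
        ≈⟨ ∑-cong 𝓥 (λ v → RS.solve 4 (λ k x y r → x RS.:* (y RS.:* (k RS.:* r)) RS.:= k RS.:* (x RS.:* (y RS.:* r))) refl _ _ _ _) ⟩
      ∑ 𝓥 (λ v → ⟦ nonzero-vec? v ⟧ * twisted v Y X) ∎

  Separated : Vector n → Fin n → Fin n → Set
  Separated v i j = i ≢ j → v i ≡ 0ᶠ ⊎ v j ≡ 0ᶠ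

  AtMostOne : Vector n → Set
  AtMostOne v = ∀ i j → Separated v i j

  separated? : ∀ v i j → Dec (Separated v i j)
  separated? v i j = ¬? (i Finₚ.≟ j) →-dec ((v i ≟ 0ᶠ) ⊎-dec (v j ≟ 0ᶠ))

  atMostOne? : ∀ v → Dec (AtMostOne v)
  atMostOne? v = Finₚ.all? (λ i → Finₚ.all? (separated? v i))

  two-entries : ∀ v → ¬ AtMostOne v → ∃ λ i → ∃ λ j → i ≢ j × v i ≢ 0ᶠ × v j ≢ 0ᶠ
  two-entries v ¬one with Finₚ.¬∀⟶∃¬ n _ (λ i → Finₚ.all? (separated? v i)) ¬one
  ... | i , ¬i with Finₚ.¬∀⟶∃¬ n _ (separated? v i) ¬i
  ... | j , ¬ij = i , j
    , (λ i≡j → ¬ij (λ i≢j → contradiction i≡j i≢j))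
    , (λ vi≡0 → ¬ij (λ _ → inj₁ vi≡0))
    , (λ vj≡0 → ¬ij (λ _ → inj₂ vj≡0))

  m : Carrier
  m = ∑ 𝓜 z

  -- Translating X by a zero-diagonal Z with χ(v*Zv) ≠ 1 multiplies the sum by χ(v*Zv).
  ∑-twisted-zero : ∀ v → ¬ AtMostOne v → ∀ Y → ∑ 𝓜 (twisted v Y) ≈ 0#
  ∑-twisted-zero v ¬one Y with two-entries v ¬one | trace-surjective t t-fixed
  ... | i , j , i≢j , vi≢0 , vj≢0 | y , tr-y = ∑-eigen enumM
      (λ X a b → X a b +ᶠ Z a b) (λ X a b → X a b -ᶠ Z a b)
      (λ X X′ e a b → trans (sym (-ᶠ+ᶠ (X a b) (Z a b))) (cong (_+ᶠ Z a b) (sym (e a b))))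
      (λ X X′ e a b → trans (sym (+ᶠ-ᶠ (X′ a b) (Z a b))) (cong (_-ᶠ Z a b) (sym (e a b))))
      (twisted v Y)
      (λ X X′ e → *-cong
        (⟦⟧-cong (zeroDiag? X) (zeroDiag? X′) (zeroDiag-cong e) (zeroDiag-cong (λ a b → sym (e a b))))
        (*-congˡ (χ-cong (form-matrix-cong (X -ᴹ Y) (X′ -ᴹ Y) (λ a b → cong (_-ᶠ Y a b) (e a b)) v))))
      (χ t) shift χt≉1
    where
    s = conj (v i) *ᶠ v j
    s≢0 : s ≢ 0ᶠ
    s≢0 = *-nonzero (conj-nonzero vi≢0) vj≢0
    -- Makes `s` times `x` equal to `y`, so the form of `Z` at `v` is `y` plus its conjugate, which
    -- is `t`.
    x = inv s s≢0 *ᶠ y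
    Z = elementary i j x
    Z-zeroDiag : ZeroDiag Z
    Z-zeroDiag = elementary-hermitian i j x , elementary-diagonal i≢j x
    form-Z : form Z v ≡ t
    form-Z = trans (form-elementary i j x v) (trans (cong (λ w → w +ᶠ conj w)
      (trans (sym (FR.*-assoc _ _ _)) (trans (cong (_*ᶠ y) (inv-r s s≢0)) (FR.*-identityˡ y)))) tr-y)
    zeroDiag-+ : ∀ {A B} → ZeroDiag A → ZeroDiag B → ZeroDiag (λ a b → A a b +ᶠ B a b)
    zeroDiag-+ {A} {B} (hA , dA) (hB , dB) =
      hermitian-+ A B hA hB , λ a → trans (cong₂ _+ᶠ_ (dA a) (dB a)) (FR.+-identityˡ 0ᶠ)
    zeroDiag-neg : ∀ {A} → ZeroDiag A → ZeroDiag (λ a b → -ᶠ A a b)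
    zeroDiag-neg (h , d) = (λ a b → trans (conj-neg _) (cong -ᶠ_ (h a b))) , λ a → trans (cong -ᶠ_ (d a)) FP.-0#≈0#
    shift : ∀ X → twisted v Y (λ a b → X a b +ᶠ Z a b) ≈ χ t * twisted v Y X
    shift X = begin
      z X+Z * (z Y * χ (form (X+Z -ᴹ Y) v))
        ≈⟨ *-congʳ (⟦⟧-cong (zeroDiag? X+Z) (zeroDiag? X)
             (λ h → zeroDiag-cong (λ a b → +ᶠ-ᶠ (X a b) (Z a b)) (zeroDiag-+ h (zeroDiag-neg Z-zeroDiag)))
             (λ h → zeroDiag-+ h Z-zeroDiag)) ⟩
      z X * (z Y * χ (form (X+Z -ᴹ Y) v))
        ≈⟨ ⟦⟧-guard (zeroDiag? X) (λ (hX , _) → ⟦⟧-guard (zeroDiag? Y) (λ (hY , _) →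
             ≈-trans (χ-cong split-form)
               (χ-+ t (form (X -ᴹ Y) v) t-fixed (form-fixed (X -ᴹ Y) (hermitian-minus X Y hX hY) v)))) ⟩
      z X * (z Y * (χ t * χ (form (X -ᴹ Y) v)))
        ≈⟨ RS.solve 4 (λ k x y r → x RS.:* (y RS.:* (k RS.:* r)) RS.:= k RS.:* (x RS.:* (y RS.:* r))) refl _ _ _ _ ⟩
      χ t * twisted v Y X ∎
      where
      X+Z : Matrix n
      X+Z a b = X a b +ᶠ Z a b
      split-form : form (X+Z -ᴹ Y) v ≡ t +ᶠ form (X -ᴹ Y) v
      split-form = trans
        (form-matrix-cong _ (λ a b → Z a b +ᶠ (X -ᴹ Y) a b) (λ a b →
          FS.solve 3 (λ x z y → (x FS.:+ z) FS.:- y FS.:= z FS.:+ (x FS.:- y)) ≡.refl (X a b) (Z a b) (Y a b)) v)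
        (trans (form-matrix-+ Z (X -ᴹ Y) v) (cong (_+ᶠ form (X -ᴹ Y) v) form-Z))

  ∑-twisted : ∀ v → ∑ 𝓜 (λ Y → ∑ 𝓜 (twisted v Y)) ≈ ⟦ atMostOne? v ⟧ * (m * m)
  ∑-twisted v = go (atMostOne? v)
    where
    go : (d : Dec (AtMostOne v)) → ∑ 𝓜 (λ Y → ∑ 𝓜 (twisted v Y)) ≈ ⟦ d ⟧ * (m * m)
    go (no ¬one) = ≈-trans (∑-zero 𝓜 (∑-twisted-zero v ¬one)) (≈-sym (zeroˡ _))
    go (yes one) = begin
      ∑ 𝓜 (λ Y → ∑ 𝓜 (twisted v Y))
        ≈⟨ ∑-cong 𝓜 (λ Y → ∑-cong 𝓜 (λ X → ⟦⟧-guard (zeroDiag? X) (λ (_ , dX) →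
             ≈-trans (⟦⟧-guard (zeroDiag? Y) (λ (_ , dY) → ≈-trans
               (χ-cong (form-single (X -ᴹ Y) v (λ i → trans (cong₂ _-ᶠ_ (dX i) (dY i)) (FR.-‿inverseʳ 0ᶠ)) one)) χ-0))
               (*-identityʳ _)))) ⟩
      ∑ 𝓜 (λ Y → ∑ 𝓜 (λ X → z X * z Y))
        ≈⟨ ∑-cong 𝓜 (λ Y → ∑-*ʳ 𝓜 (z Y) z) ⟨
      ∑ 𝓜 (λ Y → m * z Y)
        ≈⟨ ∑-*ˡ 𝓜 m z ⟨
      m * m
        ≈⟨ *-identityˡ _ ⟨
      1# * (m * m) ∎

  -- `lines` counts the nonzero vectors on the coordinate axes, exactly those on which every
  -- zero-diagonal form vanishes. Natural numbers are used so that positivity can be stated.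
  zeroDiagonals lines : ℕ
  zeroDiagonals = ∑ℕ.∑ 𝓜 (λ A → ∑ℕ.⟦ zeroDiag? A ⟧)
  lines = ∑ℕ.∑ 𝓥 (λ v → ∑ℕ.⟦ nonzero-vec? v ×-dec atMostOne? v ⟧)

  dual-count : cast (suc q) * scaledDual₁ ≈ cast (lines ℕ.* (zeroDiagonals ℕ.* zeroDiagonals))
  dual-count = begin
    cast (suc q) * scaledDual₁
      ≈⟨ dual-∑ ⟩
    ∑ 𝓥 (λ v → ⟦ nonzero-vec? v ⟧ * ∑ 𝓜 (λ Y → ∑ 𝓜 (twisted v Y)))
      ≈⟨ ∑-cong 𝓥 (λ v → ≈-trans (*-congˡ (∑-twisted v)) (≈-trans (≈-sym (*-assoc _ _ _))
           (*-congʳ (≈-sym (⟦⟧-× (nonzero-vec? v) (atMostOne? v)))))) ⟩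
    ∑ 𝓥 (λ v → ⟦ nonzero-vec? v ×-dec atMostOne? v ⟧ * (m * m))
      ≈⟨ ∑-*ʳ 𝓥 (m * m) _ ⟨
    ∑ 𝓥 (λ v → ⟦ nonzero-vec? v ×-dec atMostOne? v ⟧) * (m * m)
      ≈⟨ *-cong (cast-count 𝓥 (λ v → nonzero-vec? v ×-dec atMostOne? v))
           (*-cong (cast-count 𝓜 zeroDiag?) (cast-count 𝓜 zeroDiag?)) ⟨
    cast lines * (cast zeroDiagonals * cast zeroDiagonals)
      ≈⟨ *-congˡ (cast-* zeroDiagonals zeroDiagonals) ⟨
    cast lines * cast (zeroDiagonals ℕ.* zeroDiagonals)
      ≈⟨ cast-* lines _ ⟨
    cast (lines ℕ.* (zeroDiagonals ℕ.* zeroDiagonals)) ∎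

  zeroDiagonals-positive : 1 ≤ zeroDiagonals
  zeroDiagonals-positive = ∑ℕ-positive (enumerates-matrices ℕₚ.+-*-commutativeSemiring n) zeroDiag?
    (λ e → zeroDiag-cong (λ a b → sym (e a b))) (λ _ _ → 0ᶠ) ((λ _ _ → conj-0) , λ _ → ≡.refl)

  -- The unit vector `δ i` lies on an axis. The index `i` is where the assumption that `n` is at
  -- least 1 enters.
  lines-positive : Fin n → 1 ≤ lines
  lines-positive i = ∑ℕ-positive (enumerates-vectors ℕₚ.+-*-commutativeSemiring n)
    (λ v → nonzero-vec? v ×-dec atMostOne? v)
    (λ e (v≢0 , one) → (λ u≋0 → v≢0 (λ a → trans (sym (e a)) (u≋0 a)))
      , λ a b a≢b → [ (λ va → inj₁ (trans (e a) va)) , (λ vb → inj₂ (trans (e b) vb)) ]′ (one a b a≢b))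
    (δ i) ((λ δ≋0 → 0ᶠ≢1ᶠ (trans (sym (δ≋0 i)) (δ-diag i))) , one)
    where
    one : AtMostOne (δ i)
    one a b a≢b with i Finₚ.≟ a
    ... | no i≢a     = inj₁ ≡.refl
    ... | yes ≡.refl = inj₂ (δ-off a≢b)

  scaledDual-nonzero : Fin n → ¬ (scaledDual₁ ≈ 0#)
  scaledDual-nonzero i e = contradiction
    (cast-injective _ 0 (≈-trans (≈-sym dual-count) (≈-trans (*-congˡ e) (zeroʳ _))))
    (ℕₚ.<⇒≢ (ℕₚ.*-mono-≤ (lines-positive i) (ℕₚ.*-mono-≤ zeroDiagonals-positive zeroDiagonals-positive)) ∘ sym)

open import Data.Nat using (_*_)

theorem5p4 : (q : ℕ) → IsPrimePower q →
    (F : FiniteField) → FiniteField.card F ≡ q * q →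
    {c ℓ : Level} (R : CommutativeRing c ℓ) → IntegralDomainChar0 R →
    (χ : FiniteField.Carrier F → CommutativeRing.Carrier R) →
    NontrivialCharacter F q R χ →
    (n : ℕ) → 1 ≤ n →
    (t : ℕ) → 1 ≤ t → t ≤ n →
    ¬ Designs.IsDesign F q R {n} χ (Designs.zeroDiagonal F q R n) t
theorem5p4 q q-primePower F card≡ R domain χ χ-character n@(suc _) _ t 1≤t _ design =
  -- As `t` is at least 1, the design condition includes `k = 1`, and that coefficient is already
  -- nonzero.
  ZeroDiagonal.scaledDual-nonzero F q q-primePower card≡ R domain χ χ-character n Fin.zero
    (design 1 ℕₚ.≤-refl 1≤t)
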